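{- Let $n \geq 2$ be an integer, let $p(x) \in \mathcal{T}_n$, and let $r = \deg \mathrm{Min}(p,x)$, where $1 \leq r \leq n$. Let $q(x) \in \mathcal{J}(p(x))$ and let $f(x) = q(x)/\gcd(p(x),p'(x)) \in \mathbb{Z}[x]$. Then there exist nonnegative real numbers $\gamma_1, \dots, \gamma_r$ such that \[ \mathrm{coeff}(f(x-1)) = \sum_{j=1}^r \gamma_j \cdot \mathrm{coeff}(\mathrm{Min}_j(p, x-1)). \]
   Context: A nonzero real polynomial is real-rooted if all its complex roots are real. For $n\ge1$, a Seidel trace polynomial of degree $n$ is a real-rooted polynomial $p(x)=\sum_{i=0}^n a_i x^{n-i}\in\mathbb{Z}[x]$ of degree $n$ with $a_0=1$, $a_1=0$, and $a_2=-\binom{n}{2}$ if $n\ge2$; $\mathcal{T}_n$ is the set of these. For real-rooted $p,q$ with $\deg p = m$, $\deg q = m-1$, roots $\lambda_1\le\dots\le\lambda_m$ of $p$ and $\mu_1\le\dots\le\mu_{m-1}$ of $q$, we say $q$ interlaces $p$ if $\lambda_i \le \mu_i \le \lambda_{i+1}$ for all $i$. For $p\in\mathcal{T}_n$, $\mathcal{J}(p(x))$ is the set of integer polynomials $q(x)$ of degree $n-1$ with $q\in\mathcal{T}_{n-1}$ and $q$ interlacing $p$. Here $\gcd(p(x),p'(x))$ is the monic gcd and $\mathrm{Min}(p,x) := p(x)/\gcd(p(x),p'(x))$. Writing $\mathrm{Min}(p,x) = \prod_{i=1}^r (x-\lambda_i)$ with $\lambda_1<\dots<\lambda_r$, define $\mathrm{Min}_j(p,x)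 := \prod_{1\le i\le r,\, i\ne j}(x-\lambda_i)$ for $j\in\{1,\dots,r\}$, and $\mathrm{Min}_j(p,x-1)$ is obtained by substituting $x-1$ for $x$. For a nonzero polynomial $g(x)$ of degree $m$, $\mathrm{coeff}(g)\in\mathbb{R}^{m+1}$ is its coefficient vector, whose $i$th entry is the coefficient of $x^{m-i+1}$ in $g(x)$. -}

module Defs where

open import Level using (0ℓ; _⊔_)
open import Algebra.Bundles.Raw using (RawRing)
open import Data.Nat.Base as ℕ using (ℕ; zero; suc; _∸_)
import Data.Nat.Properties as ℕₚ
open import Data.Nat.Combinatorics using (_C_)
open import Data.Integer.Base as ℤ using (ℤ)
open import Data.Rational.Base as ℚ using (ℚ; 0ℚ; 1ℚ; ½; ∣_∣)
import Data.Rational.Properties as ℚₚ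
open import Data.Rational.Solver using (module +-*-Solver)
open import Data.Fin.Base as Fin using (Fin; toℕ; inject₁)
open import Data.Fin.Properties using (_≟_)
open import Data.List.Base as List using (List; []; _∷_)
open import Data.Vec.Functional as Vector using (Vector)
open import Data.Product.Base using (Σ-syntax; ∃-syntax; _×_; _,_)
open import Relation.Nullary using (¬_; does)
open import Relation.Binary.PropositionalEquality using (_≡_; refl; sym; trans; cong; cong₂; subst; subst₂)
open import Data.Bool.Base using (if_then_else_)

-- The real numbers are Cauchy sequences of rationals modulo null sequences (_≃_).

IsCauchy : (ℕ → ℚ) → Set
IsCauchy x = ∀ ε → 0ℚ ℚ.< ε →
  ∃[ N ] (∀ m n → N ℕ.≤ m → N ℕ.≤ n → ∣ x m ℚ.- x n ∣ ℚ.< ε)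

record ℝ : Set where
  no-eta-equality
  constructor real
  field
    seq    : ℕ → ℚ
    cauchy : IsCauchy seq

open ℝ public

infix 4 _≃_ _<ᵣ_ _≤ᵣ_

record _≃_ (x y : ℝ) : Set where
  constructor mk≃
  field
    close : ∀ ε → 0ℚ ℚ.< ε →
      ∃[ N ] (∀ n → N ℕ.≤ n → ∣ seq x n ℚ.- seq y n ∣ ℚ.< ε)

record _<ᵣ_ (x y : ℝ) : Set where
  constructor mk<
  field
    separated : ∃[ ε ] (0ℚ ℚ.< ε ×
      ∃[ N ] (∀ n → N ℕ.≤ n → seq x n ℚ.+ ε ℚ.< seq y n))

_≤ᵣ_ : ℝ → ℝ → Set
x ≤ᵣ y = ¬ (y <ᵣ x)

module CauchyBounds where
  open +-*-Solver using (solve; _:=_; _:+_; _:*_; _:-_; :-_)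

  cancel-mid : ∀ a b → a ℚ.- b ℚ.+ b ≡ a
  cancel-mid = solve 2 (λ a b → a :- b :+ b := a) refl

  diff-+ : ∀ a b c d → (a ℚ.- c) ℚ.+ (b ℚ.- d) ≡ (a ℚ.+ b) ℚ.- (c ℚ.+ d)
  diff-+ = solve 4 (λ a b c d → (a :- c) :+ (b :- d) := (a :+ b) :- (c :+ d)) refl

  diff-neg : ∀ a b → b ℚ.- a ≡ (ℚ.- a) ℚ.- (ℚ.- b)
  diff-neg = solve 2 (λ a b → b :- a := (:- a) :- (:- b)) refl

  diff-* : ∀ a b c d → a ℚ.* (b ℚ.- d) ℚ.+ d ℚ.* (a ℚ.- c) ≡ a ℚ.* b ℚ.- c ℚ.* d
  diff-* = solve 4 (λ a b c d → a :* (b :- d) :+ d :* (a :- c) := a :* b :- c :* d) refl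

  halve : ∀ ε → ½ ℚ.* ε ℚ.+ ½ ℚ.* ε ≡ ε
  halve ε = trans (sym (ℚₚ.*-distribʳ-+ ε ½ ½)) (ℚₚ.*-identityˡ ε)

  0<½* : ∀ {ε} → 0ℚ ℚ.< ε → 0ℚ ℚ.< ½ ℚ.* ε
  0<½* {ε} 0<ε = subst (ℚ._< ½ ℚ.* ε) (ℚₚ.*-zeroʳ ½) (ℚₚ.*-monoʳ-<-pos ½ 0<ε)

  bounded : ∀ x → IsCauchy x →
    ∃[ B ] (0ℚ ℚ.< B × ∃[ N ] (∀ n → N ℕ.≤ n → ∣ x n ∣ ℚ.< B))
  bounded x c with c 1ℚ (ℚₚ.positive⁻¹ 1ℚ)
  ... | N , h = B , 0<B , N , λ n N≤n → ℚₚ.≤-<-trans (tri n) (ℚₚ.+-monoˡ-< ∣ x N ∣ (h n N N≤n ℕₚ.≤-refl))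
    where
    B = 1ℚ ℚ.+ ∣ x N ∣
    0<B : 0ℚ ℚ.< B
    0<B = ℚₚ.+-mono-<-≤ {0ℚ} {1ℚ} {0ℚ} (ℚₚ.positive⁻¹ 1ℚ) (ℚₚ.0≤∣p∣ (x N))
    tri : ∀ n → ∣ x n ∣ ℚ.≤ ∣ x n ℚ.- x N ∣ ℚ.+ ∣ x N ∣
    tri n = subst (λ t → ∣ t ∣ ℚ.≤ ∣ x n ℚ.- x N ∣ ℚ.+ ∣ x N ∣)
      (cancel-mid (x n) (x N))
      (ℚₚ.∣p+q∣≤∣p∣+∣q∣ (x n ℚ.- x N) (x N))

  product-bound : ∀ B ε → 0ℚ ℚ.< B → 0ℚ ℚ.< ε →
    ∃[ δ ] (0ℚ ℚ.< δ × (∀ a b → ∣ a ∣ ℚ.< B → ∣ b ∣ ℚ.< δ → ∣ a ℚ.* b ∣ ℚ.< ε))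
  product-bound B ε 0<B 0<ε = δ , 0<δ , λ a b a<B b<δ →
    ℚₚ.≤-<-trans (ℚₚ.≤-reflexive (ℚₚ.∣p*q∣≡∣p∣*∣q∣ a b))
      (ℚₚ.≤-<-trans
        (ℚₚ.*-monoʳ-≤-nonNeg ∣ b ∣ {{ℚ.nonNegative (ℚₚ.0≤∣p∣ b)}} (ℚₚ.<⇒≤ a<B))
        (subst (B ℚ.* ∣ b ∣ ℚ.<_) Bδ≡ε (ℚₚ.*-monoʳ-<-pos B b<δ)))
    where
    instance
      posB : ℚ.Positive B
      posB = ℚ.positive 0<B
      nzB : ℚ.NonZero B
      nzB = ℚₚ.pos⇒nonZero B
      posB⁻¹ : ℚ.Positive (ℚ.1/ B)
      posB⁻¹ = ℚₚ.1/pos⇒pos B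
    δ = (ℚ.1/ B) ℚ.* ε
    0<δ : 0ℚ ℚ.< δ
    0<δ = subst (ℚ._< δ) (ℚₚ.*-zeroʳ (ℚ.1/ B)) (ℚₚ.*-monoʳ-<-pos (ℚ.1/ B) 0<ε)
    Bδ≡ε : B ℚ.* δ ≡ ε
    Bδ≡ε = trans (sym (ℚₚ.*-assoc B (ℚ.1/ B) ε))
      (trans (cong (ℚ._* ε) (ℚₚ.*-inverseʳ B)) (ℚₚ.*-identityˡ ε))

  +-cauchy : ∀ x y → IsCauchy x → IsCauchy y → IsCauchy (λ n → x n ℚ.+ y n)
  +-cauchy x y cx cy ε 0<ε with cx (½ ℚ.* ε) (0<½* 0<ε) | cy (½ ℚ.* ε) (0<½* 0<ε)
  ... | N₁ , h₁ | N₂ , h₂ = N₁ ℕ.⊔ N₂ , λ m n N≤m N≤n →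
    subst₂ (λ s t → ∣ s ∣ ℚ.< t)
      (diff-+ (x m) (y m) (x n) (y n))
      (halve ε)
      (ℚₚ.≤-<-trans (ℚₚ.∣p+q∣≤∣p∣+∣q∣ (x m ℚ.- x n) (y m ℚ.- y n))
        (ℚₚ.+-mono-< (h₁ m n (ℕₚ.m⊔n≤o⇒m≤o N₁ N₂ N≤m) (ℕₚ.m⊔n≤o⇒m≤o N₁ N₂ N≤n))
                     (h₂ m n (ℕₚ.m⊔n≤o⇒n≤o N₁ N₂ N≤m) (ℕₚ.m⊔n≤o⇒n≤o N₁ N₂ N≤n))))

  -‿cauchy : ∀ x → IsCauchy x → IsCauchy (λ n → ℚ.- x n)
  -‿cauchy x cx ε 0<ε with cx ε 0<ε
  ... | N , h = N , λ m n N≤m N≤n →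
    subst (λ t → ∣ t ∣ ℚ.< ε)
      (diff-neg (x m) (x n))
      (h n m N≤n N≤m)

  product-close : ∀ A B ε → 0ℚ ℚ.< A → 0ℚ ℚ.< B → 0ℚ ℚ.< ε →
    ∃[ δ₁ ] ∃[ δ₂ ] (0ℚ ℚ.< δ₁ × 0ℚ ℚ.< δ₂ ×
      (∀ a b c d → ∣ a ∣ ℚ.< A → ∣ d ∣ ℚ.< B → ∣ b ℚ.- d ∣ ℚ.< δ₁ → ∣ a ℚ.- c ∣ ℚ.< δ₂ →
        ∣ a ℚ.* b ℚ.- c ℚ.* d ∣ ℚ.< ε))
  product-close A B ε 0<A 0<B 0<ε = combine
    (product-bound A (½ ℚ.* ε) 0<A (0<½* 0<ε)) (product-bound B (½ ℚ.* ε) 0<B (0<½* 0<ε))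
    where
    combine : _ → _ → _
    combine (δ₁ , 0<δ₁ , h₁) (δ₂ , 0<δ₂ , h₂) =
      δ₁ , δ₂ , 0<δ₁ , 0<δ₂ , λ a b c d a<A d<B b-d<δ₁ a-c<δ₂ →
        subst₂ (λ s t → ∣ s ∣ ℚ.< t) (diff-* a b c d) (halve ε)
          (ℚₚ.≤-<-trans (ℚₚ.∣p+q∣≤∣p∣+∣q∣ (a ℚ.* (b ℚ.- d)) (d ℚ.* (a ℚ.- c)))
            (ℚₚ.+-mono-< (h₁ a (b ℚ.- d) a<A b-d<δ₁) (h₂ d (a ℚ.- c) d<B a-c<δ₂)))

  *-cauchy : ∀ x y → IsCauchy x → IsCauchy y → IsCauchy (λ n → x n ℚ.* y n)
  *-cauchy x y cx cy ε 0<ε =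
    let A , 0<A , M₁ , a = bounded x cx
        B , 0<B , M₂ , b = bounded y cy
        δ₁ , δ₂ , 0<δ₁ , 0<δ₂ , close = product-close A B ε 0<A 0<B 0<ε
        N₁ , h₁ = cy δ₁ 0<δ₁
        N₂ , h₂ = cx δ₂ 0<δ₂
        M = M₁ ℕ.⊔ M₂
        N = N₁ ℕ.⊔ N₂
    in M ℕ.⊔ N , λ m n ≤m ≤n →
      close (x m) (y m) (x n) (y n)
        (a m (ℕₚ.m⊔n≤o⇒m≤o M₁ M₂ (ℕₚ.m⊔n≤o⇒m≤o M N ≤m)))
        (b n (ℕₚ.m⊔n≤o⇒n≤o M₁ M₂ (ℕₚ.m⊔n≤o⇒m≤o M N ≤n)))
        (h₁ m n (ℕₚ.m⊔n≤o⇒m≤o N₁ N₂ (ℕₚ.m⊔n≤o⇒n≤o M N ≤m)) (ℕₚ.m⊔n≤o⇒m≤o N₁ N₂ (ℕₚ.m⊔n≤o⇒n≤o M N ≤n)))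
        (h₂ m n (ℕₚ.m⊔n≤o⇒n≤o N₁ N₂ (ℕₚ.m⊔n≤o⇒n≤o M N ≤m)) (ℕₚ.m⊔n≤o⇒n≤o N₁ N₂ (ℕₚ.m⊔n≤o⇒n≤o M N ≤n)))

open CauchyBounds using (+-cauchy; -‿cauchy; *-cauchy)

infixl 6 _+ᵣ_
infixl 7 _*ᵣ_
infix  8 -ᵣ_

_+ᵣ_ _*ᵣ_ : ℝ → ℝ → ℝ
seq    (x +ᵣ y) n = seq x n ℚ.+ seq y n
cauchy (x +ᵣ y)   = +-cauchy (seq x) (seq y) (cauchy x) (cauchy y)
seq    (x *ᵣ y) n = seq x n ℚ.* seq y n
cauchy (x *ᵣ y)   = *-cauchy (seq x) (seq y) (cauchy x) (cauchy y)

-ᵣ_ : ℝ → ℝ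
seq    (-ᵣ x) n = ℚ.- seq x n
cauchy (-ᵣ x)   = -‿cauchy (seq x) (cauchy x)

ℤ→ℚ : ℤ → ℚ
ℤ→ℚ i = i ℚ./ 1

ℚ→ℝ : ℚ → ℝ
seq    (ℚ→ℝ q) _      = q
cauchy (ℚ→ℝ q) ε 0<ε = 0 , λ _ _ _ _ →
  subst (λ t → ∣ t ∣ ℚ.< ε) (sym (ℚₚ.+-inverseʳ q)) 0<ε

ℤ→ℝ : ℤ → ℝ
ℤ→ℝ i = ℚ→ℝ (ℤ→ℚ i)

0ᵣ 1ᵣ : ℝ
0ᵣ = ℚ→ℝ 0ℚ
1ᵣ = ℚ→ℝ 1ℚ

ℤ-rawRing ℚ-rawRing ℝ-rawRing : RawRing 0ℓ 0ℓ
ℤ-rawRing = ℤ.+-*-rawRing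
ℚ-rawRing = ℚ.+-*-rawRing
ℝ-rawRing = record
  { Carrier = ℝ ; _≈_ = _≃_ ; _+_ = _+ᵣ_ ; _*_ = _*ᵣ_ ; -_ = -ᵣ_ ; 0# = 0ᵣ ; 1# = 1ᵣ }

∑ : ∀ {n} → Vector ℝ n → ℝ
∑ = Vector.foldr _+ᵣ_ 0ᵣ

record ℂ : Set where
  constructor _+i_
  field
    re im : ℝ

open ℂ public

ℝ→ℂ : ℝ → ℂ
ℝ→ℂ a = a +i 0ᵣ

ℂ-rawRing : RawRing 0ℓ 0ℓ
ℂ-rawRing = record
  { Carrier = ℂ
  ; _≈_ = λ z w → re z ≃ re w × im z ≃ im w
  ; _+_ = λ z w → (re z +ᵣ re w) +i (im z +ᵣ im w)
  ; _*_ = λ z w → (re z *ᵣ re w +ᵣ -ᵣ (im z *ᵣ im w)) +i (re z *ᵣ im w +ᵣ im z *ᵣ re w)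
  ; -_  = λ z → (-ᵣ re z) +i (-ᵣ im z)
  ; 0#  = ℝ→ℂ 0ᵣ
  ; 1#  = ℝ→ℂ 1ᵣ
  }

-- A polynomial is its list of coefficients, constant term first; trailing
-- zeros are allowed, so equality of polynomials is _≋_.
module Polynomial {c ℓ} (R : RawRing c ℓ) where
  open RawRing R

  Poly : Set c
  Poly = List Carrier

  infix 9 _[x^_]
  _[x^_] : Poly → ℕ → Carrier
  []      [x^ _     ] = 0#
  (a ∷ p) [x^ zero  ] = a
  (a ∷ p) [x^ suc k ] = p [x^ k ]

  infix 4 _≋_
  record _≋_ (p q : Poly) : Set ℓ where
    constructor mk≋
    field
      coeff≈ : ∀ k → p [x^ k ] ≈ q [x^ k ]

  HasDegree : Poly → ℕ → Set ℓ
  HasDegree p n = ¬ (p [x^ n ] ≈ 0#) × (∀ k → n ℕ.< k → p [x^ k ] ≈ 0#)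

  Monic : Poly → Set ℓ
  Monic p = ∃[ n ] (HasDegree p n × p [x^ n ] ≈ 1#)

  infixl 6 _⊕_
  infixl 7 _⊛_

  _⊕_ : Poly → Poly → Poly
  []      ⊕ q       = q
  (a ∷ p) ⊕ []      = a ∷ p
  (a ∷ p) ⊕ (b ∷ q) = a + b ∷ p ⊕ q

  scale : Carrier → Poly → Poly
  scale a = List.map (a *_)

  _⊛_ : Poly → Poly → Poly
  []      ⊛ q = []
  (a ∷ p) ⊛ q = scale a q ⊕ (0# ∷ p ⊛ q)

  x-_ : Carrier → Poly
  x- a = - a ∷ 1# ∷ []

  ∏ : ∀ {n} → Vector Poly n → Poly
  ∏ = Vector.foldr _⊛_ (1# ∷ [])

  eval : Poly → Carrier → Carrier
  eval []      z = 0#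
  eval (a ∷ p) z = a + z * eval p z

  infixl 8 _∘ₚ_
  _∘ₚ_ : Poly → Poly → Poly
  []      ∘ₚ q = []
  (a ∷ p) ∘ₚ q = (a ∷ []) ⊕ q ⊛ (p ∘ₚ q)

  shift : Poly → Poly
  shift p = p ∘ₚ (x- 1#)

  -- (a + x p)′ = p + x p′
  deriv : Poly → Poly
  deriv []      = []
  deriv (a ∷ p) = p ⊕ (0# ∷ deriv p)

  infix 4 _∣ₚ_
  _∣ₚ_ : Poly → Poly → Set (c ⊔ ℓ)
  d ∣ₚ p = ∃[ e ] (p ≋ d ⊛ e)

  record IsMonicGCD (g p q : Poly) : Set (c ⊔ ℓ) where
    field
      monic    : Monic g
      divides₁ : g ∣ₚ p
      divides₂ : g ∣ₚ q
      greatest : ∀ d → d ∣ₚ p → d ∣ₚ q → d ∣ₚ g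

  -- The entry at i : Fin (m + 1), counted from 0, is the coefficient of x^(m − i).
  coeffs : ∀ m → Poly → Vector Carrier (suc m)
  coeffs m p i = p [x^ m ∸ toℕ i ]

module ℤ[x] = Polynomial ℤ-rawRing
module ℚ[x] = Polynomial ℚ-rawRing
module ℝ[x] = Polynomial ℝ-rawRing
module ℂ[x] = Polynomial ℂ-rawRing

ℤ[x]→ℚ[x] : ℤ[x].Poly → ℚ[x].Poly
ℤ[x]→ℚ[x] = List.map ℤ→ℚ

ℤ[x]→ℝ[x] : ℤ[x].Poly → ℝ[x].Poly
ℤ[x]→ℝ[x] = List.map ℤ→ℝ

ℚ[x]→ℝ[x] : ℚ[x].Poly → ℝ[x].Poly
ℚ[x]→ℝ[x] = List.map ℚ→ℝ

RealRooted : ℝ[x].Poly → Set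
RealRooted p =
  ¬ (p ℝ[x].≋ []) ×
  (∀ z → ℂ[x].eval (List.map ℝ→ℂ p) z ≈ ℝ→ℂ 0ᵣ → im z ≃ 0ᵣ)
  where open RawRing ℂ-rawRing using (_≈_)

WeaklyIncreasing StrictlyIncreasing : ∀ {m} → Vector ℝ m → Set
WeaklyIncreasing   v = ∀ i j → i Fin.≤ j → v i ≤ᵣ v j
StrictlyIncreasing v = ∀ i j → i Fin.< j → v i <ᵣ v j

∏[x-_] : ∀ {m} → Vector ℝ m → ℝ[x].Poly
∏[x- v ] = ℝ[x].∏ (λ i → ℝ[x].x- v i)

-- v lists all m = deg p roots of p, with multiplicity; c is the leading coefficient.
IsRootList : ∀ {m} → ℝ[x].Poly → Vector ℝ m → Set
IsRootList p v =
  WeaklyIncreasing v × ∃[ c ] (¬ (c ≃ 0ᵣ) × p ℝ[x].≋ ℝ[x].scale c ∏[x- v ])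

-- q, of degree k, interlaces p, of degree k + 1.
Interlaces : ℕ → ℝ[x].Poly → ℝ[x].Poly → Set
Interlaces k q p =
  Σ[ v ∈ Vector ℝ (suc k) ] Σ[ w ∈ Vector ℝ k ]
    (IsRootList p v × IsRootList q w ×
     (∀ i → v (inject₁ i) ≤ᵣ w i × w i ≤ᵣ v (Fin.suc i)))

-- The set 𝒯ₙ, meaningful for n ≥ 1.
record SeidelTrace (n : ℕ) (p : ℤ[x].Poly) : Set where
  open ℤ[x]
  field
    degree     : HasDegree p n
    a₀         : p [x^ n ] ≡ ℤ.+ 1
    a₁         : p [x^ n ∸ 1 ] ≡ ℤ.+ 0
    a₂         : 2 ℕ.≤ n → p [x^ n ∸ 2 ] ≡ ℤ.- (ℤ.+ (n C 2))
    realRooted : RealRooted (ℤ[x]→ℝ[x] p)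

-- The set 𝒥(p) for p ∈ 𝒯ₙ, meaningful for n ≥ 2.
𝒥 : (n : ℕ) → ℤ[x].Poly → ℤ[x].Poly → Set
𝒥 n p q = SeidelTrace (n ∸ 1) q × Interlaces (n ∸ 1) (ℤ[x]→ℝ[x] q) (ℤ[x]→ℝ[x] p)

-- ∏_{i ≠ j} (x − v i); the factor at i = j is replaced by 1.
Minⱼ : ∀ {r} → Vector ℝ r → Fin r → ℝ[x].Poly
Minⱼ v j = ℝ[x].∏ (λ i → if does (i ≟ j) then 1ᵣ ∷ [] else (ℝ[x].x- v i))

{-# OPTIONS --safe #-}
module Submission where

open import Defs
open import Data.Nat using (ℕ; suc; _∸_; _≤_)
open import Data.Fin using (Fin)
open import Data.Product using (Σ-syntax; _×_)
open import Data.Vec.Functional using (Vector)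

open import Level using (0ℓ; _⊔_)
open import Algebra.Bundles using (CommutativeRing; CommutativeMonoid)
open import Algebra.Morphism.Structures using (module RingMorphisms)
open import Data.Bool.Base using (if_then_else_)
open import Data.Empty using (⊥; ⊥-elim)
open import Data.Fin.Base as Fin using (zero; suc; inject₁)
open import Data.Fin.Properties using (_≟_; toℕ-inject₁)
open import Data.Integer.Base as ℤ using (ℤ; +_; -[1+_])
open import Data.Integer.Divisibility.Signed as ℤ∣ using (divides)
import Data.Integer.Properties as ℤₚ
import Data.Integer.Solver as ℤSolver
open import Data.List.Base as List using (List; []; _∷_; length)
import Data.List.Properties as Listₚ
open import Data.List.Relation.Unary.All using (All; []; _∷_)
open import Data.Maybe.Base using (Maybe; just; nothing)
open import Data.Nat.Base as ℕ using (zero; z≤n; s≤s)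
import Data.Nat.Divisibility as ℕ∣
open import Data.Nat.ListAction using (product)
open import Data.Nat.Primality using (Prime; euclidsLemma; prime⇒nonZero)
open import Data.Nat.Primality.Factorisation using (factorise; module PrimeFactorisation)
import Data.Nat.Properties as ℕₚ
open import Data.Product.Base using (_,_; proj₁; proj₂; ∃-syntax)
open import Data.Rational.Base as ℚ using (ℚ; 0ℚ; 1ℚ; ½)
import Data.Rational.Properties as ℚₚ
open import Data.Rational.Unnormalised.Base as ℚᵘ using (mkℚᵘ; *≡*)
import Data.Rational.Unnormalised.Properties as ℚᵘₚ
open import Data.Sum.Base as Sum using (_⊎_; inj₁; inj₂; [_,_]′)
open import Data.Vec.Functional as Vector using (head; tail)
open import Relation.Binary.Bundles using (Setoid)
open import Relation.Binary.Definitions using (Tri; tri<; tri≈; tri>)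
open import Relation.Binary.PropositionalEquality as ≡ using (_≡_; _≢_)
open import Relation.Nullary using (¬_; Dec; does; yes; no)
open import Relation.Nullary.Decidable using (decidable-stable; ¬¬-excluded-middle)
open import Relation.Nullary.Negation using (¬¬-map)
import Algebra.Properties.CommutativeSemigroup ℕₚ.*-commutativeSemigroup as ℕ*

-- Let M = ∏ (x − uⱼ) over the distinct roots uⱼ of p, with multiplicities mⱼ, and G = p / M. An
-- induction on the roots, adding the smallest pair v₀ ≤ w₀, gives q = G ∑ γⱼ M / (x − uⱼ) with
-- γⱼ ≥ 0: for a new root v₀ < uⱼ one writes x − w₀ as a convex combination of x − v₀ and x − uⱼ,
-- and for a repeated root w₀ = v₀. Since p′ = G ∑ mⱼ M / (x − uⱼ), the rational gcd g is G and
-- Min is M, so g divides q; the quotient f is integral by Gauss's lemma, and the substitution of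
-- x − 1 is linear.
--
-- Equality of Cauchy reals is ¬¬-stable, so all identities and ≤ may be proved as if root
-- equality were decidable. Listing the distinct roots and dividing by their differences needs a
-- genuine decision; it comes from a rational Bézout identity A Min + B Min′ = 1, see compare-roots.

-- Equal roots are grouped twice, because of a circle. Deciding equality of roots rests on a Bézout
-- identity for Min and Min′; Euclid's algorithm over ℚ supplies one for their gcd, but that this
-- gcd is 1 already depends on the distinct roots. The circle breaks because the degree of the gcd
-- is a natural number: the claim that it is 0 is decidable, so a grouping that exists only under a
-- double negation suffices for it. For this reason `Grouped` takes its notion of apartness as a
-- parameter. Under the double negation the gaps are merely nonzero reals, which are regular but
-- come without inverses; in the grouping that is actually constructed they are positive units. The
-- other obstacle is the change of field. Computing a gcd needs a decidable zero and takes place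
-- over ℚ, while the roots are real, and the maximality of a gcd does not pass from ℚ to ℝ. What is
-- carried over consists of identities alone: g as a combination of p and p′, and the products in
-- which g is a factor.

module IntegerCoefficients {c ℓ} (R : CommutativeRing c ℓ) where
  open CommutativeRing R
  open import Algebra.Solver.Ring.AlmostCommutativeRing
    using (_-Raw-AlmostCommutative⟶_; fromCommutativeRing)
  open import Algebra.Properties.Semiring.Mult.TCOptimised semiring
    using (1+×; ×-homo-+; ×1-homo-*) renaming (_×_ to _·_)
  open import Algebra.Properties.Ring ring
    using (-0#≈0#; -‿involutive; -‿distribˡ-*; -‿distribʳ-*; -‿+-comm)
  open import Relation.Binary.Reasoning.Setoid setoid
  open import Data.Maybe.Base using (Maybe; just; nothing)
  open import Relation.Nullary using (yes; no)

  -- Coefficient map for a ring solver over any commutative ring. Equality of integers is decidable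
  -- although `_≈_` need not be, so that normal forms can cancel opposite terms.
  fromℤ : ℤ → Carrier
  fromℤ (+ n)      = n · 1#
  fromℤ (-[1+ n ]) = - (suc n · 1#)

  fromℤ-⊖ : ∀ m n → fromℤ (m ℤ.⊖ n) ≈ m · 1# - n · 1#
  fromℤ-⊖ m zero = begin
    m · 1#        ≈⟨ +-identityʳ _ ⟨
    m · 1# + 0#   ≈⟨ +-congˡ -0#≈0# ⟨
    m · 1# - 0#   ∎
  fromℤ-⊖ zero (suc n) = sym (+-identityˡ _)
  fromℤ-⊖ (suc m) (suc n) = begin
    fromℤ (suc m ℤ.⊖ suc n)             ≡⟨ ≡.cong fromℤ (ℤₚ.[1+m]⊖[1+n]≡m⊖n m n) ⟩
    fromℤ (m ℤ.⊖ n)                     ≈⟨ fromℤ-⊖ m n ⟩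
    m · 1# - n · 1#                     ≈⟨ +-congˡ (+-identityˡ _) ⟨
    m · 1# + (0# - n · 1#)              ≈⟨ +-congˡ (+-congʳ (-‿inverseʳ 1#)) ⟨
    m · 1# + (1# - 1# - n · 1#)         ≈⟨ +-congˡ (+-assoc _ _ _) ⟩
    m · 1# + (1# + (- 1# - n · 1#))     ≈⟨ +-congˡ (+-congˡ (-‿+-comm 1# _)) ⟩
    m · 1# + (1# - (1# + n · 1#))       ≈⟨ +-assoc _ _ _ ⟨
    m · 1# + 1# - (1# + n · 1#)         ≈⟨ +-congʳ (+-comm _ _) ⟩
    1# + m · 1# - (1# + n · 1#)         ≈⟨ +-cong (1+× m 1#) (-‿cong (1+× n 1#)) ⟨
    suc m · 1# - suc n · 1#             ∎

  fromℤ-+ : ∀ i j → fromℤ (i ℤ.+ j) ≈ fromℤ i + fromℤ j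
  fromℤ-+ (+ m)      (+ n)      = ×-homo-+ 1# m n
  fromℤ-+ (+ m)      (-[1+ n ]) = fromℤ-⊖ m (suc n)
  fromℤ-+ (-[1+ m ]) (+ n)      = trans (fromℤ-⊖ n (suc m)) (+-comm _ _)
  fromℤ-+ (-[1+ m ]) (-[1+ n ]) = begin
    - (suc (suc (m ℕ.+ n)) · 1#)     ≡⟨ ≡.cong (λ k → - (suc k · 1#)) (ℕₚ.+-suc m n) ⟨
    - ((suc m ℕ.+ suc n) · 1#)       ≈⟨ -‿cong (×-homo-+ 1# (suc m) (suc n)) ⟩
    - (suc m · 1# + suc n · 1#)      ≈⟨ -‿+-comm _ _ ⟨
    - (suc m · 1#) - (suc n · 1#)    ∎
    where import Data.Nat.Properties as ℕₚ

  fromℤ-neg : ∀ i → fromℤ (ℤ.- i) ≈ - fromℤ i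
  fromℤ-neg (+ zero)   = sym -0#≈0#
  fromℤ-neg (+ suc n)  = refl
  fromℤ-neg (-[1+ n ]) = sym (-‿involutive _)

  fromℤ-pos* : ∀ m j → fromℤ (+ m ℤ.* j) ≈ m · 1# * fromℤ j
  fromℤ-pos* m (+ n) = trans (reflexive (≡.cong fromℤ (≡.sym (ℤₚ.pos-* m n)))) (×1-homo-* m n)
  fromℤ-pos* m (-[1+ n ]) = begin
    fromℤ (+ m ℤ.* ℤ.- (+ suc n))    ≡⟨ ≡.cong fromℤ (ℤₚ.neg-distribʳ-* (+ m) (+ suc n)) ⟨
    fromℤ (ℤ.- (+ m ℤ.* + suc n))    ≈⟨ fromℤ-neg (+ m ℤ.* + suc n) ⟩
    - fromℤ (+ m ℤ.* + suc n)        ≈⟨ -‿cong (fromℤ-pos* m (+ suc n)) ⟩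
    - (m · 1# * (suc n · 1#))        ≈⟨ -‿distribʳ-* _ _ ⟩
    m · 1# * - (suc n · 1#)          ∎

  fromℤ-* : ∀ i j → fromℤ (i ℤ.* j) ≈ fromℤ i * fromℤ j
  fromℤ-* (+ m)      j = fromℤ-pos* m j
  fromℤ-* (-[1+ m ]) j = begin
    fromℤ (ℤ.- (+ suc m) ℤ.* j)      ≡⟨ ≡.cong fromℤ (ℤₚ.neg-distribˡ-* (+ suc m) j) ⟨
    fromℤ (ℤ.- (+ suc m ℤ.* j))      ≈⟨ fromℤ-neg (+ suc m ℤ.* j) ⟩
    - fromℤ (+ suc m ℤ.* j)          ≈⟨ -‿cong (fromℤ-pos* (suc m) j) ⟩
    - (suc m · 1# * fromℤ j)         ≈⟨ -‿distribˡ-* _ _ ⟩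
    - (suc m · 1#) * fromℤ j         ∎

  fromℤ-morphism : ℤ.+-*-rawRing -Raw-AlmostCommutative⟶ fromCommutativeRing R
  fromℤ-morphism = record
    { ⟦_⟧ = fromℤ ; +-homo = fromℤ-+ ; *-homo = fromℤ-* ; -‿homo = fromℤ-neg
    ; 0-homo = refl ; 1-homo = refl }

  _fromℤ≟_ : ∀ i j → Maybe (fromℤ i ≈ fromℤ j)
  i fromℤ≟ j with i ℤₚ.≟ j
  ... | yes i≡j = just (reflexive (≡.cong fromℤ i≡j))
  ... | no  _   = nothing

  open import Algebra.Solver.Ring ℤ.+-*-rawRing (fromCommutativeRing R) fromℤ-morphism _fromℤ≟_ public
    using (solve; _:=_; _:+_; _:*_; _:-_; :-_; con)

-- The commutative ring of polynomials.

module PolynomialRing {c ℓ} (R : CommutativeRing c ℓ) where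
  open CommutativeRing R
  open Polynomial rawRing public
  open _≋_ public
  open IntegerCoefficients R using (solve; _:=_; _:+_; _:*_; _:-_; :-_; con)
  open import Relation.Binary.Reasoning.Setoid setoid

  ≋-refl : ∀ {p} → p ≋ p
  ≋-refl = mk≋ λ _ → refl

  ≋-sym : ∀ {p q} → p ≋ q → q ≋ p
  ≋-sym p≋q = mk≋ λ k → sym (coeff≈ p≋q k)

  ≋-trans : ∀ {p q r} → p ≋ q → q ≋ r → p ≋ r
  ≋-trans p≋q q≋r = mk≋ λ k → trans (coeff≈ p≋q k) (coeff≈ q≋r k)

  ≋-setoid : Setoid c ℓ
  ≋-setoid = record { Carrier = Poly ; _≈_ = _≋_
    ; isEquivalence = record { refl = ≋-refl ; sym = ≋-sym ; trans = ≋-trans } }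

  infixr 2 _≋⟨_⟩_ _≋⟨_⟨_
  infix  3 _∎ₚ

  _≋⟨_⟩_ : ∀ p {q r} → p ≋ q → q ≋ r → p ≋ r
  p ≋⟨ p≋q ⟩ q≋r = ≋-trans p≋q q≋r

  _≋⟨_⟨_ : ∀ p {q r} → q ≋ p → q ≋ r → p ≋ r
  p ≋⟨ q≋p ⟨ q≋r = ≋-trans (≋-sym q≋p) q≋r

  _∎ₚ : ∀ p → p ≋ p
  p ∎ₚ = ≋-refl

  ∷-cong : ∀ {a b p q} → a ≈ b → p ≋ q → a ∷ p ≋ b ∷ q
  ∷-cong a≈b p≋q = mk≋ λ { zero → a≈b ; (suc k) → coeff≈ p≋q k }

  ∷-tail : ∀ {a b p q} → a ∷ p ≋ b ∷ q → p ≋ q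
  ∷-tail e = mk≋ λ k → coeff≈ e (suc k)

  ∷≋[] : ∀ {a p} → a ≈ 0# → p ≋ [] → a ∷ p ≋ []
  ∷≋[] a≈0 p≋[] = mk≋ λ { zero → a≈0 ; (suc k) → coeff≈ p≋[] k }

  ∷≋[]-tail : ∀ {a p} → a ∷ p ≋ [] → p ≋ []
  ∷≋[]-tail e = mk≋ λ k → coeff≈ e (suc k)

  coeff-⊕ : ∀ p q k → (p ⊕ q) [x^ k ] ≈ p [x^ k ] + q [x^ k ]
  coeff-⊕ []      q       k       = sym (+-identityˡ _)
  coeff-⊕ (a ∷ p) []      k       = sym (+-identityʳ _)
  coeff-⊕ (a ∷ p) (b ∷ q) zero    = refl
  coeff-⊕ (a ∷ p) (b ∷ q) (suc k) = coeff-⊕ p q k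

  coeff-scale : ∀ a p k → scale a p [x^ k ] ≈ a * p [x^ k ]
  coeff-scale a []      k       = sym (zeroʳ a)
  coeff-scale a (b ∷ p) zero    = refl
  coeff-scale a (b ∷ p) (suc k) = coeff-scale a p k

  ⊕-cong : ∀ {p p′ q q′} → p ≋ p′ → q ≋ q′ → p ⊕ q ≋ p′ ⊕ q′
  ⊕-cong {p} {p′} {q} {q′} e f = mk≋ λ k →
    trans (coeff-⊕ p q k) (trans (+-cong (coeff≈ e k) (coeff≈ f k)) (sym (coeff-⊕ p′ q′ k)))

  ⊕-assoc : ∀ p q r → (p ⊕ q) ⊕ r ≋ p ⊕ (q ⊕ r)
  ⊕-assoc p q r = mk≋ λ k → begin
    ((p ⊕ q) ⊕ r) [x^ k ]                  ≈⟨ coeff-⊕ (p ⊕ q) r k ⟩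
    (p ⊕ q) [x^ k ] + r [x^ k ]            ≈⟨ +-congʳ (coeff-⊕ p q k) ⟩
    p [x^ k ] + q [x^ k ] + r [x^ k ]      ≈⟨ +-assoc _ _ _ ⟩
    p [x^ k ] + (q [x^ k ] + r [x^ k ])    ≈⟨ +-congˡ (coeff-⊕ q r k) ⟨
    p [x^ k ] + (q ⊕ r) [x^ k ]            ≈⟨ coeff-⊕ p (q ⊕ r) k ⟨
    (p ⊕ (q ⊕ r)) [x^ k ]                  ∎

  ⊕-comm : ∀ p q → p ⊕ q ≋ q ⊕ p
  ⊕-comm p q = mk≋ λ k → trans (coeff-⊕ p q k) (trans (+-comm _ _) (sym (coeff-⊕ q p k)))

  ⊕-identityˡ : ∀ p → [] ⊕ p ≋ p
  ⊕-identityˡ p = ≋-refl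

  ⊕-identityʳ : ∀ p → p ⊕ [] ≋ p
  ⊕-identityʳ p = ⊕-comm p []

  ⊕-commutativeMonoid : CommutativeMonoid c ℓ
  ⊕-commutativeMonoid = record
    { Carrier = Poly ; _≈_ = _≋_ ; _∙_ = _⊕_ ; ε = []
    ; isCommutativeMonoid = record
      { isMonoid = record
        { isSemigroup = record
          { isMagma = record { isEquivalence = Setoid.isEquivalence ≋-setoid ; ∙-cong = ⊕-cong }
          ; assoc = ⊕-assoc }
        ; identity = ⊕-identityˡ , ⊕-identityʳ }
      ; comm = ⊕-comm } }

  private
    module ⊕ where
      open import Algebra.Properties.CommutativeSemigroup
        (CommutativeMonoid.commutativeSemigroup ⊕-commutativeMonoid) public

  scale-cong : ∀ {a b p q} → a ≈ b → p ≋ q → scale a p ≋ scale b q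
  scale-cong {a} {b} {p} {q} e f = mk≋ λ k →
    trans (coeff-scale a p k) (trans (*-cong e (coeff≈ f k)) (sym (coeff-scale b q k)))

  scale-congˡ : ∀ a {p q} → p ≋ q → scale a p ≋ scale a q
  scale-congˡ a = scale-cong refl

  scale-congʳ : ∀ {a b} p → a ≈ b → scale a p ≋ scale b p
  scale-congʳ p a≈b = scale-cong a≈b (≋-refl {p})

  scale-⊕ : ∀ a p q → scale a (p ⊕ q) ≋ scale a p ⊕ scale a q
  scale-⊕ a p q = mk≋ λ k → begin
    scale a (p ⊕ q) [x^ k ]                   ≈⟨ coeff-scale a (p ⊕ q) k ⟩
    a * (p ⊕ q) [x^ k ]                       ≈⟨ *-congˡ (coeff-⊕ p q k) ⟩
    a * (p [x^ k ] + q [x^ k ])               ≈⟨ distribˡ _ _ _ ⟩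
    a * p [x^ k ] + a * q [x^ k ]             ≈⟨ +-cong (coeff-scale a p k) (coeff-scale a q k) ⟨
    scale a p [x^ k ] + scale a q [x^ k ]     ≈⟨ coeff-⊕ (scale a p) (scale a q) k ⟨
    (scale a p ⊕ scale a q) [x^ k ]           ∎

  scale-scale : ∀ a b p → scale a (scale b p) ≋ scale (a * b) p
  scale-scale a b p = mk≋ λ k → begin
    scale a (scale b p) [x^ k ]    ≈⟨ coeff-scale a (scale b p) k ⟩
    a * scale b p [x^ k ]          ≈⟨ *-congˡ (coeff-scale b p k) ⟩
    a * (b * p [x^ k ])            ≈⟨ *-assoc _ _ _ ⟨
    a * b * p [x^ k ]              ≈⟨ coeff-scale (a * b) p k ⟨
    scale (a * b) p [x^ k ]        ∎

  scale-0 : ∀ {a} p → a ≈ 0# → scale a p ≋ []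
  scale-0 {a} p a≈0 = mk≋ λ k → trans (coeff-scale a p k) (trans (*-congʳ a≈0) (zeroˡ _))

  scale-1 : ∀ p → scale 1# p ≋ p
  scale-1 p = mk≋ λ k → trans (coeff-scale 1# p k) (*-identityˡ _)

  ⊛-congˡ : ∀ p {q q′} → q ≋ q′ → p ⊛ q ≋ p ⊛ q′
  ⊛-congˡ []      e = ≋-refl
  ⊛-congˡ (a ∷ p) e = ⊕-cong (scale-cong refl e) (∷-cong refl (⊛-congˡ p e))

  ⊛-zeroʳ : ∀ p → p ⊛ [] ≋ []
  ⊛-zeroʳ []      = ≋-refl
  ⊛-zeroʳ (a ∷ p) = ∷≋[] refl (⊛-zeroʳ p)

  private
    -- A list that is `≋ []` may still consist of zeros, and the recursion of `_⊛_` runs through all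
    -- of them.
    vanishing-⊛ : ∀ p {q} → p ≋ [] → p ⊛ q ≋ []
    vanishing-⊛ []      e = ≋-refl
    vanishing-⊛ (a ∷ p) {q} e =
      ⊕-cong (scale-0 q (coeff≈ e 0)) (∷≋[] refl (vanishing-⊛ p (∷≋[]-tail e)))

  ⊛-congʳ : ∀ {p p′} q → p ≋ p′ → p ⊛ q ≋ p′ ⊛ q
  ⊛-congʳ {[]}    {p′}    q e = ≋-sym (vanishing-⊛ p′ (≋-sym e))
  ⊛-congʳ {a ∷ p} {[]}    q e = vanishing-⊛ (a ∷ p) e
  ⊛-congʳ {a ∷ p} {b ∷ p′} q e =
    ⊕-cong (scale-cong (coeff≈ e 0) (≋-refl {q})) (∷-cong refl (⊛-congʳ q (∷-tail e)))

  ⊛-cong : ∀ {p p′ q q′} → p ≋ p′ → q ≋ q′ → p ⊛ q ≋ p′ ⊛ q′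
  ⊛-cong {p} {p′} {q} {q′} e f = ≋-trans (⊛-congʳ q e) (⊛-congˡ p′ f)

  0∷-⊕ : ∀ p q → 0# ∷ (p ⊕ q) ≋ (0# ∷ p) ⊕ (0# ∷ q)
  0∷-⊕ p q = ∷-cong (sym (+-identityˡ _)) ≋-refl

  ⊛-distribˡ : ∀ p q r → p ⊛ (q ⊕ r) ≋ p ⊛ q ⊕ p ⊛ r
  ⊛-distribˡ []      q r = ≋-refl
  ⊛-distribˡ (a ∷ p) q r = ≋-trans
    (⊕-cong (scale-⊕ a q r) (≋-trans (∷-cong refl (⊛-distribˡ p q r)) (0∷-⊕ (p ⊛ q) (p ⊛ r))))
    (⊕.interchange (scale a q) (scale a r) (0# ∷ p ⊛ q) (0# ∷ p ⊛ r))

  -- The defining recursion of `_⊛_`, mirrored in the second argument; commutativity is then an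
  -- induction.
  ⊛-∷ : ∀ p b q → p ⊛ (b ∷ q) ≋ scale b p ⊕ (0# ∷ p ⊛ q)
  ⊛-∷ []      b q = mk≋ λ { zero → refl ; (suc k) → refl }
  ⊛-∷ (a ∷ p) b q = ∷-cong (+-congʳ (*-comm a b)) (≋-trans
    (⊕-cong (≋-refl {scale a q}) (⊛-∷ p b q))
    (⊕.x∙yz≈y∙xz (scale a q) (scale b p) (0# ∷ p ⊛ q)))

  ⊛-comm : ∀ p q → p ⊛ q ≋ q ⊛ p
  ⊛-comm []      q = ≋-sym (⊛-zeroʳ q)
  ⊛-comm (a ∷ p) q = ≋-trans
    (⊕-cong (≋-refl {scale a q}) (∷-cong refl (⊛-comm p q))) (≋-sym (⊛-∷ q a p))

  ⊛-distribʳ : ∀ p q r → (q ⊕ r) ⊛ p ≋ q ⊛ p ⊕ r ⊛ p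
  ⊛-distribʳ p q r = ≋-trans (⊛-comm (q ⊕ r) p)
    (≋-trans (⊛-distribˡ p q r) (⊕-cong (⊛-comm p q) (⊛-comm p r)))

  scale-⊛ : ∀ a p q → scale a p ⊛ q ≋ scale a (p ⊛ q)
  scale-⊛ a []      q = ≋-refl
  scale-⊛ a (b ∷ p) q = ≋-trans
    (⊕-cong (≋-sym (scale-scale a b q)) (∷-cong (sym (zeroʳ a)) (scale-⊛ a p q)))
    (≋-sym (scale-⊕ a (scale b q) (0# ∷ p ⊛ q)))

  0∷-⊛ : ∀ p q → (0# ∷ p) ⊛ q ≋ 0# ∷ p ⊛ q
  0∷-⊛ p q = ⊕-cong (scale-0 q refl) (≋-refl {0# ∷ p ⊛ q})

  ⊛-assoc : ∀ p q r → (p ⊛ q) ⊛ r ≋ p ⊛ (q ⊛ r)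
  ⊛-assoc []      q r = ≋-refl
  ⊛-assoc (a ∷ p) q r = ≋-trans (⊛-distribʳ r (scale a q) (0# ∷ p ⊛ q))
    (⊕-cong (scale-⊛ a q r) (≋-trans (0∷-⊛ (p ⊛ q) r) (∷-cong refl (⊛-assoc p q r))))

  ⊛-identityˡ : ∀ p → (1# ∷ []) ⊛ p ≋ p
  ⊛-identityˡ p = ≋-trans (⊕-cong (scale-1 p) (∷≋[] refl ≋-refl)) (⊕-identityʳ p)

  neg : Poly → Poly
  neg = scale (- 1#)

  neg-inverseʳ : ∀ p → p ⊕ neg p ≋ []
  neg-inverseʳ p = mk≋ λ k → begin
    (p ⊕ neg p) [x^ k ]                ≈⟨ coeff-⊕ p (neg p) k ⟩
    p [x^ k ] + neg p [x^ k ]          ≈⟨ +-congˡ (coeff-scale (- 1#) p k) ⟩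
    p [x^ k ] + - 1# * p [x^ k ]
      ≈⟨ solve 1 (λ a → a :+ con (ℤ.- + 1) :* a := con (+ 0)) refl (p [x^ k ]) ⟩
    0#                                 ∎

  polynomialRing : CommutativeRing c ℓ
  polynomialRing = record
    { Carrier = Poly ; _≈_ = _≋_ ; _+_ = _⊕_ ; _*_ = _⊛_ ; -_ = neg ; 0# = [] ; 1# = 1# ∷ []
    ; isCommutativeRing = record
      { isRing = record
        { +-isAbelianGroup = record
          { isGroup = record
            { isMonoid = CommutativeMonoid.isMonoid ⊕-commutativeMonoid
            ; inverse = (λ p → ≋-trans (⊕-comm (neg p) p) (neg-inverseʳ p)) , neg-inverseʳ
            ; ⁻¹-cong = scale-cong refl }
          ; comm = ⊕-comm }
        ; *-cong = ⊛-cong ; *-assoc = ⊛-assoc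
        ; *-identity = ⊛-identityˡ , λ p → ≋-trans (⊛-comm p (1# ∷ [])) (⊛-identityˡ p)
        ; distrib = ⊛-distribˡ , ⊛-distribʳ }
      ; *-comm = ⊛-comm } }

  module PolynomialSolver = IntegerCoefficients polynomialRing
    renaming (solve to solveₚ; _:=_ to _⊜_; _:+_ to _:⊕_; _:*_ to _:⊛_; _:-_ to _:⊖_; :-_ to :⊖_; con to conₚ)

  constant : Carrier → Poly
  constant a = a ∷ []

  X : Poly
  X = 0# ∷ 1# ∷ []

  -- The ring solver sees `scale`, `_∷_` and `x-_` only as atoms. This and the next lemmas express
  -- them by sums and products with constants and `X`, on which the solver can work.
  scale≋constant⊛ : ∀ a p → scale a p ≋ constant a ⊛ p
  scale≋constant⊛ a p = ≋-sym (≋-trans (⊕-cong (≋-refl {scale a p}) (∷≋[] refl ≋-refl)) (⊕-identityʳ _))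

  0∷≋X⊛ : ∀ p → 0# ∷ p ≋ X ⊛ p
  0∷≋X⊛ p = ≋-sym (≋-trans (0∷-⊛ (1# ∷ []) p) (∷-cong refl (⊛-identityˡ p)))

  ∷≋constant⊕X⊛ : ∀ a p → a ∷ p ≋ constant a ⊕ X ⊛ p
  ∷≋constant⊕X⊛ a p = ≋-trans (∷-cong (sym (+-identityʳ a)) ≋-refl) (⊕-cong (≋-refl {constant a}) (0∷≋X⊛ p))

  x-≋X⊖constant : ∀ a → x- a ≋ X ⊕ neg (constant a)
  x-≋X⊖constant a = ∷-cong (solve 1 (λ a → :- a := con (+ 0) :+ con (ℤ.- + 1) :* a) refl a) ≋-refl

  constant-cong : ∀ {a b} → a ≈ b → constant a ≋ constant b
  constant-cong e = ∷-cong e ≋-refl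

  constant-* : ∀ a b → constant (a * b) ≋ constant a ⊛ constant b
  constant-* a b = ∷-cong (sym (+-identityʳ _)) ≋-refl

  x-cong : ∀ {a b} → a ≈ b → x- a ≋ x- b
  x-cong e = ∷-cong (-‿cong e) ≋-refl

-- Degree bounds, division, evaluation, derivative and substitution.

module PolynomialDegree {c ℓ} (R : CommutativeRing c ℓ) where
  open CommutativeRing R
  open PolynomialRing R
  open IntegerCoefficients R using (solve; _:=_; _:+_; _:*_; _:-_; :-_; con)
  open PolynomialSolver using (solveₚ; _⊜_; _:⊕_; _:⊛_; _:⊖_; :⊖_)
  open import Relation.Binary.Reasoning.Setoid setoid

  -- A strict bound on the degree instead of the degree itself: it covers the zero polynomial and
  -- can be stated without deciding which coefficient leads.
  record Below (p : Poly) (d : ℕ) : Set ℓ where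
    constructor mkBelow
    field
      vanishes : ∀ k → d ℕ.≤ k → p [x^ k ] ≈ 0#

  record MonicOf (p : Poly) (d : ℕ) : Set ℓ where
    constructor monicOf
    field
      leading : p [x^ d ] ≈ 1#
      below   : Below p (suc d)

  open Below public
  open MonicOf public

  Below-resp : ∀ {p q d} → p ≋ q → Below p d → Below q d
  Below-resp e b = mkBelow λ k d≤k → trans (sym (coeff≈ e k)) (vanishes b k d≤k)

  Below-tail : ∀ {a p d} → Below (a ∷ p) (suc d) → Below p d
  Below-tail b = mkBelow λ k d≤k → vanishes b (suc k) (s≤s d≤k)

  Below-∷ : ∀ {a p d} → Below p d → Below (a ∷ p) (suc d)
  Below-∷ b = mkBelow λ { (suc k) (s≤s d≤k) → vanishes b k d≤k }

  Below-[] : ∀ {d} → Below [] d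
  Below-[] = mkBelow λ _ _ → refl

  Below-≤ : ∀ {p d e} → d ℕ.≤ e → Below p d → Below p e
  Below-≤ d≤e b = mkBelow λ k e≤k → vanishes b k (ℕₚ.≤-trans d≤e e≤k)

  Below-0 : ∀ {p} → Below p 0 → p ≋ []
  Below-0 b = mk≋ λ k → vanishes b k z≤n

  Below-⊕ : ∀ p q {d} → Below p d → Below q d → Below (p ⊕ q) d
  Below-⊕ p q bp bq = mkBelow λ k d≤k →
    trans (coeff-⊕ p q k) (trans (+-cong (vanishes bp k d≤k) (vanishes bq k d≤k)) (+-identityʳ 0#))

  Below-scale : ∀ a p {d} → Below p d → Below (scale a p) d
  Below-scale a p b = mkBelow λ k d≤k → trans (coeff-scale a p k) (trans (*-congˡ (vanishes b k d≤k)) (zeroʳ a))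

  Below-length : ∀ p → Below p (length p)
  Below-length []      = Below-[]
  Below-length (a ∷ p) = Below-∷ (Below-length p)

  coeff-∷⊛ : ∀ a p q k → ((a ∷ p) ⊛ q) [x^ suc k ] ≈ a * q [x^ suc k ] + (p ⊛ q) [x^ k ]
  coeff-∷⊛ a p q k = trans (coeff-⊕ (scale a q) (0# ∷ p ⊛ q) (suc k)) (+-congʳ (coeff-scale a q (suc k)))

  vanishing-tail-⊛ : ∀ a {p} q → p ≋ [] → (a ∷ p) ⊛ q ≋ scale a q
  vanishing-tail-⊛ a q e = ≋-trans
    (⊕-cong (≋-refl {scale a q}) (∷≋[] refl (⊛-congʳ q e))) (⊕-identityʳ _)

  -- Degrees at most m - 1 and l add up to at most m + l - 1; writing only the second bound as a
  -- successor avoids a subtraction.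
  Below-⊛ : ∀ p q {m l} → Below p m → Below q (suc l) → Below (p ⊛ q) (m ℕ.+ l)
  Below-⊛ []      q         bp bq = Below-[]
  Below-⊛ (a ∷ p) q {zero}  bp bq = Below-resp (≋-sym (⊛-congʳ {a ∷ p} {[]} q (Below-0 bp))) Below-[]
  Below-⊛ (a ∷ p) q {suc m} {l} bp bq = mkBelow λ { (suc k) (s≤s m+l≤k) → begin
    ((a ∷ p) ⊛ q) [x^ suc k ]              ≈⟨ coeff-∷⊛ a p q k ⟩
    a * q [x^ suc k ] + (p ⊛ q) [x^ k ]
      ≈⟨ +-cong (*-congˡ (vanishes bq (suc k) (s≤s (ℕₚ.m+n≤o⇒n≤o m m+l≤k))))
          (vanishes (Below-⊛ p q (Below-tail bp) bq) k m+l≤k) ⟩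
    a * 0# + 0#                            ≈⟨ trans (+-identityʳ _) (zeroʳ a) ⟩
    0#                                     ∎ }

  coeff-⊛-top : ∀ p q {m l} → Below p (suc m) → Below q (suc l) → (p ⊛ q) [x^ m ℕ.+ l ] ≈ p [x^ m ] * q [x^ l ]
  coeff-⊛-top []      q bp bq = sym (zeroˡ _)
  coeff-⊛-top (a ∷ p) q {zero} {l} bp bq =
    trans (coeff≈ (vanishing-tail-⊛ a q (Below-0 (Below-tail bp))) l) (coeff-scale a q l)
  coeff-⊛-top (a ∷ p) q {suc m} {l} bp bq = begin
    ((a ∷ p) ⊛ q) [x^ suc (m ℕ.+ l) ]                        ≈⟨ coeff-∷⊛ a p q (m ℕ.+ l) ⟩
    a * q [x^ suc (m ℕ.+ l) ] + (p ⊛ q) [x^ m ℕ.+ l ]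
      ≈⟨ +-cong (*-congˡ (vanishes bq _ (s≤s (ℕₚ.m≤n+m l m)))) (coeff-⊛-top p q (Below-tail bp) bq) ⟩
    a * 0# + p [x^ m ] * q [x^ l ]                           ≈⟨ trans (+-congʳ (zeroʳ a)) (+-identityˡ _) ⟩
    p [x^ m ] * q [x^ l ]                                    ∎

  MonicOf-resp : ∀ {p q d} → p ≋ q → MonicOf p d → MonicOf q d
  MonicOf-resp e m = monicOf (trans (sym (coeff≈ e _)) (leading m)) (Below-resp e (below m))

  MonicOf-⊛ : ∀ {p q m l} → MonicOf p m → MonicOf q l → MonicOf (p ⊛ q) (m ℕ.+ l)
  MonicOf-⊛ {p} {q} mp mq = monicOf
    (trans (coeff-⊛-top p q (below mp) (below mq)) (trans (*-cong (leading mp) (leading mq)) (*-identityˡ 1#)))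
    (Below-⊛ p q (below mp) (below mq))

  MonicOf-1 : MonicOf (1# ∷ []) 0
  MonicOf-1 = monicOf refl (mkBelow λ { (suc k) _ → refl })

  MonicOf-x- : ∀ a → MonicOf (x- a) 1
  MonicOf-x- a = monicOf refl (mkBelow λ { (suc (suc k)) _ → refl ; (suc zero) (s≤s ()) })

  Below-lower : ∀ {p d} → Below p (suc d) → p [x^ d ] ≈ 0# → Below p d
  Below-lower {p} {d} b top≈0 = mkBelow λ k d≤k → case k (ℕₚ.m≤n⇒m<n∨m≡n d≤k)
    where
    case : ∀ k → d ℕ.< k ⊎ d ≡ k → p [x^ k ] ≈ 0#
    case k (inj₁ d<k)    = vanishes b k d<k
    case _ (inj₂ ≡.refl) = top≈0

  -- `go` lowers a crude bound, taken from the length of p, one step at a time: as g is monic, the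
  -- coefficient of x^(t + b) in p equals that of x^(d + t + b) in g p, which vanishes. The degree
  -- of p is never determined.
  Below-cancel : ∀ {g d} p {t} → MonicOf g d → Below (g ⊛ p) (d ℕ.+ t) → Below p t
  Below-cancel {g} {d} p {t} mg = go (length p) (Below-≤ (ℕₚ.m≤n+m (length p) t) (Below-length p))
    where
    go : ∀ b → Below p (t ℕ.+ b) → Below (g ⊛ p) (d ℕ.+ t) → Below p t
    go zero    bp bgp = ≡.subst (Below p) (ℕₚ.+-identityʳ t) bp
    go (suc b) bp bgp = go b bp′ bgp
      where
      bp₁ : Below p (suc (t ℕ.+ b))
      bp₁ = ≡.subst (Below p) (ℕₚ.+-suc t b) bp
      top≈0 : p [x^ t ℕ.+ b ] ≈ 0#
      top≈0 = begin
        p [x^ t ℕ.+ b ]                    ≈⟨ *-identityˡ _ ⟨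
        1# * p [x^ t ℕ.+ b ]               ≈⟨ *-congʳ (leading mg) ⟨
        g [x^ d ] * p [x^ t ℕ.+ b ]        ≈⟨ coeff-⊛-top g p (below mg) bp₁ ⟨
        (g ⊛ p) [x^ d ℕ.+ (t ℕ.+ b) ]      ≈⟨ vanishes bgp _ (ℕₚ.+-monoʳ-≤ d (ℕₚ.m≤m+n t b)) ⟩
        0#                                 ∎
      bp′ : Below p (t ℕ.+ b)
      bp′ = Below-lower bp₁ top≈0

  ⊛-cancel-[] : ∀ {g d} p → MonicOf g d → g ⊛ p ≋ [] → p ≋ []
  ⊛-cancel-[] p mg e = Below-0 (Below-cancel p mg (mkBelow λ k _ → coeff≈ e k))

  ≋⇒⊖≋[] : ∀ {p q} → p ≋ q → p ⊕ neg q ≋ []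
  ≋⇒⊖≋[] {p} {q} e = ≋-trans (⊕-cong e (≋-refl {neg q})) (neg-inverseʳ q)

  ⊖≋[]⇒≋ : ∀ {p q} → p ⊕ neg q ≋ [] → p ≋ q
  ⊖≋[]⇒≋ {p} {q} e = ≋-trans
    (solveₚ 2 (λ p q → p ⊜ p :⊖ q :⊕ q) ≋-refl p q) (⊕-cong e (≋-refl {q}))

  ⊛-cancelˡ : ∀ {g d} p q → MonicOf g d → g ⊛ p ≋ g ⊛ q → p ≋ q
  ⊛-cancelˡ {g} p q mg e = ⊖≋[]⇒≋ (⊛-cancel-[] (p ⊕ neg q) mg (≋-trans
    (solveₚ 3 (λ g p q → g :⊛ (p :⊖ q) ⊜ g :⊛ p :⊖ g :⊛ q) ≋-refl g p q) (≋⇒⊖≋[] e)))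

  MonicOf-quotient : ∀ {g d} p {m} → MonicOf g d → MonicOf (g ⊛ p) (d ℕ.+ m) → MonicOf p m
  MonicOf-quotient {g} {d} p {m} mg mgp = monicOf
    (begin
      p [x^ m ]                   ≈⟨ *-identityˡ _ ⟨
      1# * p [x^ m ]              ≈⟨ *-congʳ (leading mg) ⟨
      g [x^ d ] * p [x^ m ]       ≈⟨ coeff-⊛-top g p (below mg) b ⟨
      (g ⊛ p) [x^ d ℕ.+ m ]       ≈⟨ leading mgp ⟩
      1#                          ∎)
    b
    where
    b : Below p (suc m)
    b = Below-cancel p mg (≡.subst (Below (g ⊛ p)) (≡.sym (ℕₚ.+-suc d m)) (below mgp))

  MonicOf-unit : ∀ {p} → MonicOf p 0 → p ≋ 1# ∷ []
  MonicOf-unit {p} mp = mk≋ λ { zero → leading mp ; (suc k) → vanishes (below mp) (suc k) (s≤s z≤n) }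

  -- Long division by recursion from the constant term. If p = g s + t, then a + X p = g (X s) + (a
  -- + X t); the new remainder has degree at most d, and subtracting a multiple of the monic g
  -- brings it below d. No coefficient is inverted or compared with 0.
  divide : ∀ p {g d} → MonicOf g d → ∃[ s ] ∃[ t ] (p ≋ g ⊛ s ⊕ t × Below t d)
  divide []      {g} mg = [] , [] , ≋-sym (⊕-cong (⊛-zeroʳ g) (≋-refl {[]})) , Below-[]
  divide (a ∷ p) {g} {d} mg with divide p mg
  ... | s , t , p≋ , bt = lead ∷ s , (a ∷ t) ⊕ scale (- lead) g , eq , b
    where
    lead = (a ∷ t) [x^ d ]
    b : Below ((a ∷ t) ⊕ scale (- lead) g) d
    b = Below-lower (Below-⊕ (a ∷ t) (scale (- lead) g) (Below-∷ bt) (Below-scale (- lead) g (below mg))) (begin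
      ((a ∷ t) ⊕ scale (- lead) g) [x^ d ]    ≈⟨ coeff-⊕ (a ∷ t) (scale (- lead) g) d ⟩
      lead + scale (- lead) g [x^ d ]
        ≈⟨ +-congˡ (trans (coeff-scale (- lead) g d) (*-congˡ (leading mg))) ⟩
      lead + - lead * 1#                      ≈⟨ +-congˡ (*-identityʳ _) ⟩
      lead - lead                             ≈⟨ -‿inverseʳ lead ⟩
      0#                                      ∎)
    eq : a ∷ p ≋ g ⊛ (lead ∷ s) ⊕ ((a ∷ t) ⊕ scale (- lead) g)
    eq = a ∷ p
        ≋⟨ ∷≋constant⊕X⊛ a p ⟩
      constant a ⊕ X ⊛ p
        ≋⟨ ⊕-cong (≋-refl {constant a}) (⊛-congˡ X p≋) ⟩
      constant a ⊕ X ⊛ (g ⊛ s ⊕ t)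
        ≋⟨ solveₚ 6 (λ a X g s t l → a :⊕ X :⊛ (g :⊛ s :⊕ t) ⊜ g :⊛ (l :⊕ X :⊛ s) :⊕
            ((a :⊕ X :⊛ t) :⊕ (:⊖ l) :⊛ g))
             ≋-refl (constant a) X g s t (constant lead) ⟩
      g ⊛ (constant lead ⊕ X ⊛ s) ⊕ ((constant a ⊕ X ⊛ t) ⊕ neg (constant lead) ⊛ g)
        ≋⟨ ⊕-cong (⊛-congˡ g (≋-sym (∷≋constant⊕X⊛ lead s))) (⊕-cong (≋-sym (∷≋constant⊕X⊛ a t))
             (≋-trans (⊛-congʳ g (constant-cong (solve 1 (λ l → con (ℤ.- + 1) :* l := :- l) refl lead)))
                 (≋-sym (scale≋constant⊛ (- lead) g)))) ⟩
      g ⊛ (lead ∷ s) ⊕ ((a ∷ t) ⊕ scale (- lead) g) ∎ₚ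

  eval-vanishing : ∀ p z → p ≋ [] → eval p z ≈ 0#
  eval-vanishing []      z e = refl
  eval-vanishing (a ∷ p) z e = trans (+-cong (coeff≈ e 0) (*-congˡ (eval-vanishing p z (∷≋[]-tail e))))
      (trans (+-identityˡ _) (zeroʳ z))

  eval-cong : ∀ {p q} z → p ≋ q → eval p z ≈ eval q z
  eval-cong {[]}    {q}     z e = sym (eval-vanishing q z (≋-sym e))
  eval-cong {a ∷ p} {[]}    z e = eval-vanishing (a ∷ p) z e
  eval-cong {a ∷ p} {b ∷ q} z e = +-cong (coeff≈ e 0) (*-congˡ (eval-cong z (∷-tail e)))

  eval-congʳ : ∀ p {y z} → y ≈ z → eval p y ≈ eval p z
  eval-congʳ []      e = refl
  eval-congʳ (a ∷ p) e = +-congˡ (*-cong e (eval-congʳ p e))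

  eval-⊕ : ∀ p q z → eval (p ⊕ q) z ≈ eval p z + eval q z
  eval-⊕ []      q       z = sym (+-identityˡ _)
  eval-⊕ (a ∷ p) []      z = sym (+-identityʳ _)
  eval-⊕ (a ∷ p) (b ∷ q) z = trans (+-congˡ (*-congˡ (eval-⊕ p q z)))
    (solve 5 (λ a b z u v → a :+ b :+ z :* (u :+ v) := a :+ z :* u :+ (b :+ z :* v)) refl a b z (eval p z)
      (eval q z))

  eval-scale : ∀ a p z → eval (scale a p) z ≈ a * eval p z
  eval-scale a []      z = sym (zeroʳ a)
  eval-scale a (b ∷ p) z = trans (+-congˡ (*-congˡ (eval-scale a p z)))
    (solve 4 (λ a b z u → a :* b :+ z :* (a :* u) := a :* (b :+ z :* u)) refl a b z (eval p z))

  eval-⊛ : ∀ p q z → eval (p ⊛ q) z ≈ eval p z * eval q z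
  eval-⊛ []      q z = sym (zeroˡ _)
  eval-⊛ (a ∷ p) q z = begin
    eval (scale a q ⊕ (0# ∷ p ⊛ q)) z                 ≈⟨ eval-⊕ (scale a q) (0# ∷ p ⊛ q) z ⟩
    eval (scale a q) z + (0# + z * eval (p ⊛ q) z)
      ≈⟨ +-cong (eval-scale a q z) (+-congˡ (*-congˡ (eval-⊛ p q z))) ⟩
    a * eval q z + (0# + z * (eval p z * eval q z))
      ≈⟨ solve 4 (λ a z u v → a :* v :+ (con (+ 0) :+ z :* (u :* v)) := (a :+ z :* u) :* v) refl a z
          (eval p z) (eval q z) ⟩
    (a + z * eval p z) * eval q z                     ∎

  eval-x- : ∀ a z → eval (x- a) z ≈ z - a
  eval-x- a z = solve 2 (λ a z → (:- a) :+ z :* (con (+ 1) :+ z :* con (+ 0)) := z :- a) refl a z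

  eval-1 : ∀ z → eval (1# ∷ []) z ≈ 1#
  eval-1 z = trans (+-congˡ (zeroʳ z)) (+-identityʳ 1#)

  -- Synthetic division: the intermediate values of Horner's scheme at a are the coefficients of the
  -- quotient.
  factor : ∀ p a → ∃[ q ] (p ≋ (x- a) ⊛ q ⊕ constant (eval p a))
  factor []      a = [] , ≋-sym (≋-trans (⊕-cong (⊛-zeroʳ (x- a)) (∷≋[] refl ≋-refl)) ≋-refl)
  factor (b ∷ p) a with factor p a
  ... | q , p≋ = eval p a ∷ q , (b ∷ p
        ≋⟨ ∷≋constant⊕X⊛ b p ⟩
      constant b ⊕ X ⊛ p
        ≋⟨ ⊕-cong (≋-refl {constant b})
            (⊛-congˡ X (≋-trans p≋ (⊕-cong (⊛-congʳ q (x-≋X⊖constant a)) (≋-refl {constant (eval p a)})))) ⟩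
      constant b ⊕ X ⊛ ((X ⊕ neg (constant a)) ⊛ q ⊕ constant (eval p a))
        ≋⟨ solveₚ 5 (λ X a b e q → b :⊕ X :⊛ ((X :⊖ a) :⊛ q :⊕ e) ⊜ (X :⊖ a) :⊛ (e :⊕ X :⊛ q) :⊕ (b :⊕ a :⊛ e))
             ≋-refl X (constant a) (constant b) (constant (eval p a)) q ⟩
      (X ⊕ neg (constant a)) ⊛ (constant (eval p a) ⊕ X ⊛ q) ⊕ (constant b ⊕ constant a ⊛ constant (eval p a))
        ≋⟨ ⊕-cong (⊛-cong (x-≋X⊖constant a) (∷≋constant⊕X⊛ (eval p a) q))
            (⊕-cong (≋-refl {constant b}) (constant-* a (eval p a))) ⟨
      (x- a) ⊛ (eval p a ∷ q) ⊕ constant (b + a * eval p a) ∎ₚ)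

  deriv-vanishing : ∀ p → p ≋ [] → deriv p ≋ []
  deriv-vanishing []      e = ≋-refl
  deriv-vanishing (a ∷ p) e = ⊕-cong (∷≋[]-tail e) (∷≋[] refl (deriv-vanishing p (∷≋[]-tail e)))

  deriv-cong : ∀ {p q} → p ≋ q → deriv p ≋ deriv q
  deriv-cong {[]}    {q}     e = ≋-sym (deriv-vanishing q (≋-sym e))
  deriv-cong {a ∷ p} {[]}    e = deriv-vanishing (a ∷ p) e
  deriv-cong {a ∷ p} {b ∷ q} e = ⊕-cong (∷-tail e) (∷-cong refl (deriv-cong (∷-tail e)))

  deriv-∷ : ∀ a p → deriv (a ∷ p) ≋ p ⊕ X ⊛ deriv p
  deriv-∷ a p = ⊕-cong (≋-refl {p}) (0∷≋X⊛ (deriv p))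

  deriv-⊕ : ∀ p q → deriv (p ⊕ q) ≋ deriv p ⊕ deriv q
  deriv-⊕ []      q       = ≋-refl
  deriv-⊕ (a ∷ p) []      = ≋-sym (⊕-identityʳ _)
  deriv-⊕ (a ∷ p) (b ∷ q) = ≋-trans (deriv-∷ (a + b) (p ⊕ q)) (≋-trans
    (⊕-cong (≋-refl {p ⊕ q}) (⊛-congˡ X (deriv-⊕ p q)))
    (≋-trans (solveₚ 5 (λ X p q p′ q′ → p :⊕ q :⊕ X :⊛ (p′ :⊕ q′) ⊜ (p :⊕ X :⊛ p′) :⊕ (q :⊕ X :⊛ q′)) ≋-refl X
        p q (deriv p) (deriv q))
      (⊕-cong (≋-sym (deriv-∷ a p)) (≋-sym (deriv-∷ b q)))))

  deriv-scale : ∀ a p → deriv (scale a p) ≋ scale a (deriv p)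
  deriv-scale a []      = ≋-refl
  deriv-scale a (b ∷ p) = ≋-trans
    (⊕-cong (≋-refl {scale a p}) (∷-cong (sym (zeroʳ a)) (deriv-scale a p)))
    (≋-sym (scale-⊕ a p (0# ∷ deriv p)))

  deriv-⊛ : ∀ p q → deriv (p ⊛ q) ≋ deriv p ⊛ q ⊕ p ⊛ deriv q
  deriv-⊛ []      q = ≋-refl
  deriv-⊛ (a ∷ p) q = deriv (scale a q ⊕ (0# ∷ p ⊛ q))
      ≋⟨ deriv-⊕ (scale a q) (0# ∷ p ⊛ q) ⟩
    deriv (scale a q) ⊕ deriv (0# ∷ p ⊛ q)
      ≋⟨ ⊕-cong (≋-trans (deriv-scale a q) (scale≋constant⊛ a (deriv q)))
          (≋-trans (deriv-∷ 0# (p ⊛ q)) (⊕-cong (≋-refl {p ⊛ q}) (⊛-congˡ X (deriv-⊛ p q)))) ⟩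
    constant a ⊛ deriv q ⊕ (p ⊛ q ⊕ X ⊛ (deriv p ⊛ q ⊕ p ⊛ deriv q))
      ≋⟨ solveₚ 6 (λ a X p q p′ q′ → a :⊛ q′ :⊕ (p :⊛ q :⊕ X :⊛ (p′ :⊛ q :⊕ p :⊛ q′)) ⊜ (p :⊕ X :⊛ p′) :⊛ q :⊕
          (a :⊕ X :⊛ p) :⊛ q′)
           ≋-refl (constant a) X p q (deriv p) (deriv q) ⟩
    (p ⊕ X ⊛ deriv p) ⊛ q ⊕ (constant a ⊕ X ⊛ p) ⊛ deriv q
      ≋⟨ ⊕-cong (⊛-congʳ q (deriv-∷ a p)) (⊛-congʳ (deriv q) (∷≋constant⊕X⊛ a p)) ⟨
    deriv (a ∷ p) ⊛ q ⊕ (a ∷ p) ⊛ deriv q ∎ₚ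

  deriv-x- : ∀ a → deriv (x- a) ≋ 1# ∷ []
  deriv-x- a = mk≋ λ { zero → +-identityʳ 1# ; (suc zero) → refl ; (suc (suc k)) → refl }

  -- The second-order remainder l is built along Horner's scheme, by replacing l with p′(x) + y l,
  -- so that no division by (y - x)² takes place.
  taylor : ∀ p x y → ∃[ l ] (eval p y ≈ eval p x + (y - x) * (eval (deriv p) x + (y - x) * l))
  taylor []      x y = 0# , solve 2
      (λ x y → con (+ 0) := con (+ 0) :+ (y :- x) :* (con (+ 0) :+ (y :- x) :* con (+ 0))) refl x y
  taylor (a ∷ p) x y with taylor p x y
  ... | l , e = eval (deriv p) x + y * l , (begin
    a + y * eval p y
      ≈⟨ +-congˡ (*-congˡ e) ⟩
    a + y * (eval p x + (y - x) * (eval (deriv p) x + (y - x) * l))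
      ≈⟨ solve 6 (λ a x y u v l → a :+ y :* (u :+ (y :- x) :* (v :+ (y :- x) :* l))
           := a :+ x :* u :+ (y :- x) :* (u :+ (con (+ 0) :+ x :* v) :+ (y :- x) :* (v :+ y :* l))) refl a x y
               (eval p x) (eval (deriv p) x) l ⟩
    a + x * eval p x + (y - x) * (eval p x + (0# + x * eval (deriv p) x) + (y - x) * (eval (deriv p) x + y * l))
      ≈⟨ +-congˡ (*-congˡ (+-congʳ (eval-⊕ p (0# ∷ deriv p) x))) ⟨
    a + x * eval p x + (y - x) * (eval (deriv (a ∷ p)) x + (y - x) * (eval (deriv p) x + y * l)) ∎)

  ∘ₚ-vanishing : ∀ p q → p ≋ [] → p ∘ₚ q ≋ []
  ∘ₚ-vanishing []      q e = ≋-refl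
  ∘ₚ-vanishing (a ∷ p) q e = ⊕-cong (∷≋[] (coeff≈ e 0) ≋-refl)
    (≋-trans (⊛-congˡ q (∘ₚ-vanishing p q (∷≋[]-tail e))) (⊛-zeroʳ q))

  ∘ₚ-congʳ : ∀ {p p′} q → p ≋ p′ → p ∘ₚ q ≋ p′ ∘ₚ q
  ∘ₚ-congʳ {[]}    {p′}     q e = ≋-sym (∘ₚ-vanishing p′ q (≋-sym e))
  ∘ₚ-congʳ {a ∷ p} {[]}     q e = ∘ₚ-vanishing (a ∷ p) q e
  ∘ₚ-congʳ {a ∷ p} {b ∷ p′} q e = ⊕-cong (constant-cong (coeff≈ e 0)) (⊛-congˡ q (∘ₚ-congʳ q (∷-tail e)))

  ∘ₚ-⊕ : ∀ p p′ q → (p ⊕ p′) ∘ₚ q ≋ p ∘ₚ q ⊕ p′ ∘ₚ q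
  ∘ₚ-⊕ []      p′       q = ≋-refl
  ∘ₚ-⊕ (a ∷ p) []       q = ≋-sym (⊕-identityʳ _)
  ∘ₚ-⊕ (a ∷ p) (b ∷ p′) q = ≋-trans
    (⊕-cong (≋-refl {constant (a + b)}) (⊛-congˡ q (∘ₚ-⊕ p p′ q)))
    (solveₚ 5 (λ a b q u v → a :⊕ b :⊕ q :⊛ (u :⊕ v) ⊜ (a :⊕ q :⊛ u) :⊕ (b :⊕ q :⊛ v)) ≋-refl (constant a)
      (constant b) q (p ∘ₚ q) (p′ ∘ₚ q))

  ∘ₚ-scale : ∀ a p q → scale a p ∘ₚ q ≋ scale a (p ∘ₚ q)
  ∘ₚ-scale a []      q = ≋-refl
  ∘ₚ-scale a (b ∷ p) q = ≋-trans
    (⊕-cong (constant-* a b) (⊛-congˡ q (≋-trans (∘ₚ-scale a p q) (scale≋constant⊛ a (p ∘ₚ q)))))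
    (≋-trans (solveₚ 4 (λ a b q u → a :⊛ b :⊕ q :⊛ (a :⊛ u) ⊜ a :⊛ (b :⊕ q :⊛ u)) ≋-refl (constant a)
        (constant b) q (p ∘ₚ q))
      (≋-sym (scale≋constant⊛ a (constant b ⊕ q ⊛ (p ∘ₚ q)))))

  MonicOf-shift : ∀ p {d} → MonicOf p d → MonicOf (shift p) d
  MonicOf-shift []      {d}     m = m
  MonicOf-shift (a ∷ p) {zero}  m = MonicOf-resp (≋-sym eq) MonicOf-1
    where
    eq : shift (a ∷ p) ≋ 1# ∷ []
    eq = ⊕-cong (constant-cong (leading m))
        (≋-trans (⊛-congˡ (x- 1#) (∘ₚ-vanishing p (x- 1#) (Below-0 (Below-tail (below m))))) (⊛-zeroʳ (x- 1#)))
  MonicOf-shift (a ∷ p) {suc d} m = monicOf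
    (trans (coeff-⊕ (constant a) (x- 1# ⊛ shift p) (suc d)) (trans (+-identityˡ _) (leading top)))
    (Below-⊕ (constant a) (x- 1# ⊛ shift p) (mkBelow λ { (suc k) _ → refl }) (below top))
    where
    top : MonicOf (x- 1# ⊛ shift p) (suc d)
    top = MonicOf-⊛ (MonicOf-x- 1#) (MonicOf-shift p (monicOf (leading m) (Below-tail (below m))))

-- Products of linear factors, Lagrange combinations and grouped roots.

module RootVectors {c ℓ} (R : CommutativeRing c ℓ) where
  open CommutativeRing R hiding (zero)
  open PolynomialRing R
  open PolynomialDegree R
  open IntegerCoefficients R using (solve; _:=_; _:+_; _:*_; _:-_; :-_; con)
  open PolynomialSolver using (solveₚ; _⊜_; _:⊕_; _:⊛_; conₚ)
  open import Algebra.Properties.Semiring.Mult.TCOptimised semiring using (1+×) renaming (_×_ to _·_)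
  open import Relation.Binary.Reasoning.Setoid setoid

  linears : ∀ {n} → Vector Carrier n → Poly
  linears v = ∏ λ i → x- v i

  -- Has the shape of `Minⱼ`, so that over ℝ the two agree by computation.
  omit : ∀ {n} → Vector Carrier n → Fin n → Poly
  omit v j = ∏ λ i → if does (i ≟ j) then 1# ∷ [] else (x- v i)

  -- The Lagrange combination ∑ⱼ cⱼ ∏_{i ≠ j} (x − vᵢ), see combination≋∑ₚ.
  combination : ∀ {n} → Vector Carrier n → Vector Carrier n → Poly
  combination {zero}  c v = []
  combination {suc n} c v = scale (head c) (linears (tail v)) ⊕ (x- head v) ⊛ combination (tail c) (tail v)

  ∑ₚ : ∀ {n} → Vector Poly n → Poly
  ∑ₚ = Vector.foldr _⊕_ []

  ∑ₚ-cong : ∀ {n} {p q : Vector Poly n} → (∀ i → p i ≋ q i) → ∑ₚ p ≋ ∑ₚ q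
  ∑ₚ-cong {zero}  e = ≋-refl
  ∑ₚ-cong {suc n} e = ⊕-cong (e zero) (∑ₚ-cong (λ i → e (suc i)))

  ∑ₚ-⊛ : ∀ {n} q (p : Vector Poly n) → ∑ₚ (λ i → q ⊛ p i) ≋ q ⊛ ∑ₚ p
  ∑ₚ-⊛ {zero}  q p = ≋-sym (⊛-zeroʳ q)
  ∑ₚ-⊛ {suc n} q p = ≋-trans (⊕-cong (≋-refl {q ⊛ head p}) (∑ₚ-⊛ q (tail p)))
      (≋-sym (⊛-distribˡ q (head p) (∑ₚ (tail p))))

  combination≋∑ₚ : ∀ {n} (c v : Vector Carrier n) → combination c v ≋ ∑ₚ λ j → scale (c j) (omit v j)
  combination≋∑ₚ {zero}  c v = ≋-refl
  combination≋∑ₚ {suc n} c v = ⊕-cong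
    (scale-cong refl (≋-sym (⊛-identityˡ (linears (tail v)))))
    (≋-trans (⊛-congˡ (x- head v) (combination≋∑ₚ (tail c) (tail v)))
      (≋-trans (≋-sym (∑ₚ-⊛ (x- head v) (λ j → scale (tail c j) (omit (tail v) j))))
        (∑ₚ-cong λ j → swap (x- head v) (tail c j) (omit (tail v) j))))
    where
    swap : ∀ p a q → p ⊛ scale a q ≋ scale a (p ⊛ q)
    swap p a q = ≋-trans (⊛-comm p (scale a q)) (≋-trans (scale-⊛ a q p) (scale-cong refl (⊛-comm q p)))

  MonicOf-linears : ∀ {n} (v : Vector Carrier n) → MonicOf (linears v) n
  MonicOf-linears {zero}  v = MonicOf-1
  MonicOf-linears {suc n} v = MonicOf-⊛ (MonicOf-x- (head v)) (MonicOf-linears (tail v))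

  eval-linears-root : ∀ {n} (v : Vector Carrier n) i → eval (linears v) (v i) ≈ 0#
  eval-linears-root v zero = trans (eval-⊛ (x- head v) (linears (tail v)) (head v))
    (trans (*-congʳ (trans (eval-x- (head v) (head v)) (-‿inverseʳ (head v)))) (zeroˡ _))
  eval-linears-root v (suc i) = trans (eval-⊛ (x- head v) (linears (tail v)) (tail v i))
    (trans (*-congˡ (eval-linears-root (tail v) i)) (zeroʳ _))

  -- Non-zero-divisors. Both kinds of gaps between roots that occur, nonzero reals and positive
  -- units, are regular, and cancellation is all that the divisibility arguments ask of a gap.
  Regular : Carrier → Set (c ⊔ ℓ)
  Regular a = ∀ z → a * z ≈ 0# → z ≈ 0#

  Regular-resp : ∀ {a b} → a ≈ b → Regular a → Regular b
  Regular-resp a≈b ra z bz≈0 = ra z (trans (*-congʳ a≈b) bz≈0)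

  Regular-1 : Regular 1#
  Regular-1 z e = trans (sym (*-identityˡ z)) e

  Regular-* : ∀ {a b} → Regular a → Regular b → Regular (a * b)
  Regular-* ra rb z e = rb z (ra _ (trans (sym (*-assoc _ _ z)) e))

  Regular-swap : ∀ {a b} → Regular (a - b) → Regular (b - a)
  Regular-swap {a} {b} r z e = r z (begin
    (a - b) * z        ≈⟨ solve 3 (λ a b z → (a :- b) :* z := :- ((b :- a) :* z)) refl a b z ⟩
    - ((b - a) * z)    ≈⟨ -‿cong e ⟩
    - 0#               ≈⟨ solve 0 (:- con (+ 0) := con (+ 0)) refl ⟩
    0#                 ∎)

  Distinct : ∀ {n} → Vector Carrier n → Set (c ⊔ ℓ)
  Distinct u = ∀ i j → i Fin.< j → Regular (u j - u i)

  Distinct-tail : ∀ {n} {u : Vector Carrier (suc n)} → Distinct u → Distinct (tail u)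
  Distinct-tail d i j i<j = d (suc i) (suc j) (s≤s i<j)

  -- After x - u₀ is split off, the quotient still vanishes at every other uⱼ, since the regular
  -- factor uⱼ - u₀ can be cancelled there.
  roots⇒linears-∣ : ∀ {n} (u : Vector Carrier n) → Distinct u →
    ∀ e → (∀ j → eval e (u j) ≈ 0#) → ∃[ f ] (e ≋ linears u ⊛ f)
  roots⇒linears-∣ {zero}  u d e roots = e , ≋-sym (⊛-identityˡ e)
  roots⇒linears-∣ {suc n} u d e roots with factor e (head u)
  ... | q , e≋ = extend (roots⇒linears-∣ (tail u) (Distinct-tail d) q tail-roots)
    where
    e≋′ : e ≋ (x- head u) ⊛ q
    e≋′ = ≋-trans e≋ (≋-trans (⊕-cong (≋-refl {(x- head u) ⊛ q}) (∷≋[] (roots zero) ≋-refl)) (⊕-identityʳ _))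
    tail-roots : ∀ j → eval q (tail u j) ≈ 0#
    tail-roots j = d zero (suc j) (s≤s z≤n) _ (begin
      (u (suc j) - u zero) * eval q (tail u j)            ≈⟨ *-congʳ (eval-x- (u zero) (u (suc j))) ⟨
      eval (x- head u) (u (suc j)) * eval q (tail u j)    ≈⟨ eval-⊛ (x- head u) q (u (suc j)) ⟨
      eval ((x- head u) ⊛ q) (u (suc j))                  ≈⟨ eval-cong (u (suc j)) e≋′ ⟨
      eval e (u (suc j))                                  ≈⟨ roots (suc j) ⟩
      0#                                                  ∎)
    extend : ∃[ f ] (q ≋ linears (tail u) ⊛ f) → ∃[ f ] (e ≋ linears u ⊛ f)
    extend (f , q≋) = f , ≋-trans e≋′
        (≋-trans (⊛-congˡ (x- head u) q≋) (≋-sym (⊛-assoc (x- head u) (linears (tail u)) f)))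

  Regular-eval-linears : ∀ {n} (v : Vector Carrier n) x → (∀ i → Regular (x - v i)) →
    Regular (eval (linears v) x)
  Regular-eval-linears {zero}  v x r = Regular-resp (sym (eval-1 x)) Regular-1
  Regular-eval-linears {suc n} v x r = Regular-resp
    (sym (trans (eval-⊛ (x- head v) (linears (tail v)) x) (*-congʳ (eval-x- (head v) x))))
    (Regular-* (r zero) (Regular-eval-linears (tail v) x (λ i → r (suc i))))

  -- At uⱼ all terms but the j-th vanish, which leaves cⱼ times the product of the differences uⱼ -
  -- uᵢ.
  Regular-eval-combination : ∀ {n} (c u : Vector Carrier n) → Distinct u → (∀ j → Regular (c j)) →
    ∀ j → Regular (eval (combination c u) (u j))
  Regular-eval-combination {suc n} c u d rc j = Regular-resp (sym (expand (u j))) (go j)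
    where
    C : Carrier → Carrier
    C = eval (combination (tail c) (tail u))
    expand : ∀ z → eval (combination c u) z ≈ head c * eval (linears (tail u)) z + (z - head u) * C z
    expand z = trans (eval-⊕ (scale (head c) (linears (tail u))) _ z)
        (+-cong (eval-scale (head c) (linears (tail u)) z)
      (trans (eval-⊛ (x- head u) (combination (tail c) (tail u)) z) (*-congʳ (eval-x- (head u) z))))
    go : ∀ j → Regular (head c * eval (linears (tail u)) (u j) + (u j - head u) * C (u j))
    go zero = Regular-resp
      (solve 3 (λ a x z → a := a :+ (x :- x) :* z) refl (head c * eval (linears (tail u)) (head u)) (head u)
        (C (head u)))
      (Regular-* (rc zero) (Regular-eval-linears (tail u) (head u)
          (λ i → Regular-swap (d zero (suc i) (s≤s z≤n)))))
    go (suc j) = Regular-resp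
      (sym (trans (+-congʳ (trans (*-congˡ (eval-linears-root (tail u) j)) (zeroʳ _))) (+-identityˡ _)))
      (Regular-* (d zero (suc j) (s≤s z≤n))
          (Regular-eval-combination (tail c) (tail u) (Distinct-tail d) (λ j → rc (suc j)) j))

  -- At each uⱼ the value of h k is regular while that of e k is 0, so e vanishes there. In effect
  -- `linears u` and the combination are coprime: splitting off a common factor k leaves all of
  -- `linears u` inside e.
  common-factor : ∀ {n} (c u : Vector Carrier n) → Distinct u → (∀ j → Regular (c j)) →
    ∀ {e h k} → linears u ≋ e ⊛ k → combination c u ≋ h ⊛ k → ∃[ f ] (e ≋ linears u ⊛ f)
  common-factor c u d rc {e} {h} {k} lin≋ comb≋ = roots⇒linears-∣ u d e λ j →
    Regular-resp (trans (eval-cong (u j) comb≋) (eval-⊛ h k (u j))) (Regular-eval-combination c u d rc j) _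
        (begin
      eval h (u j) * eval k (u j) * eval e (u j)
        ≈⟨ solve 3 (λ h k e → h :* k :* e := h :* (e :* k)) refl (eval h (u j)) (eval k (u j)) (eval e (u j)) ⟩
      eval h (u j) * (eval e (u j) * eval k (u j))
        ≈⟨ *-congˡ (eval-⊛ e k (u j)) ⟨
      eval h (u j) * eval (e ⊛ k) (u j)
        ≈⟨ *-congˡ (eval-cong (u j) lin≋) ⟨
      eval h (u j) * eval (linears u) (u j)
        ≈⟨ *-congˡ (eval-linears-root u j) ⟩
      eval h (u j) * 0#
        ≈⟨ zeroʳ _ ⟩
      0# ∎)

  -- v lists the entries of u with multiplicities, equal entries being adjacent.
  data Grouped {d} (D : Carrier → Set d) : ∀ {n r} →
      Vector Carrier (suc n) → Vector Carrier (suc r) → Set (c ⊔ ℓ ⊔ d) where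
    single : ∀ {v u : Vector Carrier 1} → head v ≈ head u → Grouped D v u
    repeat : ∀ {n r} {v : Vector Carrier (suc (suc n))} {u : Vector Carrier (suc r)} →
      head v ≈ head u → Grouped D (tail v) u → Grouped D v u
    fresh  : ∀ {n r} {v : Vector Carrier (suc (suc n))} {u : Vector Carrier (suc (suc r))} →
      head v ≈ head u → (∀ j → D (tail u j - head u)) → Grouped D (tail v) (tail u) → Grouped D v u

  module _ {d} {D : Carrier → Set d} where

    Grouped-head : ∀ {n r} {v : Vector Carrier (suc n)} {u : Vector Carrier (suc r)} →
      Grouped D v u → head v ≈ head u
    Grouped-head (single e)    = e
    Grouped-head (repeat e _)  = e
    Grouped-head (fresh e _ _) = e

    Grouped-apart : ∀ {n r} {v : Vector Carrier (suc n)} {u : Vector Carrier (suc r)} → Grouped D v u →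
      ∀ i j → i Fin.< j → D (u j - u i)
    Grouped-apart (single _)    zero    zero    ()
    Grouped-apart (repeat _ g)  i       j       i<j       = Grouped-apart g i j i<j
    Grouped-apart (fresh _ a g) zero    (suc j) _         = a j
    Grouped-apart (fresh _ a g) (suc i) (suc j) (s≤s i<j) = Grouped-apart g i j i<j

    Grouped-⊆ : ∀ {n r} {v : Vector Carrier (suc n)} {u : Vector Carrier (suc r)} →
      Grouped D v u → ∀ i → ∃[ j ] v i ≈ u j
    Grouped-⊆ (single e)    zero    = zero , e
    Grouped-⊆ (repeat e _)  zero    = zero , e
    Grouped-⊆ (repeat _ g)  (suc i) = Grouped-⊆ g i
    Grouped-⊆ (fresh e _ _) zero    = zero , e
    Grouped-⊆ (fresh _ _ g) (suc i) with Grouped-⊆ g i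
    ... | j , e = suc j , e

    Grouped-⊇ : ∀ {n r} {v : Vector Carrier (suc n)} {u : Vector Carrier (suc r)} →
      Grouped D v u → ∀ j → ∃[ i ] u j ≈ v i
    Grouped-⊇ (single e)    zero    = zero , sym e
    Grouped-⊇ (repeat _ g)  j with Grouped-⊇ g j
    ... | i , e = suc i , e
    Grouped-⊇ (fresh e _ _) zero    = zero , sym e
    Grouped-⊇ (fresh _ _ g) (suc j) with Grouped-⊇ g j
    ... | i , e = suc i , e

    Grouped-≤ : ∀ {n r} {v : Vector Carrier (suc n)} {u : Vector Carrier (suc r)} → Grouped D v u → r ℕ.≤ n
    Grouped-≤ (single _)    = z≤n
    Grouped-≤ (repeat _ g)  = ℕₚ.m≤n⇒m≤1+n (Grouped-≤ g)
    Grouped-≤ (fresh _ _ g) = s≤s (Grouped-≤ g)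

    -- The second alternative asks for apartness from all later entries, not just from the next one:
    -- `D` is not assumed transitive, and a fresh root has to be apart from every later
    -- representative. `resp` moves this from the entries of v to those of u.
    group : ∀ {n} (v : Vector Carrier (suc n)) → (∀ {a b} → a ≈ b → D a → D b) →
      (∀ i → v (inject₁ i) ≈ v (suc i) ⊎ (∀ j → inject₁ i Fin.< j → D (v j - v (inject₁ i)))) →
      ∃[ r ] Σ[ u ∈ Vector Carrier (suc r) ] Grouped D v u
    group {zero}  v resp dec = zero , v , single refl
    group {suc n} v resp dec with group (tail v) resp (λ i → tail-dec (dec (suc i)))
      where
      tail-dec : ∀ {i} → tail v (inject₁ i) ≈ tail v (suc i) ⊎
          (∀ j → inject₁ (suc i) Fin.< j → D (v j - tail v (inject₁ i))) →
        tail v (inject₁ i) ≈ tail v (suc i) ⊎ (∀ j → inject₁ i Fin.< j → D (tail v j - tail v (inject₁ i)))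
      tail-dec (inj₁ e) = inj₁ e
      tail-dec (inj₂ a) = inj₂ λ j i<j → a (suc j) (s≤s i<j)
    ... | r , u , g with dec zero
    ... | inj₁ e = r , u , repeat (trans e (Grouped-head g)) g
    ... | inj₂ a = suc r , (head v Vector.∷ u) , fresh refl apart g
      where
      apart : ∀ j → D (u j - head v)
      apart j with Grouped-⊇ g j
      ... | i , e = resp (+-congʳ (sym e)) (a (suc i) (s≤s z≤n))

    -- The factors left over when one copy of each root has gone into `linears u`: the product of
    -- the (x - uⱼ)^(mⱼ - 1).
    cofactor : ∀ {n r} {v : Vector Carrier (suc n)} {u : Vector Carrier (suc r)} → Grouped D v u → Poly
    cofactor (single _)           = 1# ∷ []
    cofactor (repeat {u = u} _ g) = (x- head u) ⊛ cofactor g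
    cofactor (fresh _ _ g)        = cofactor g

    multiplicity : ∀ {n r} {v : Vector Carrier (suc n)} {u : Vector Carrier (suc r)} →
      Grouped D v u → Vector ℕ (suc r)
    multiplicity (single _)    _       = 1
    multiplicity (repeat _ g)  zero    = suc (multiplicity g zero)
    multiplicity (repeat _ g)  (suc j) = multiplicity g (suc j)
    multiplicity (fresh _ _ g) zero    = 1
    multiplicity (fresh _ _ g) (suc j) = multiplicity g j

    multiplicity-positive : ∀ {n r} {v : Vector Carrier (suc n)} {u : Vector Carrier (suc r)}
        (g : Grouped D v u) j →
      0 ℕ.< multiplicity g j
    multiplicity-positive (single _)    _       = s≤s z≤n
    multiplicity-positive (repeat _ g)  zero    = s≤s z≤n
    multiplicity-positive (repeat _ g)  (suc j) = multiplicity-positive g (suc j)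
    multiplicity-positive (fresh _ _ g) zero    = s≤s z≤n
    multiplicity-positive (fresh _ _ g) (suc j) = multiplicity-positive g j

    linears-grouped : ∀ {n r} {v : Vector Carrier (suc n)} {u : Vector Carrier (suc r)} (g : Grouped D v u) →
      linears v ≋ linears u ⊛ cofactor g
    linears-grouped {v = v} {u} (single e) = ≋-trans (⊛-congʳ (1# ∷ []) (x-cong e))
      (≋-sym (≋-trans (⊛-comm (linears u) (1# ∷ [])) (⊛-identityˡ (linears u))))
    linears-grouped {v = v} {u} (repeat e g) = ≋-trans (⊛-cong (x-cong e) (linears-grouped g))
      (solveₚ 3 (λ L M G → L :⊛ (M :⊛ G) ⊜ M :⊛ (L :⊛ G)) ≋-refl (x- head u) (linears u) (cofactor g))
    linears-grouped {v = v} {u} (fresh e _ g) = ≋-trans (⊛-cong (x-cong e) (linears-grouped g))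
      (≋-sym (⊛-assoc (x- head u) (linears (tail u)) (cofactor g)))

    weights : ∀ {n r} {v : Vector Carrier (suc n)} {u : Vector Carrier (suc r)} →
      Grouped D v u → Vector Carrier (suc r)
    weights g j = multiplicity g j · 1#

    deriv-x-⊛ : ∀ a p → deriv ((x- a) ⊛ p) ≋ p ⊕ (x- a) ⊛ deriv p
    deriv-x-⊛ a p = ≋-trans (deriv-⊛ (x- a) p)
      (⊕-cong (≋-trans (⊛-congʳ p (deriv-x- a)) (⊛-identityˡ p)) (≋-refl {(x- a) ⊛ deriv p}))

    -- The logarithmic derivative, cleared of denominators. In (L p)′ = p + L p′ a repeated factor L
    -- = x - u₀ raises the weight of u₀ by one and joins the cofactor, whereas a fresh one enters
    -- with weight 1.
    deriv-linears-grouped : ∀ {n r} {v : Vector Carrier (suc n)} {u : Vector Carrier (suc r)}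
        (g : Grouped D v u) →
      deriv (linears v) ≋ combination (weights g) u ⊛ cofactor g
    deriv-linears-grouped {v = v} {u} (single e) =
      deriv (linears v)                                      ≋⟨ deriv-x-⊛ (head v) (1# ∷ []) ⟩
      (1# ∷ []) ⊕ (x- head v) ⊛ (0# ∷ [])
        ≋⟨ ⊕-cong (≋-refl {1# ∷ []}) (≋-trans (⊛-congˡ (x- head v) (∷≋[] refl ≋-refl)) (⊛-zeroʳ (x- head v))) ⟩
      (1# ∷ []) ⊕ []
        ≋⟨ ⊕-cong (scale-1 (1# ∷ [])) (⊛-zeroʳ (x- head u)) ⟨
      combination (weights (single {D = D} {v} {u} e)) u     ≋⟨ ≋-trans (⊛-comm _ (1# ∷ [])) (⊛-identityˡ _) ⟨
      combination (weights (single {D = D} {v} {u} e)) u ⊛ (1# ∷ [])   ∎ₚ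
    deriv-linears-grouped {v = v} {u} (repeat e g) =
      deriv (linears v)
        ≋⟨ ≋-trans (deriv-x-⊛ (head v) (linears (tail v)))
            (⊕-cong (linears-grouped g) (⊛-cong (x-cong e) (deriv-linears-grouped g))) ⟩
      (L ⊛ M) ⊛ G ⊕ L ⊛ ((scale (weights g zero) M ⊕ L ⊛ C) ⊛ G)
        ≋⟨ ⊕-cong (≋-refl {(L ⊛ M) ⊛ G})
            (⊛-congˡ L (⊛-congʳ G (⊕-cong (scale≋constant⊛ (weights g zero) M) (≋-refl {L ⊛ C})))) ⟩
      (L ⊛ M) ⊛ G ⊕ L ⊛ ((constant (weights g zero) ⊛ M ⊕ L ⊛ C) ⊛ G)
        ≋⟨ solveₚ 5 (λ L M G C w → (L :⊛ M) :⊛ G :⊕ L :⊛ ((w :⊛ M :⊕ L :⊛ C) :⊛ G) ⊜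
            ((conₚ (+ 1) :⊕ w) :⊛ M :⊕ L :⊛ C) :⊛ (L :⊛ G)) ≋-refl L M G C (constant (weights g zero)) ⟩
      (constant (1# + weights g zero) ⊛ M ⊕ L ⊛ C) ⊛ (L ⊛ G)
        ≋⟨ ⊛-congʳ (L ⊛ G) (⊕-cong (≋-trans (⊛-congʳ M (constant-cong (sym (1+× (multiplicity g zero) 1#))))
            (≋-sym (scale≋constant⊛ _ M))) (≋-refl {L ⊛ C})) ⟩
      (scale (suc (multiplicity g zero) · 1#) M ⊕ L ⊛ C) ⊛ (L ⊛ G) ∎ₚ
      where
      L = x- head u
      M = linears (tail u)
      G = cofactor g
      C = combination (tail (weights g)) (tail u)
    deriv-linears-grouped {v = v} {u} (fresh e _ g) =
      deriv (linears v)
        ≋⟨ ≋-trans (deriv-x-⊛ (head v) (linears (tail v)))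
            (⊕-cong (linears-grouped g) (⊛-cong (x-cong e) (deriv-linears-grouped g))) ⟩
      M ⊛ G ⊕ L ⊛ (C ⊛ G)
        ≋⟨ solveₚ 4 (λ L M G C → M :⊛ G :⊕ L :⊛ (C :⊛ G) ⊜ (M :⊕ L :⊛ C) :⊛ G) ≋-refl L M G C ⟩
      (M ⊕ L ⊛ C) ⊛ G
        ≋⟨ ⊛-congʳ G (⊕-cong (scale-1 M) (≋-refl {L ⊛ C})) ⟨
      (scale 1# M ⊕ L ⊛ C) ⊛ G ∎ₚ
      where
      L = x- head u
      M = linears (tail u)
      G = cofactor g
      C = combination (weights g) (tail u)

  -- Distinct roots as a grouping of themselves, all multiplicities being 1. It makes the derivative
  -- formula above available for `linears u`.
  Grouped-self : ∀ {d} {D : Carrier → Set d} {r} (u : Vector Carrier (suc r)) →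
    (∀ i j → i Fin.< j → D (u j - u i)) → Grouped D u u
  Grouped-self {r = zero}  u a = single refl
  Grouped-self {r = suc r} u a = fresh refl (λ j → a zero (suc j) (s≤s z≤n))
      (Grouped-self (tail u) λ i j i<j → a (suc i) (suc j) (s≤s i<j))

-- The part of the order of ℝ that holds constructively without comparing two elements. Antisymmetry
-- is what pins down an element squeezed between two equal ones.
record Nonnegativity {c ℓ} (R : CommutativeRing c ℓ) : Set (Level.suc (c ⊔ ℓ)) where
  open CommutativeRing R hiding (zero)
  field
    NonNeg         : Carrier → Set ℓ
    nonNeg-resp    : ∀ {a b} → a ≈ b → NonNeg a → NonNeg b
    nonNeg-+       : ∀ {a b} → NonNeg a → NonNeg b → NonNeg (a + b)
    nonNeg-*       : ∀ {a b} → NonNeg a → NonNeg b → NonNeg (a * b)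
    nonNeg-0       : NonNeg 0#
    nonNeg-1       : NonNeg 1#
    nonNeg-antisym : ∀ {a} → NonNeg a → NonNeg (- a) → a ≈ 0#

-- Interlacing root lists and nonnegative Lagrange coefficients.

module Interlacing {c ℓ} (R : CommutativeRing c ℓ) (O : Nonnegativity R) where
  open CommutativeRing R hiding (zero)
  open Nonnegativity O
  open PolynomialRing R
  open PolynomialDegree R
  open RootVectors R
  open IntegerCoefficients R using (solve; _:=_; _:+_; _:*_; _:-_; :-_)
  open PolynomialSolver using (solveₚ; _⊜_; _:⊕_; _:⊛_)

  -- A constructive form of a > 0. Since the inverse is nonnegative as well, quotients of
  -- nonnegative elements by a are available and nonnegative.
  PosUnit : Carrier → Set (c ⊔ ℓ)
  PosUnit a = NonNeg a × ∃[ s ] (NonNeg s × s * a ≈ 1#)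

  private
    -- In the application U = x - u₀ and L M = `linears u`. The expanded summands are sorted into
    -- those with the factor L M, which make up the new leading coefficient, and those with the
    -- factor U.
    regroup : ∀ c M a b U L g C → c ⊛ M ⊛ (a ⊛ U ⊕ b ⊛ L) ⊕ L ⊛ (g ⊛ M ⊕ U ⊛ C) ≋
      (c ⊛ b ⊕ g) ⊛ (L ⊛ M) ⊕ U ⊛ (c ⊛ a ⊛ M ⊕ L ⊛ C)
    regroup c M a b U L g C =
      c ⊛ M ⊛ (a ⊛ U ⊕ b ⊛ L) ⊕ L ⊛ (g ⊛ M ⊕ U ⊛ C)
        ≋⟨ ⊕-cong (⊛-distribˡ (c ⊛ M) (a ⊛ U) (b ⊛ L)) (⊛-distribˡ L (g ⊛ M) (U ⊛ C)) ⟩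
      (c ⊛ M ⊛ (a ⊛ U) ⊕ c ⊛ M ⊛ (b ⊛ L)) ⊕ (L ⊛ (g ⊛ M) ⊕ L ⊛ (U ⊛ C))
        ≋⟨ solveₚ 4 (λ p q r s → (p :⊕ q) :⊕ (r :⊕ s) ⊜ (q :⊕ r) :⊕ (p :⊕ s)) ≋-refl
             (c ⊛ M ⊛ (a ⊛ U)) (c ⊛ M ⊛ (b ⊛ L)) (L ⊛ (g ⊛ M)) (L ⊛ (U ⊛ C)) ⟩
      (c ⊛ M ⊛ (b ⊛ L) ⊕ L ⊛ (g ⊛ M)) ⊕ (c ⊛ M ⊛ (a ⊛ U) ⊕ L ⊛ (U ⊛ C))
        ≋⟨ ⊕-cong
             (solveₚ 5 (λ c M b L g → c :⊛ M :⊛ (b :⊛ L) :⊕ L :⊛ (g :⊛ M) ⊜ (c :⊛ b :⊕ g) :⊛ (L :⊛ M)) ≋-refl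
               c M b L g)
             (≋-trans (⊕-cong (solveₚ 4 (λ c M a U → c :⊛ M :⊛ (a :⊛ U) ⊜ U :⊛ (c :⊛ a :⊛ M)) ≋-refl c M a U)
                              (solveₚ 3 (λ L U C → L :⊛ (U :⊛ C) ⊜ U :⊛ (L :⊛ C)) ≋-refl L U C))
               (≋-sym (⊛-distribˡ U (c ⊛ a ⊛ M) (L ⊛ C)))) ⟩
      (c ⊛ b ⊕ g) ⊛ (L ⊛ M) ⊕ U ⊛ (c ⊛ a ⊛ M ⊕ L ⊛ C) ∎ₚ

  -- x − w is the convex combination of x − u₀ and x − uⱼ with weights (uⱼ − w)/(uⱼ − u₀)
  -- and (w − u₀)/(uⱼ − u₀), so multiplying by x − w turns each term of the combination
  -- into two terms with nonnegative coefficients.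
  multiply-combination : ∀ {r} (u₀ w : Carrier) (γ u : Vector Carrier r) → NonNeg (w - u₀) →
    (∀ j → PosUnit (u j - u₀)) → (∀ j → NonNeg (u j - w)) → (∀ j → NonNeg (γ j)) →
    ∃[ γ₀ ] Σ[ γ′ ∈ Vector Carrier r ] (NonNeg γ₀ × (∀ j → NonNeg (γ′ j)) ×
      (x- w) ⊛ combination γ u ≋ scale γ₀ (linears u) ⊕ (x- u₀) ⊛ combination γ′ u)
  multiply-combination {zero} u₀ w γ u _ _ _ _ = 0# , γ , nonNeg-0 , (λ ()) ,
    ≋-trans (⊛-zeroʳ (x- w)) (≋-sym (⊕-cong (scale-0 (1# ∷ []) refl) (⊛-zeroʳ (x- u₀))))
  multiply-combination {suc r} u₀ w γ u u₀≤w apart w≤u 0≤γ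
    with multiply-combination u₀ w (tail γ) (tail u) u₀≤w (λ j → apart (suc j)) (λ j → w≤u (suc j))
        (λ j → 0≤γ (suc j)) | apart zero
  ... | γ₀ , γ′ , 0≤γ₀ , 0≤γ′ , eq | _ , s , 0≤s , s*≈1 =
    head γ * β + γ₀ , (head γ * α) Vector.∷ γ′ ,
    nonNeg-+ (nonNeg-* (0≤γ zero) (nonNeg-* 0≤s u₀≤w)) 0≤γ₀ ,
    (λ { zero → nonNeg-* (0≤γ zero) (nonNeg-* 0≤s (w≤u zero)) ; (suc j) → 0≤γ′ j }) ,
    ((x- w) ⊛ (scale (head γ) M ⊕ L ⊛ C)
       ≋⟨ ⊛-congˡ (x- w) (⊕-cong (scale≋constant⊛ (head γ) M) (≋-refl {L ⊛ C})) ⟩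
     (x- w) ⊛ (constant (head γ) ⊛ M ⊕ L ⊛ C)
       ≋⟨ solveₚ 5 (λ W c M L C → W :⊛ (c :⊛ M :⊕ L :⊛ C) ⊜ c :⊛ M :⊛ W :⊕ L :⊛ (W :⊛ C)) ≋-refl (x- w)
           (constant (head γ)) M L C ⟩
     constant (head γ) ⊛ M ⊛ (x- w) ⊕ L ⊛ ((x- w) ⊛ C)
       ≋⟨ ⊕-cong (⊛-congˡ (constant (head γ) ⊛ M) convex)
           (⊛-congˡ L (≋-trans eq (⊕-cong (scale≋constant⊛ γ₀ M) (≋-refl {(x- u₀) ⊛ C′})))) ⟩
     constant (head γ) ⊛ M ⊛ (constant α ⊛ (x- u₀) ⊕ constant β ⊛ L) ⊕ L ⊛ (constant γ₀ ⊛ M ⊕ (x- u₀) ⊛ C′)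
       ≋⟨ regroup (constant (head γ)) M (constant α) (constant β) (x- u₀) L (constant γ₀) C′ ⟩
     (constant (head γ) ⊛ constant β ⊕ constant γ₀) ⊛ (L ⊛ M) ⊕ (x- u₀) ⊛
         (constant (head γ) ⊛ constant α ⊛ M ⊕ L ⊛ C′)
       ≋⟨ ⊕-cong (≋-trans (scale≋constant⊛ _ (L ⊛ M))
           (⊛-congʳ (L ⊛ M) (⊕-cong (constant-* (head γ) β) (≋-refl {constant γ₀}))))
            (⊛-congˡ (x- u₀) (⊕-cong (≋-trans (scale≋constant⊛ _ M) (⊛-congʳ M (constant-* (head γ) α)))
                (≋-refl {L ⊛ C′}))) ⟨
     scale (head γ * β + γ₀) (L ⊛ M) ⊕ (x- u₀) ⊛ (scale (head γ * α) M ⊕ L ⊛ C′) ∎ₚ)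
    where
    M = linears (tail u)
    L = x- head u
    C = combination (tail γ) (tail u)
    C′ = combination γ′ (tail u)
    α = s * (head u - w)
    β = s * (w - u₀)
    α+β≈1 : α + β ≈ 1#
    α+β≈1 = trans (solve 4 (λ s u w z → s :* (u :- w) :+ s :* (w :- z) := s :* (u :- z)) refl s (head u) w u₀)
        s*≈1
    convex-constant : - w ≈ α * (- u₀) + β * (- head u)
    convex-constant = trans
      (sym (trans (*-congʳ s*≈1) (*-identityˡ (- w))))
      (solve 4 (λ s u w z → s :* (u :- z) :* (:- w) := s :* (u :- w) :* (:- z) :+ s :* (w :- z) :* (:- u))
        refl s (head u) w u₀)
    convex : (x- w) ≋ constant α ⊛ (x- u₀) ⊕ constant β ⊛ L
    convex = ≋-trans
      (∷-cong convex-constant (∷-cong (trans (sym α+β≈1) (sym (+-cong (*-identityʳ α) (*-identityʳ β))))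
          ≋-refl))
      (⊕-cong (scale≋constant⊛ α (x- u₀)) (scale≋constant⊛ β L))

  interlacing-combination : ∀ {n r} {v : Vector Carrier (suc n)} {u : Vector Carrier (suc r)}
      (g : Grouped PosUnit v u)
    (w : Vector Carrier n) → (∀ i → NonNeg (w i - v (inject₁ i)) × NonNeg (v (suc i) - w i)) →
    Σ[ γ ∈ Vector Carrier (suc r) ] ((∀ j → NonNeg (γ j)) × linears w ≋ combination γ u ⊛ cofactor g)
  -- Here w is empty and `linears w` is 1, which is also the Lagrange combination on one node with
  -- weight 1.
  interlacing-combination {u = u} (single _) w _ = (λ _ → 1#) , (λ _ → nonNeg-1) ,
    ≋-sym (≋-trans (⊛-comm _ (1# ∷ [])) (≋-trans (⊛-identityˡ _)
      (⊕-cong (scale-1 (1# ∷ [])) (⊛-zeroʳ (x- head u)))))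
  interlacing-combination {v = v} {u} (repeat e g) w inter
    with interlacing-combination g (tail w) (λ i → inter (suc i))
  ... | γ , 0≤γ , eq = γ , 0≤γ , ≋-trans (⊛-cong (x-cong w≈u) eq)
      (solveₚ 3 (λ L C G → L :⊛ (C :⊛ G) ⊜ C :⊛ (L :⊛ G)) ≋-refl (x- head u) (combination γ u) (cofactor g))
    where
    w-u≈0 : head w - head u ≈ 0#
    w-u≈0 = nonNeg-antisym (nonNeg-resp (+-congˡ (-‿cong e)) (proj₁ (inter zero)))
      (nonNeg-resp (trans (+-congʳ (Grouped-head g))
          (solve 2 (λ u w → u :- w := :- (w :- u)) refl (head u) (head w))) (proj₂ (inter zero)))
    w≈u : head w ≈ head u
    w≈u = trans (solve 2 (λ w u → w := w :- u :+ u) refl (head w) (head u))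
        (trans (+-congʳ w-u≈0) (+-identityˡ _))
  interlacing-combination {v = v} {u} (fresh e apart g) w inter = extend
      (interlacing-combination g (tail w) (λ i → inter (suc i)))
    where
    -- Interlacing bounds w₀ only by v₁ = u₁; for the later uⱼ the nonnegative gap uⱼ - u₁ is added.
    w≤u₁ : NonNeg (head (tail u) - head w)
    w≤u₁ = nonNeg-resp (+-congʳ (Grouped-head g)) (proj₂ (inter zero))
    w≤u : ∀ j → NonNeg (tail u j - head w)
    w≤u zero    = w≤u₁
    w≤u (suc j) = nonNeg-resp
      (solve 3 (λ a b c → (a :- b) :+ (b :- c) := a :- c) refl (tail u (suc j)) (tail u zero) (head w))
      (nonNeg-+ (proj₁ (Grouped-apart g zero (suc j) (s≤s z≤n))) w≤u₁)
    extend : Σ[ γ ∈ Vector Carrier _ ]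
        ((∀ j → NonNeg (γ j)) × linears (tail w) ≋ combination γ (tail u) ⊛ cofactor g) →
      Σ[ γ ∈ Vector Carrier _ ] ((∀ j → NonNeg (γ j)) × linears w ≋ combination γ u ⊛ cofactor g)
    extend (γ , 0≤γ , eq) = combine (multiply-combination (head u) (head w) γ (tail u)
        (nonNeg-resp (+-congˡ (-‿cong e)) (proj₁ (inter zero))) apart w≤u 0≤γ)
      where
      combine : ∃[ γ₀ ] Σ[ γ′ ∈ Vector Carrier _ ] (NonNeg γ₀ × (∀ j → NonNeg (γ′ j)) ×
          (x- head w) ⊛ combination γ (tail u) ≋ scale γ₀ (linears (tail u)) ⊕ (x- head u) ⊛ combination γ′
              (tail u)) →
        Σ[ γ ∈ Vector Carrier _ ] ((∀ j → NonNeg (γ j)) × linears w ≋ combination γ u ⊛ cofactor g)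
      combine (γ₀ , γ′ , 0≤γ₀ , 0≤γ′ , eq′) = γ₀ Vector.∷ γ′ , (λ { zero → 0≤γ₀ ; (suc j) → 0≤γ′ j }) ,
        ≋-trans (⊛-congˡ (x- head w) eq)
            (≋-trans (≋-sym (⊛-assoc (x- head w) (combination γ (tail u)) (cofactor g)))
          (⊛-congʳ (cofactor g) eq′))

-- Linear inequalities between rationals.

module RationalOrder where
  open import Data.Rational.Solver using (module +-*-Solver)
  open +-*-Solver public using (solve; _:=_; _:+_; _:*_; _:-_; :-_; con)

  -- Reduces linear arithmetic to ring identities: the hypotheses are added up to a < b, and it
  -- remains to check that the two differences agree.
  <-resp-difference : ∀ {a b p q} → a ℚ.< b → b ℚ.- a ≡ q ℚ.- p → p ℚ.< q
  <-resp-difference {a} {b} {p} {q} a<b e = ≡.subst₂ ℚ._<_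
    (solve 2 (λ a p → a :+ (p :- a) := p) ≡.refl a p)
    (≡.trans (solve 3 (λ a b p → b :+ (p :- a) := (b :- a) :+ p) ≡.refl a b p)
      (≡.trans (≡.cong (ℚ._+ p) e) (solve 2 (λ p q → q :- p :+ p := q) ≡.refl p q)))
    (ℚₚ.+-monoˡ-< (p ℚ.- a) a<b)

  <-contradiction : ∀ {a b} → a ℚ.< b → b ℚ.- a ≡ 0ℚ → ⊥
  <-contradiction a<b e = ℚₚ.<-irrefl ≡.refl (<-resp-difference {p = 0ℚ} {q = 0ℚ} a<b e)

  p≤∣p∣ : ∀ p → p ℚ.≤ ℚ.∣ p ∣
  p≤∣p∣ p with ℚₚ.∣p∣≡p∨∣p∣≡-p p | ℚₚ.≤-total 0ℚ p
  ... | _ | inj₁ 0≤p = ℚₚ.≤-reflexive (≡.sym (ℚₚ.0≤p⇒∣p∣≡p 0≤p))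
  ... | _ | inj₂ p≤0 = ℚₚ.≤-trans p≤0 (ℚₚ.0≤∣p∣ p)

  ∣p∣<⇒p< : ∀ {p q} → ℚ.∣ p ∣ ℚ.< q → p ℚ.< q
  ∣p∣<⇒p< {p} = ℚₚ.≤-<-trans (p≤∣p∣ p)

  ∣p∣<⇒-p< : ∀ {p q} → ℚ.∣ p ∣ ℚ.< q → ℚ.- p ℚ.< q
  ∣p∣<⇒-p< {p} {q} l = ∣p∣<⇒p< (≡.subst (ℚ._< q) (≡.sym (ℚₚ.∣-p∣≡∣p∣ p)) l)

  ∣p∣<⇒-q<p : ∀ {p q} → ℚ.∣ p ∣ ℚ.< q → ℚ.- q ℚ.< p
  ∣p∣<⇒-q<p {p} {q} l = <-resp-difference (∣p∣<⇒-p< l) (solve 2 (λ p q → q :- (:- p) := p :- (:- q)) ≡.refl p q)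

  ∣∣< : ∀ {p q} → ℚ.- q ℚ.< p → p ℚ.< q → ℚ.∣ p ∣ ℚ.< q
  ∣∣< {p} {q} -q<p p<q with ℚₚ.∣p∣≡p∨∣p∣≡-p p
  ... | inj₁ e = ≡.subst (ℚ._< q) (≡.sym e) p<q
  ... | inj₂ e = ≡.subst (ℚ._< q) (≡.sym e)
    (<-resp-difference -q<p (solve 2 (λ p q → p :- (:- q) := q :- (:- p)) ≡.refl p q))

  ∣p-q∣≡∣q-p∣ : ∀ p q → ℚ.∣ p ℚ.- q ∣ ≡ ℚ.∣ q ℚ.- p ∣
  ∣p-q∣≡∣q-p∣ p q = ≡.trans (≡.sym (ℚₚ.∣-p∣≡∣p∣ (p ℚ.- q)))
    (≡.cong ℚ.∣_∣ (solve 2 (λ p q → :- (p :- q) := q :- p) ≡.refl p q))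

-- The Cauchy reals as a ring with an order.

module RealField where
  open RationalOrder
  open CauchyBounds using (halve; 0<½*; bounded; product-bound; product-close; diff-+; diff-neg)

  Eventually : (ℕ → Set) → Set
  Eventually P = ∃[ N ] (∀ n → N ℕ.≤ n → P n)

  eventually : ∀ {P} → (∀ n → P n) → Eventually P
  eventually f = 0 , λ n _ → f n

  zipₑ : ∀ {P Q R} → (∀ n → P n → Q n → R n) → Eventually P → Eventually Q → Eventually R
  zipₑ f (M , p) (N , q) = M ℕ.⊔ N , λ n ≤n →
    f n (p n (ℕₚ.m⊔n≤o⇒m≤o M N ≤n)) (q n (ℕₚ.m⊔n≤o⇒n≤o M N ≤n))

  mapₑ : ∀ {P Q} → (∀ n → P n → Q n) → Eventually P → Eventually Q
  mapₑ f (N , p) = N , λ n ≤n → f n (p n ≤n)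

  never : ∀ {P} → Eventually P → (∀ n → ¬ P n) → ⊥
  never (N , p) f = f N (p N ℕₚ.≤-refl)

  open _≃_ public
  open _<ᵣ_ public

  ≃-pointwise : ∀ {x y} → (∀ n → seq x n ≡ seq y n) → x ≃ y
  ≃-pointwise {x} {y} e = mk≃ λ ε 0<ε → eventually λ n →
    ≡.subst (λ t → ℚ.∣ t ∣ ℚ.< ε) (≡.sym (≡.trans (≡.cong (ℚ._- seq y n) (e n)) (ℚₚ.+-inverseʳ (seq y n)))) 0<ε

  ≃-refl : ∀ {x} → x ≃ x
  ≃-refl = ≃-pointwise λ _ → ≡.refl

  ≃-sym : ∀ {x y} → x ≃ y → y ≃ x
  ≃-sym {x} {y} e = mk≃ λ ε 0<ε → mapₑ (λ n → ≡.subst (ℚ._< ε) (∣p-q∣≡∣q-p∣ (seq x n) (seq y n)))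
      (close e ε 0<ε)

  private
    ∣+∣< : ∀ {ε} a b {c} → a ℚ.+ b ≡ c → ℚ.∣ a ∣ ℚ.< ½ ℚ.* ε → ℚ.∣ b ∣ ℚ.< ½ ℚ.* ε → ℚ.∣ c ∣ ℚ.< ε
    ∣+∣< {ε} a b ≡.refl la lb = ≡.subst (ℚ.∣ a ℚ.+ b ∣ ℚ.<_) (halve ε)
      (ℚₚ.≤-<-trans (ℚₚ.∣p+q∣≤∣p∣+∣q∣ a b) (ℚₚ.+-mono-< la lb))

  ≃-trans : ∀ {x y z} → x ≃ y → y ≃ z → x ≃ z
  ≃-trans {x} {y} {z} e f = mk≃ λ ε 0<ε → zipₑ
    (λ n → ∣+∣< (seq x n ℚ.- seq y n) (seq y n ℚ.- seq z n)
      (solve 3 (λ a b c → (a :- b) :+ (b :- c) := a :- c) ≡.refl (seq x n) (seq y n) (seq z n)))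
    (close e (½ ℚ.* ε) (0<½* 0<ε)) (close f (½ ℚ.* ε) (0<½* 0<ε))

  +ᵣ-cong : ∀ {x x′ y y′} → x ≃ x′ → y ≃ y′ → x +ᵣ y ≃ x′ +ᵣ y′
  +ᵣ-cong {x} {x′} {y} {y′} e f = mk≃ λ ε 0<ε → zipₑ
    (λ n → ∣+∣< (seq x n ℚ.- seq x′ n) (seq y n ℚ.- seq y′ n)
        (diff-+ (seq x n) (seq y n) (seq x′ n) (seq y′ n)))
    (close e (½ ℚ.* ε) (0<½* 0<ε)) (close f (½ ℚ.* ε) (0<½* 0<ε))

  -ᵣ-cong : ∀ {x y} → x ≃ y → -ᵣ x ≃ -ᵣ y
  -ᵣ-cong {x} {y} e = mk≃ λ ε 0<ε →
    mapₑ (λ n → ≡.subst (λ t → ℚ.∣ t ∣ ℚ.< ε) (diff-neg (seq x n) (seq y n))) (close (≃-sym e) ε 0<ε)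

  *ᵣ-cong : ∀ {x x′ y y′} → x ≃ x′ → y ≃ y′ → x *ᵣ y ≃ x′ *ᵣ y′
  *ᵣ-cong {x} {x′} {y} {y′} e f = mk≃ λ ε 0<ε →
    let A , 0<A , xb = bounded (seq x) (cauchy x)
        B , 0<B , yb = bounded (seq y′) (cauchy y′)
        δ₁ , δ₂ , 0<δ₁ , 0<δ₂ , h = product-close A B ε 0<A 0<B 0<ε
    in zipₑ (λ n (a , d) (b-d , a-c) → h (seq x n) (seq y n) (seq x′ n) (seq y′ n) a d b-d a-c)
         (zipₑ (λ _ → _,_) xb yb) (zipₑ (λ _ → _,_) (close f δ₁ 0<δ₁) (close e δ₂ 0<δ₂))

  realRing : CommutativeRing 0ℓ 0ℓ
  realRing = record
    { Carrier = ℝ ; _≈_ = _≃_ ; _+_ = _+ᵣ_ ; _*_ = _*ᵣ_ ; -_ = -ᵣ_ ; 0# = 0ᵣ ; 1# = 1ᵣ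
    ; isCommutativeRing = record
      { isRing = record
        { +-isAbelianGroup = record
          { isGroup = record
            { isMonoid = record
              { isSemigroup = record
                { isMagma = record
                  { isEquivalence = record { refl = ≃-refl ; sym = ≃-sym ; trans = ≃-trans }
                  ; ∙-cong = +ᵣ-cong }
                ; assoc = λ x y z → ≃-pointwise λ n → ℚₚ.+-assoc (seq x n) (seq y n) (seq z n) }
              ; identity = (λ x → ≃-pointwise λ n → ℚₚ.+-identityˡ (seq x n)) , λ x → ≃-pointwise λ n →
                  ℚₚ.+-identityʳ (seq x n) }
            ; inverse = (λ x → ≃-pointwise λ n → ℚₚ.+-inverseˡ (seq x n)) , λ x → ≃-pointwise λ n →
                ℚₚ.+-inverseʳ (seq x n)
            ; ⁻¹-cong = -ᵣ-cong }
          ; comm = λ x y → ≃-pointwise λ n → ℚₚ.+-comm (seq x n) (seq y n) }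
        ; *-cong = *ᵣ-cong
        ; *-assoc = λ x y z → ≃-pointwise λ n → ℚₚ.*-assoc (seq x n) (seq y n) (seq z n)
        ; *-identity = (λ x → ≃-pointwise λ n → ℚₚ.*-identityˡ (seq x n)) , λ x → ≃-pointwise λ n →
            ℚₚ.*-identityʳ (seq x n)
        ; distrib = (λ x y z → ≃-pointwise λ n → ℚₚ.*-distribˡ-+ (seq x n) (seq y n) (seq z n))
                  , λ x y z → ≃-pointwise λ n → ℚₚ.*-distribʳ-+ (seq x n) (seq y n) (seq z n) }
      ; *-comm = λ x y → ≃-pointwise λ n → ℚₚ.*-comm (seq x n) (seq y n) } }

  NonNeg : ℝ → Set
  NonNeg x = 0ᵣ ≤ᵣ x

  -- `NonNeg` is a negation and gives no direct hold on the terms of the sequence; this is its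
  -- positive equivalent, with which ε-arguments can be made.
  AlmostNonNeg : ℝ → Set
  AlmostNonNeg x = ∀ ε → 0ℚ ℚ.< ε → Eventually λ n → ℚ.- ε ℚ.< seq x n

  AlmostNonNeg⇒NonNeg : ∀ {x} → AlmostNonNeg x → NonNeg x
  AlmostNonNeg⇒NonNeg {x} h (mk< (ε , 0<ε , s)) = never (zipₑ (λ _ → _,_) (h ε 0<ε) s) λ n (a , b) →
    <-contradiction (ℚₚ.+-mono-< a b)
      (solve 2 (λ ε x → (x :+ con 0ℚ) :- ((:- ε) :+ (x :+ ε)) := con 0ℚ) ≡.refl ε (seq x n))

  -- A single term, within ε/4 of all later ones, is compared with -ε/2. If it lies below, all later
  -- terms stay below -ε/4 and x < 0; otherwise all later terms exceed -ε/2 - ε/4 > -ε.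
  NonNeg⇒AlmostNonNeg : ∀ {x} → NonNeg x → AlmostNonNeg x
  NonNeg⇒AlmostNonNeg {x} 0≤x ε 0<ε with cauchy x (½ ℚ.* (½ ℚ.* ε)) (0<½* (0<½* 0<ε))
  ... | N , h with seq x N ℚₚ.<? ℚ.- (½ ℚ.* ε)
  ... | yes x<-½ε = ⊥-elim (0≤x (mk< (k , 0<½* (0<½* 0<ε) , N , λ n N≤n →
          <-resp-difference (ℚₚ.+-mono-< x<-½ε (∣p∣<⇒p< (h n N N≤n ℕₚ.≤-refl)))
            (≡.trans (≡.cong (λ t → ((ℚ.- t) ℚ.+ k) ℚ.- (seq x N ℚ.+ (seq x n ℚ.- seq x N)))
                (≡.sym (halve (½ ℚ.* ε))))
              (solve 3 (λ k a b → (:- (k :+ k) :+ k) :- (a :+ (b :- a)) := con 0ℚ :- (b :+ k)) ≡.refl k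
                (seq x N) (seq x n))))))
    where k = ½ ℚ.* (½ ℚ.* ε)
  ... | no x≮-½ε = N , λ n N≤n → <-resp-difference
          (ℚₚ.+-mono-≤-< (ℚₚ.≮⇒≥ x≮-½ε) (ℚₚ.<-trans (∣p∣<⇒p< (h N n ℕₚ.≤-refl N≤n)) k<½ε))
          (≡.trans (solve 3 (λ t a b → (a :+ t) :- ((:- t) :+ (a :- b)) := b :+ (t :+ t)) ≡.refl (½ ℚ.* ε)
              (seq x N) (seq x n))
            (≡.trans (≡.cong (seq x n ℚ.+_) (halve ε))
                (solve 2 (λ b e → b :+ e := b :- (:- e)) ≡.refl (seq x n) ε)))
    where
    k<½ε : ½ ℚ.* (½ ℚ.* ε) ℚ.< ½ ℚ.* ε
    k<½ε = <-resp-difference (0<½* (0<½* 0<ε))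
      (≡.trans (solve 1 (λ k → k :- con 0ℚ := (k :+ k) :- k) ≡.refl k) (≡.cong (ℚ._- k) (halve (½ ℚ.* ε))))
      where k = ½ ℚ.* (½ ℚ.* ε)

  NonNeg-resp : ∀ {x y} → x ≃ y → NonNeg x → NonNeg y
  NonNeg-resp {x} {y} e 0≤x = AlmostNonNeg⇒NonNeg λ ε 0<ε → zipₑ
    (λ n a b → <-resp-difference (ℚₚ.+-mono-< a (∣p∣<⇒p< b))
      (≡.trans (solve 3 (λ t x y → (x :+ t) :- ((:- t) :+ (x :- y)) := y :+ (t :+ t)) ≡.refl (½ ℚ.* ε)
          (seq x n) (seq y n))
        (≡.trans (≡.cong (seq y n ℚ.+_) (halve ε))
            (solve 2 (λ y e → y :+ e := y :- (:- e)) ≡.refl (seq y n) ε))))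
    (NonNeg⇒AlmostNonNeg 0≤x (½ ℚ.* ε) (0<½* 0<ε)) (close e (½ ℚ.* ε) (0<½* 0<ε))

  NonNeg-+ : ∀ {x y} → NonNeg x → NonNeg y → NonNeg (x +ᵣ y)
  NonNeg-+ {x} {y} 0≤x 0≤y = AlmostNonNeg⇒NonNeg λ ε 0<ε → zipₑ
    (λ n a b → ≡.subst (ℚ._< seq x n ℚ.+ seq y n)
      (≡.trans (≡.sym (ℚₚ.neg-distrib-+ (½ ℚ.* ε) (½ ℚ.* ε))) (≡.cong ℚ.-_ (halve ε))) (ℚₚ.+-mono-< a b))
    (NonNeg⇒AlmostNonNeg 0≤x (½ ℚ.* ε) (0<½* 0<ε)) (NonNeg⇒AlmostNonNeg 0≤y (½ ℚ.* ε) (0<½* 0<ε))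

  private
    -ε<0 : ∀ {ε} → 0ℚ ℚ.< ε → ℚ.- ε ℚ.< 0ℚ
    -ε<0 0<ε = ℚₚ.neg-antimono-< 0<ε

    -- A negative b has absolute value below δ₁, which makes a b smaller than ε in absolute value; a
    -- negative a is treated alike with δ₂. If neither is negative, a b ≥ 0.
    product-almost : ∀ {ε} A B δ₁ δ₂ → 0ℚ ℚ.< ε →
      (∀ a b → ℚ.∣ a ∣ ℚ.< A → ℚ.∣ b ∣ ℚ.< δ₁ → ℚ.∣ a ℚ.* b ∣ ℚ.< ε) →
      (∀ b a → ℚ.∣ b ∣ ℚ.< B → ℚ.∣ a ∣ ℚ.< δ₂ → ℚ.∣ b ℚ.* a ∣ ℚ.< ε) →
      0ℚ ℚ.< δ₁ → 0ℚ ℚ.< δ₂ →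
      ∀ a b → ℚ.∣ a ∣ ℚ.< A → ℚ.∣ b ∣ ℚ.< B → ℚ.- δ₁ ℚ.< b → ℚ.- δ₂ ℚ.< a → ℚ.- ε ℚ.< a ℚ.* b
    product-almost {ε} A B δ₁ δ₂ 0<ε h₁ h₂ 0<δ₁ 0<δ₂ a b a<A b<B -δ₁<b -δ₂<a with b ℚₚ.<? 0ℚ | a ℚₚ.<? 0ℚ
    ... | yes b<0 | _       = ∣p∣<⇒-q<p (h₁ a b a<A (∣∣< -δ₁<b (ℚₚ.<-trans b<0 0<δ₁)))
    ... | no  _   | yes a<0 = ≡.subst (ℚ.- ε ℚ.<_) (ℚₚ.*-comm b a)
        (∣p∣<⇒-q<p (h₂ b a b<B (∣∣< -δ₂<a (ℚₚ.<-trans a<0 0<δ₂))))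
    ... | no b≮0  | no a≮0  = ℚₚ.<-≤-trans (-ε<0 0<ε) (ℚₚ.nonNegative⁻¹ (a ℚ.* b)
            {{ℚₚ.nonNeg*nonNeg⇒nonNeg a {{ℚ.nonNegative (ℚₚ.≮⇒≥ a≮0)}} b {{ℚ.nonNegative (ℚₚ.≮⇒≥ b≮0)}}}})

  NonNeg-* : ∀ {x y} → NonNeg x → NonNeg y → NonNeg (x *ᵣ y)
  NonNeg-* {x} {y} 0≤x 0≤y = AlmostNonNeg⇒NonNeg λ ε 0<ε →
    let A , 0<A , xb = bounded (seq x) (cauchy x)
        B , 0<B , yb = bounded (seq y) (cauchy y)
        δ₁ , 0<δ₁ , h₁ = product-bound A ε 0<A 0<ε
        δ₂ , 0<δ₂ , h₂ = product-bound B ε 0<B 0<ε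
    in zipₑ (λ n (a , b) (c , d) → product-almost A B δ₁ δ₂ 0<ε h₁ h₂ 0<δ₁ 0<δ₂ (seq x n) (seq y n) a b c d)
         (zipₑ (λ _ → _,_) xb yb)
         (zipₑ (λ _ → _,_) (NonNeg⇒AlmostNonNeg 0≤y δ₁ 0<δ₁) (NonNeg⇒AlmostNonNeg 0≤x δ₂ 0<δ₂))

  NonNeg-0 : NonNeg 0ᵣ
  NonNeg-0 = AlmostNonNeg⇒NonNeg λ ε 0<ε → eventually λ _ → -ε<0 0<ε

  NonNeg-1 : NonNeg 1ᵣ
  NonNeg-1 = AlmostNonNeg⇒NonNeg λ ε 0<ε → eventually λ _ → ℚₚ.<-trans (-ε<0 0<ε) (ℚₚ.positive⁻¹ 1ℚ)

  NonNeg-square : ∀ x → NonNeg (x *ᵣ x)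
  NonNeg-square x = AlmostNonNeg⇒NonNeg λ ε 0<ε → eventually λ n → ℚₚ.<-≤-trans (-ε<0 0<ε) (0≤p*p (seq x n))
    where
    0≤p*p : ∀ p → 0ℚ ℚ.≤ p ℚ.* p
    0≤p*p p with ℚₚ.≤-total 0ℚ p
    ... | inj₁ 0≤p = ℚₚ.nonNegative⁻¹ (p ℚ.* p)
        {{ℚₚ.nonNeg*nonNeg⇒nonNeg p {{ℚ.nonNegative 0≤p}} p {{ℚ.nonNegative 0≤p}}}}
    ... | inj₂ p≤0 = ≡.subst (0ℚ ℚ.≤_) (solve 1 (λ p → (:- p) :* (:- p) := p :* p) ≡.refl p)
      (ℚₚ.nonNegative⁻¹ (ℚ.- p ℚ.* ℚ.- p) {{ℚₚ.nonNeg*nonNeg⇒nonNeg (ℚ.- p) {{0≤-p}} (ℚ.- p) {{0≤-p}}}})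
      where
      0≤-p : ℚ.NonNegative (ℚ.- p)
      0≤-p = ℚ.nonNegative (ℚₚ.neg-antimono-≤ p≤0)

  NonNeg-antisym : ∀ {x} → NonNeg x → NonNeg (-ᵣ x) → x ≃ 0ᵣ
  NonNeg-antisym {x} 0≤x 0≤-x = mk≃ λ ε 0<ε → zipₑ
    (λ n a b → ≡.subst (λ t → ℚ.∣ t ∣ ℚ.< ε) (≡.sym (ℚₚ.+-identityʳ (seq x n)))
      (∣∣< a (<-resp-difference b (solve 2 (λ x e → :- x :- (:- e) := e :- x) ≡.refl (seq x n) ε))))
    (NonNeg⇒AlmostNonNeg 0≤x ε 0<ε) (NonNeg⇒AlmostNonNeg 0≤-x ε 0<ε)

  realNonnegativity : Nonnegativity realRing
  realNonnegativity = record
    { NonNeg = NonNeg ; nonNeg-resp = NonNeg-resp ; nonNeg-+ = NonNeg-+ ; nonNeg-* = NonNeg-*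
    ; nonNeg-0 = NonNeg-0 ; nonNeg-1 = NonNeg-1 ; nonNeg-antisym = NonNeg-antisym }

  open CommutativeRing realRing using (_-_)
  open Interlacing realRing realNonnegativity public using (PosUnit; interlacing-combination)

  ≤ᵣ⇒NonNeg : ∀ {x y} → x ≤ᵣ y → NonNeg (y - x)
  ≤ᵣ⇒NonNeg {x} {y} x≤y (mk< (ε , 0<ε , s)) = x≤y (mk< (ε , 0<ε , mapₑ (λ n l → <-resp-difference l
    (solve 3 (λ x y e → con 0ℚ :- ((y :- x) :+ e) := x :- (y :+ e)) ≡.refl (seq x n) (seq y n) ε)) s))

  x-y≃0⇒x≃y : ∀ {x y} → x - y ≃ 0ᵣ → x ≃ y
  x-y≃0⇒x≃y {x} {y} e = mk≃ λ ε 0<ε → mapₑ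
      (λ n → ≡.subst (λ t → ℚ.∣ t ∣ ℚ.< ε) (ℚₚ.+-identityʳ (seq x n ℚ.- seq y n))) (close e ε 0<ε)

  x≃y⇒x-y≃0 : ∀ {x y} → x ≃ y → x - y ≃ 0ᵣ
  x≃y⇒x-y≃0 {x} {y} e = mk≃ λ ε 0<ε → mapₑ
      (λ n → ≡.subst (λ t → ℚ.∣ t ∣ ℚ.< ε) (≡.sym (ℚₚ.+-identityʳ (seq x n ℚ.- seq y n)))) (close e ε 0<ε)

  -0≃0 : -ᵣ 0ᵣ ≃ 0ᵣ
  -0≃0 = ≃-pointwise λ _ → ≡.refl

  -- By antisymmetry x ≃ y reduces to 0 ≤ x - y and 0 ≤ -(x - y), and both are negations.
  ≃-stable : ∀ {x y} → ¬ ¬ (x ≃ y) → x ≃ y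
  ≃-stable {x} {y} h = x-y≃0⇒x≃y (NonNeg-antisym
    (λ l → h λ e → NonNeg-resp (≃-sym (x≃y⇒x-y≃0 e)) NonNeg-0 l)
    (λ l → h λ e → NonNeg-resp (≃-sym (≃-trans (-ᵣ-cong (x≃y⇒x-y≃0 e)) -0≃0)) NonNeg-0 l))

  1≄0 : ¬ (1ᵣ ≃ 0ᵣ)
  1≄0 e = never (close e ½ (ℚₚ.positive⁻¹ ½)) λ n l →
    ℚₚ.<-asym l (ℚₚ.<-≤-trans ½<1 (p≤∣p∣ (1ℚ ℚ.- 0ℚ)))
    where
    ½<1 : ½ ℚ.< 1ℚ ℚ.- 0ℚ
    ½<1 = <-resp-difference (ℚₚ.positive⁻¹ ½) ≡.refl

  private
    -- Eventually z is at distance at least δ from 0, so that |x z| < ε δ yields |x| < ε.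
    negative-factor : ∀ {x z} → x *ᵣ z ≃ 0ᵣ → z <ᵣ 0ᵣ → x ≃ 0ᵣ
    negative-factor {x} {z} e (mk< (δ , 0<δ , s)) = mk≃ λ ε 0<ε → zipₑ (λ n → small n 0<ε)
      s (close e (ε ℚ.* δ) (0<* 0<ε))
      where
      0<* : ∀ {ε} → 0ℚ ℚ.< ε → 0ℚ ℚ.< ε ℚ.* δ
      0<* {ε} 0<ε = ℚₚ.positive⁻¹ (ε ℚ.* δ) {{ℚₚ.pos*pos⇒pos ε {{ℚ.positive 0<ε}} δ {{ℚ.positive 0<δ}}}}
      small : ∀ n {ε} → 0ℚ ℚ.< ε → seq z n ℚ.+ δ ℚ.< 0ℚ → ℚ.∣ seq x n ℚ.* seq z n ℚ.- 0ℚ ∣ ℚ.< ε ℚ.* δ →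
        ℚ.∣ seq x n ℚ.- 0ℚ ∣ ℚ.< ε
      small n {ε} 0<ε z+δ<0 xz<εδ = ≡.subst (λ t → ℚ.∣ t ∣ ℚ.< ε) (≡.sym (ℚₚ.+-identityʳ (seq x n)))
        (ℚₚ.*-cancelʳ-<-nonNeg δ {{ℚ.nonNegative (ℚₚ.<⇒≤ 0<δ)}} (ℚₚ.≤-<-trans
          (ℚₚ.*-monoˡ-≤-nonNeg ℚ.∣ seq x n ∣ {{ℚₚ.∣-∣-nonNeg (seq x n)}} δ≤∣z∣)
          (≡.subst (ℚ._< ε ℚ.* δ) (≡.trans (≡.cong ℚ.∣_∣ (ℚₚ.+-identityʳ _))
              (ℚₚ.∣p*q∣≡∣p∣*∣q∣ (seq x n) (seq z n))) xz<εδ)))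
        where
        δ≤∣z∣ : δ ℚ.≤ ℚ.∣ seq z n ∣
        δ≤∣z∣ = ℚₚ.≤-trans (ℚₚ.<⇒≤ (<-resp-difference z+δ<0
            (solve 2 (λ z d → con 0ℚ :- (z :+ d) := :- z :- d) ≡.refl (seq z n) δ)))
          (≡.subst (ℚ.- seq z n ℚ.≤_) (ℚₚ.∣-p∣≡∣p∣ (seq z n)) (p≤∣p∣ (ℚ.- seq z n)))

  -- A real that is merely not 0 comes with no lower bound on its size, hence with no inverse.
  -- Regularity still holds: z < 0 and -z < 0 would each force x ≃ 0, so antisymmetry applies to z.
  nonzero⇒Regular : ∀ {x} → ¬ (x ≃ 0ᵣ) → RootVectors.Regular realRing x
  nonzero⇒Regular {x} x≄0 z e = NonNeg-antisym
    (λ z<0 → x≄0 (negative-factor e z<0))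
    (λ -z<0 → x≄0 (negative-factor (≃-trans x*-z≃-0 -0≃0) -z<0))
    where
    x*-z≃-0 : x *ᵣ -ᵣ z ≃ -ᵣ 0ᵣ
    x*-z≃-0 = ≃-trans (≃-pointwise λ n → ≡.sym (ℚₚ.neg-distribʳ-* (seq x n) (seq z n))) (-ᵣ-cong e)

  -- One term, within ¼ of all later ones, is compared with ½. Below ½ it excludes the limit 1,
  -- otherwise the limit 0; stability of equality turns the exclusion into the remaining
  -- alternative.
  decide-idempotent : ∀ {t} → ¬ ¬ (t ≃ 0ᵣ ⊎ t ≃ 1ᵣ) → t ≃ 0ᵣ ⊎ t ≃ 1ᵣ
  decide-idempotent {t} h with cauchy t ¼ (ℚₚ.positive⁻¹ ¼)
    where ¼ = ½ ℚ.* ½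
  ... | N , c with seq t N ℚₚ.<? ½
  ... | yes t<½ = inj₁ (≃-stable λ t≄0 → h [ t≄0 , t≄1 ]′)
    where
    t≄1 : ¬ (t ≃ 1ᵣ)
    t≄1 e = never (zipₑ (λ _ → _,_) (close (≃-sym e) (½ ℚ.* ½) (ℚₚ.positive⁻¹ (½ ℚ.* ½)))
        (N , λ n N≤n → c n N N≤n ℕₚ.≤-refl))
      λ n (a , b) → <-contradiction (ℚₚ.+-mono-< t<½ (ℚₚ.+-mono-< (∣p∣<⇒p< a) (∣p∣<⇒p< b)))
        (solve 2 (λ s t → (con ½ :+ (con (½ ℚ.* ½) :+ con (½ ℚ.* ½))) :- (s :+ ((con 1ℚ :- t) :+ (t :- s))) :=
          con 0ℚ) ≡.refl (seq t N) (seq t n))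
  ... | no  t≮½ = inj₂ (≃-stable λ t≄1 → h [ t≄0 , t≄1 ]′)
    where
    t≄0 : ¬ (t ≃ 0ᵣ)
    t≄0 e = never (zipₑ (λ _ → _,_) (close e (½ ℚ.* ½) (ℚₚ.positive⁻¹ (½ ℚ.* ½)))
        (N , λ n N≤n → c N n ℕₚ.≤-refl N≤n))
      λ n (a , b) → <-contradiction (ℚₚ.+-mono-≤-< (ℚₚ.≮⇒≥ t≮½) (ℚₚ.+-mono-< (∣p∣<⇒p< a) (∣p∣<⇒p< b)))
        (solve 2 (λ s t → (s :+ (con (½ ℚ.* ½) :+ con (½ ℚ.* ½))) :- (con ½ :+ ((t :- con 0ℚ) :+ (s :- t))) :=
          con 0ℚ) ≡.refl (seq t N) (seq t n))

  -- The inverse is nonnegative because s = s² a.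
  inverse⇒PosUnit : ∀ {a s} → NonNeg a → s *ᵣ a ≃ 1ᵣ → PosUnit a
  inverse⇒PosUnit {a} {s} 0≤a sa≃1 = 0≤a , s , NonNeg-resp s²a≃s (NonNeg-* (NonNeg-square s) 0≤a) , sa≃1
    where
    open CommutativeRing realRing using (*-assoc; *-congˡ; *-identityʳ)
    s²a≃s : s *ᵣ s *ᵣ a ≃ s
    s²a≃s = ≃-trans (*-assoc s s a) (≃-trans (*-congˡ sa≃1) (*-identityʳ s))

  -- With |s| < B, the number δ is such that a gap smaller than δ would give |s a| < ½,
  -- contradicting |s a - 1| < ½. So the gap is eventually at least δ, and the separation ½ δ leaves
  -- room for the strict inequality.
  PosUnit⇒< : ∀ {x y} → PosUnit (y - x) → x <ᵣ y
  PosUnit⇒< {x} {y} (0≤y-x , s , _ , e) =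
    let B , 0<B , sb = bounded (seq s) (cauchy s)
        δ , 0<δ , h = product-bound B ½ 0<B (ℚₚ.positive⁻¹ ½)
    in mk< (½ ℚ.* δ , 0<½* 0<δ , zipₑ (λ n (a , b) c → bound n 0<δ h a b c)
         (zipₑ (λ _ → _,_) sb (close e ½ (ℚₚ.positive⁻¹ ½))) (NonNeg⇒AlmostNonNeg 0≤y-x δ 0<δ))
    where
    bound : ∀ n {B δ} → 0ℚ ℚ.< δ → (∀ a b → ℚ.∣ a ∣ ℚ.< B → ℚ.∣ b ∣ ℚ.< δ → ℚ.∣ a ℚ.* b ∣ ℚ.< ½) →
      ℚ.∣ seq s n ∣ ℚ.< B → ℚ.∣ seq s n ℚ.* (seq y n ℚ.- seq x n) ℚ.- 1ℚ ∣ ℚ.< ½ →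
      ℚ.- δ ℚ.< seq y n ℚ.- seq x n → seq x n ℚ.+ ½ ℚ.* δ ℚ.< seq y n
    bound n {B} {δ} 0<δ h s<B sa≈1 -δ<a with (seq y n ℚ.- seq x n) ℚₚ.<? δ
    ... | yes a<δ = ⊥-elim (<-contradiction
            (ℚₚ.+-mono-< (∣p∣<⇒p< (h (seq s n) (seq y n ℚ.- seq x n) s<B (∣∣< -δ<a a<δ))) (∣p∣<⇒-p< sa≈1))
            (solve 1 (λ t → (con ½ :+ con ½) :- (t :+ :- (t :- con 1ℚ)) := con 0ℚ) ≡.refl
              (seq s n ℚ.* (seq y n ℚ.- seq x n))))
    ... | no a≮δ = <-resp-difference (ℚₚ.+-mono-≤-< (ℚₚ.≮⇒≥ a≮δ) (0<½* 0<δ))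
            (≡.trans (≡.cong (λ t → (seq y n ℚ.- seq x n) ℚ.+ ½ ℚ.* δ ℚ.- (t ℚ.+ 0ℚ)) (≡.sym (halve δ)))
              (solve 3 (λ x y h → (y :- x) :+ h :- ((h :+ h) :+ con 0ℚ) := y :- (x :+ h)) ≡.refl (seq x n)
                (seq y n) (½ ℚ.* δ)))

-- Coefficientwise images of polynomials under a ring homomorphism.

module PolynomialMap {a b ℓ₁ ℓ₂} (A : CommutativeRing a ℓ₁) (B : CommutativeRing b ℓ₂)
  (φ : CommutativeRing.Carrier A → CommutativeRing.Carrier B)
  (φ-hom : RingMorphisms.IsRingHomomorphism (CommutativeRing.rawRing A) (CommutativeRing.rawRing B) φ) where
  private
    module A where
      open PolynomialRing A public
      open PolynomialDegree A public
      open CommutativeRing A public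
    module B where
      open PolynomialRing B public
      open PolynomialDegree B public
      open CommutativeRing B public
  open RingMorphisms.IsRingHomomorphism φ-hom

  mapₚ : A.Poly → B.Poly
  mapₚ = List.map φ

  coeff-map : ∀ p k → mapₚ p B.[x^ k ] B.≈ φ (p A.[x^ k ])
  coeff-map []      k       = B.sym 0#-homo
  coeff-map (a ∷ p) zero    = B.refl
  coeff-map (a ∷ p) (suc k) = coeff-map p k

  map-cong : ∀ {p q} → p A.≋ q → mapₚ p B.≋ mapₚ q
  map-cong {p} {q} e = B.mk≋ λ k → B.trans (coeff-map p k)
      (B.trans (⟦⟧-cong (A.coeff≈ e k)) (B.sym (coeff-map q k)))

  map-⊕ : ∀ p q → mapₚ (p A.⊕ q) B.≋ mapₚ p B.⊕ mapₚ q
  map-⊕ []      q       = B.≋-refl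
  map-⊕ (a ∷ p) []      = B.≋-refl
  map-⊕ (a ∷ p) (b ∷ q) = B.∷-cong (+-homo a b) (map-⊕ p q)

  map-scale : ∀ a p → mapₚ (A.scale a p) B.≋ B.scale (φ a) (mapₚ p)
  map-scale a []      = B.≋-refl
  map-scale a (b ∷ p) = B.∷-cong (*-homo a b) (map-scale a p)

  map-⊛ : ∀ p q → mapₚ (p A.⊛ q) B.≋ mapₚ p B.⊛ mapₚ q
  map-⊛ []      q = B.≋-refl
  map-⊛ (a ∷ p) q = B.≋-trans (map-⊕ (A.scale a q) (A.0# ∷ p A.⊛ q))
    (B.⊕-cong (map-scale a q) (B.∷-cong 0#-homo (map-⊛ p q)))

  map-deriv : ∀ p → mapₚ (A.deriv p) B.≋ B.deriv (mapₚ p)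
  map-deriv []      = B.≋-refl
  map-deriv (a ∷ p) = B.≋-trans (map-⊕ p (A.0# ∷ A.deriv p))
    (B.⊕-cong (B.≋-refl {mapₚ p}) (B.∷-cong 0#-homo (map-deriv p)))

  map-shift : ∀ p → mapₚ (A.shift p) B.≋ B.shift (mapₚ p)
  map-shift []      = B.≋-refl
  map-shift (a ∷ p) = B.≋-trans (map-⊕ (a ∷ []) (A.x- A.1# A.⊛ A.shift p))
    (B.⊕-cong (B.≋-refl {φ a ∷ []})
        (B.≋-trans (map-⊛ (A.x- A.1#) (A.shift p)) (B.⊛-cong x-1-homo (map-shift p))))
    where
    x-1-homo : mapₚ (A.x- A.1#) B.≋ (B.x- B.1#)
    x-1-homo = B.∷-cong (B.trans (-‿homo A.1#) (B.-‿cong 1#-homo)) (B.∷-cong 1#-homo B.≋-refl)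

  Below-map : ∀ {p d} → A.Below p d → B.Below (mapₚ p) d
  Below-map {p} b = B.mkBelow λ k d≤k → B.trans (coeff-map p k) (B.trans (⟦⟧-cong (A.vanishes b k d≤k)) 0#-homo)

  MonicOf-map : ∀ {p d} → A.MonicOf p d → B.MonicOf (mapₚ p) d
  MonicOf-map {p} {d} m = B.monicOf
    (B.trans (coeff-map p d) (B.trans (⟦⟧-cong (A.leading m)) 1#-homo)) (Below-map (A.below m))

  module Injective (φ-injective : ∀ {x y} → φ x B.≈ φ y → x A.≈ y) where

    map-injective : ∀ {p q} → mapₚ p B.≋ mapₚ q → p A.≋ q
    map-injective {p} {q} e = A.mk≋ λ k → φ-injective
      (B.trans (B.sym (coeff-map p k)) (B.trans (B.coeff≈ e k) (coeff-map q k)))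

    MonicOf-unmap : ∀ {p d} → B.MonicOf (mapₚ p) d → A.MonicOf p d
    MonicOf-unmap {p} {d} m = A.monicOf
      (φ-injective (B.trans (B.sym (coeff-map p d)) (B.trans (B.leading m) (B.sym 1#-homo))))
      (A.mkBelow λ k d<k → φ-injective
          (B.trans (B.sym (coeff-map p k)) (B.trans (B.vanishes (B.below m) k d<k) (B.sym 0#-homo))))

-- The embedding of ℤ into ℚ.

module Embedding where

  private
    -- `ℤ→ℚ` normalises its fraction. Among the unnormalised rationals it is just i over 1, and the
    -- homomorphism laws become cross-multiplications in ℤ.
    embed-≃ : ∀ i → ℚ.toℚᵘ (ℤ→ℚ i) ℚᵘ.≃ mkℚᵘ i 0
    embed-≃ i = ℚₚ.toℚᵘ-fromℚᵘ (mkℚᵘ i 0)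

    open ℤSolver.+-*-Solver

  ℤ→ℚ-injective : ∀ {i j} → ℤ→ℚ i ≡ ℤ→ℚ j → i ≡ j
  ℤ→ℚ-injective {i} {j} e with ℚₚ.fromℚᵘ-injective {mkℚᵘ i 0} {mkℚᵘ j 0} e
  ... | *≡* i*1≡j*1 = ≡.trans (≡.sym (ℤₚ.*-identityʳ i)) (≡.trans i*1≡j*1 (ℤₚ.*-identityʳ j))

  ℤ→ℚ-+ : ∀ i j → ℤ→ℚ (i ℤ.+ j) ≡ ℤ→ℚ i ℚ.+ ℤ→ℚ j
  ℤ→ℚ-+ i j = ℚₚ.toℚᵘ-injective (ℚᵘₚ.≃-trans (embed-≃ (i ℤ.+ j)) (ℚᵘₚ.≃-trans
    (*≡* (solve 2 (λ i j → (i :+ j) :* (con (+ 1) :* con (+ 1)) := (i :* con (+ 1) :+ j :* con (+ 1)) :* con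
        (+ 1)) ≡.refl i j))
    (ℚᵘₚ.≃-sym (ℚᵘₚ.≃-trans (ℚₚ.toℚᵘ-homo-+ (ℤ→ℚ i) (ℤ→ℚ j)) (ℚᵘₚ.+-cong (embed-≃ i) (embed-≃ j))))))

  ℤ→ℚ-* : ∀ i j → ℤ→ℚ (i ℤ.* j) ≡ ℤ→ℚ i ℚ.* ℤ→ℚ j
  ℤ→ℚ-* i j = ℚₚ.toℚᵘ-injective (ℚᵘₚ.≃-trans (embed-≃ (i ℤ.* j)) (ℚᵘₚ.≃-trans
    (*≡* (solve 2 (λ i j → (i :* j) :* (con (+ 1) :* con (+ 1)) := (i :* j) :* con (+ 1)) ≡.refl i j))
    (ℚᵘₚ.≃-sym (ℚᵘₚ.≃-trans (ℚₚ.toℚᵘ-homo-* (ℤ→ℚ i) (ℤ→ℚ j)) (ℚᵘₚ.*-cong (embed-≃ i) (embed-≃ j))))))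

  ℤ→ℚ-neg : ∀ i → ℤ→ℚ (ℤ.- i) ≡ ℚ.- ℤ→ℚ i
  ℤ→ℚ-neg i = ℚₚ.toℚᵘ-injective (ℚᵘₚ.≃-trans (embed-≃ (ℤ.- i))
    (ℚᵘₚ.≃-sym (ℚᵘₚ.≃-trans (ℚₚ.toℚᵘ-homo‿- (ℤ→ℚ i)) (ℚᵘₚ.-‿cong (embed-≃ i)))))

  denominator-* : ∀ a → ℤ→ℚ (ℚ.↧ a) ℚ.* a ≡ ℤ→ℚ (ℚ.↥ a)
  denominator-* a@record{} = ℚₚ.toℚᵘ-injective (ℚᵘₚ.≃-trans (ℚₚ.toℚᵘ-homo-* (ℤ→ℚ (ℚ.↧ a)) a)
    (ℚᵘₚ.≃-trans (ℚᵘₚ.*-cong (embed-≃ (ℚ.↧ a)) (ℚᵘₚ.≃-refl {ℚ.toℚᵘ a}))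
      (ℚᵘₚ.≃-trans (*≡* (solve 2 (λ d n → (d :* n) :* con (+ 1) := n :* (con (+ 1) :* d)) ≡.refl (ℚ.↧ a)
          (ℚ.↥ a)))
        (ℚᵘₚ.≃-sym (embed-≃ (ℚ.↥ a))))))

  ℤ→ℚ-hom : RingMorphisms.IsRingHomomorphism ℤ-rawRing ℚ-rawRing ℤ→ℚ
  ℤ→ℚ-hom = record
    { isSemiringHomomorphism = record
      { isNearSemiringHomomorphism = record
        { +-isMonoidHomomorphism = record
          { isMagmaHomomorphism = record
            { isRelHomomorphism = record { cong = ≡.cong ℤ→ℚ }
            ; homo = ℤ→ℚ-+ }
          ; ε-homo = ≡.refl }
        ; *-homo = ℤ→ℚ-* }
      ; 1#-homo = ≡.refl }
    ; -‿homo = ℤ→ℚ-neg }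

-- A field with a zero test. ℚ has one, while Cauchy reals do not constructively; this is why gcds
-- are computed before passing to ℝ.
InverseOrZero : ∀ {c ℓ} → CommutativeRing c ℓ → Set (c ⊔ ℓ)
InverseOrZero R = ∀ a → a ≈ 0# ⊎ (a ≉ 0# × ∃[ b ] a * b ≈ 1#)
  where open CommutativeRing R

-- Euclid's algorithm and Bézout identities.

module EuclideanAlgorithm {c ℓ} (R : CommutativeRing c ℓ) (invert : InverseOrZero R) where
  open CommutativeRing R hiding (zero)
  open PolynomialRing R
  open PolynomialDegree R
  open PolynomialSolver using (solveₚ; _⊜_; _:⊕_; _:⊛_; _:⊖_)

  zero-or-degree : ∀ p → p ≋ [] ⊎ ∃[ d ] (p [x^ d ] ≉ 0# × (∃[ b ] p [x^ d ] * b ≈ 1#) × Below p (suc d))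
  zero-or-degree []      = inj₁ ≋-refl
  zero-or-degree (a ∷ p) with zero-or-degree p
  ... | inj₂ (d , lead , unit , b) = inj₂ (suc d , lead , unit , Below-∷ b)
  ... | inj₁ p≋[] with invert a
  ...   | inj₁ a≈0 = inj₁ (∷≋[] a≈0 p≋[])
  ...   | inj₂ (a≉0 , b , ab≈1) = inj₂ (0 , a≉0 , (b , ab≈1) , Below-∷ (Below-resp (≋-sym p≋[]) Below-[]))

  zero-or-monic : ∀ p → p ≋ [] ⊎ ∃[ d ] ∃[ c ] ∃[ c⁻¹ ] ∃[ q ]
      (p [x^ d ] ≉ 0# × MonicOf q d × p ≋ scale c q × q ≋ scale c⁻¹ p)
  zero-or-monic p with zero-or-degree p
  ... | inj₁ p≋[] = inj₁ p≋[]
  ... | inj₂ (d , lead≉0 , (c⁻¹ , cc⁻¹≈1) , b) = inj₂ (d , p [x^ d ] , c⁻¹ , scale c⁻¹ p , lead≉0 ,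
          monicOf (trans (coeff-scale c⁻¹ p d) (trans (*-comm _ _) cc⁻¹≈1)) (Below-scale c⁻¹ p b) ,
          ≋-sym (≋-trans (scale-scale (p [x^ d ]) c⁻¹ p)
              (≋-trans (scale-cong cc⁻¹≈1 (≋-refl {p})) (scale-1 p))) ,
          ≋-refl)

  record Bezout (p q : Poly) : Set (c ⊔ ℓ) where
    field
      gcd s t   : Poly
      degree    : ℕ
      gcd-monic : MonicOf gcd degree
      identity  : gcd ≋ s ⊛ p ⊕ t ⊛ q
      gcd∣ˡ     : gcd ∣ₚ p
      gcd∣ʳ     : gcd ∣ₚ q

  -- Each remainder is made monic before it serves as the next divisor, as `divide` requires; the
  -- fuel bounds the degree of the divisor.
  bezout : ∀ p q {d} → MonicOf q d → Bezout p q
  bezout p q {d} = go (suc d) p q ℕₚ.≤-refl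
    where
    go : ∀ fuel p q {d} → d ℕ.< fuel → MonicOf q d → Bezout p q
    go (suc fuel) p q {d} (s≤s d≤fuel) mq with divide p mq
    ... | a , r , p≋ , below-r with zero-or-monic r
    ... | inj₁ r≋[] = record
          { gcd = q ; s = [] ; t = 1# ∷ [] ; degree = d ; gcd-monic = mq
          ; identity = ≋-sym (⊛-identityˡ q)
          ; gcd∣ˡ = a , ≋-trans p≋ (≋-trans (⊕-cong (≋-refl {q ⊛ a}) r≋[]) (⊕-identityʳ _))
          ; gcd∣ʳ = (1# ∷ []) , ≋-sym (≋-trans (⊛-comm q (1# ∷ [])) (⊛-identityˡ q)) }
    ... | inj₂ (e , c , c⁻¹ , r′ , lead≉0 , mr′ , r≋ , r′≋) =
          extend (go fuel q r′ (ℕₚ.<-≤-trans e<d d≤fuel) mr′)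
      where
      e<d : e ℕ.< d
      e<d = ℕₚ.≰⇒> λ d≤e → lead≉0 (vanishes below-r e d≤e)
      p≋′ : p ≋ q ⊛ a ⊕ constant c ⊛ r′
      p≋′ = ≋-trans p≋ (⊕-cong (≋-refl {q ⊛ a}) (≋-trans r≋ (scale≋constant⊛ c r′)))
      r≋′ : r ≋ p ⊕ neg (q ⊛ a)
      r≋′ = ≋-trans (solveₚ 2 (λ x y → y ⊜ (x :⊕ y) :⊖ x) ≋-refl (q ⊛ a) r)
          (⊕-cong (≋-sym p≋) (≋-refl {neg (q ⊛ a)}))
      extend : Bezout q r′ → Bezout p q
      extend B = record
        -- Obtained by substituting r′ = c⁻¹ (p - q a) into gcd = s q + t r′ and collecting the
        -- multiples of p and q.
        { gcd = gcd ; s = t ⊛ constant c⁻¹ ; t = s ⊕ neg (t ⊛ constant c⁻¹ ⊛ a)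
        ; degree = degree ; gcd-monic = gcd-monic
        ; identity = ≋-trans identity (≋-trans
            (⊕-cong (≋-refl {s ⊛ q}) (⊛-congˡ t
                (≋-trans r′≋ (≋-trans (scale≋constant⊛ c⁻¹ r) (⊛-congˡ (constant c⁻¹) r≋′)))))
            (solveₚ 6 (λ s t k p q a → s :⊛ q :⊕ t :⊛ (k :⊛ (p :⊖ q :⊛ a)) ⊜ t :⊛ k :⊛ p :⊕ (s :⊖ t :⊛ k :⊛ a)
              :⊛ q) ≋-refl s t (constant c⁻¹) p q a))
        ; gcd∣ˡ = (proj₁ gcd∣ˡ ⊛ a ⊕ constant c ⊛ proj₁ gcd∣ʳ) , ≋-trans p≋′ (≋-trans
            (⊕-cong (⊛-congʳ a (proj₂ gcd∣ˡ)) (⊛-congˡ (constant c) (proj₂ gcd∣ʳ)))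
            (solveₚ 5 (λ g u v a c → (g :⊛ u) :⊛ a :⊕ c :⊛ (g :⊛ v) ⊜ g :⊛ (u :⊛ a :⊕ c :⊛ v)) ≋-refl gcd
              (proj₁ gcd∣ˡ) (proj₁ gcd∣ʳ) a (constant c)))
        ; gcd∣ʳ = gcd∣ˡ }
        where open Bezout B

-- Gauss's lemma: monic rational factors of integer polynomials are integral.

module GaussLemma {c ℓ} (K : CommutativeRing c ℓ)
  (ι : ℤ → CommutativeRing.Carrier K)
  (ι-hom : RingMorphisms.IsRingHomomorphism ℤ-rawRing (CommutativeRing.rawRing K) ι)
  (ι-injective : ∀ {i j} → CommutativeRing._≈_ K (ι i) (ι j) → i ≡ j)
  (invert : InverseOrZero K)
  (fraction : ∀ a → ∃[ D ] ∃[ i ]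
      (ℕ.NonZero D × CommutativeRing._≈_ K (CommutativeRing._*_ K (ι (+ D)) a) (ι i))) where
  open CommutativeRing K hiding (zero)
  private
    module Z where
      open PolynomialRing ℤₚ.+-*-commutativeRing public
      open PolynomialDegree ℤₚ.+-*-commutativeRing public
  open PolynomialRing K
  open PolynomialDegree K
  open PolynomialMap ℤₚ.+-*-commutativeRing K ι ι-hom
  open Injective ι-injective
  open RingMorphisms.IsRingHomomorphism ι-hom using (*-homo; 1#-homo; 0#-homo)

  private
    DividesAll : ℕ → Z.Poly → Set
    DividesAll m p = ∀ k → + m ℤ∣.∣ p Z.[x^ k ]

    DividesAll-∷ : ∀ {m a} p → + m ℤ∣.∣ a → DividesAll m p → DividesAll m (a ∷ p)
    DividesAll-∷ p m∣a m∣p zero    = m∣a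
    DividesAll-∷ p m∣a m∣p (suc k) = m∣p k

    DividesAll-[] : ∀ m → DividesAll m []
    DividesAll-[] m k = divides (+ 0) ≡.refl

    DividesAll-resp : ∀ {m p q} → p Z.≋ q → DividesAll m p → DividesAll m q
    DividesAll-resp e m∣p k = ≡.subst (_ ℤ∣.∣_) (Z.coeff≈ e k) (m∣p k)

    prime-∣-* : ∀ {π} → Prime π → ∀ a b → + π ℤ∣.∣ a ℤ.* b → + π ℤ∣.∣ a ⊎ + π ℤ∣.∣ b
    prime-∣-* {π} π-prime a b π∣ab = Sum.map ℤ∣.∣ᵤ⇒∣ ℤ∣.∣ᵤ⇒∣
      (euclidsLemma ℤ.∣ a ∣ ℤ.∣ b ∣ π-prime (≡.subst (π ℕ∣.∣_) (ℤₚ.abs-* a b) (ℤ∣.∣⇒∣ᵤ π∣ab)))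

    DividesAll-drop : ∀ {m a} p q → + m ℤ∣.∣ a → DividesAll m ((a ∷ p) Z.⊛ q) → DividesAll m (p Z.⊛ q)
    DividesAll-drop {m} {a} p q m∣a h k = ℤ∣.∣m+n∣m⇒∣n
      (≡.subst (+ m ℤ∣.∣_) (Z.coeff-∷⊛ a p q k) (h (suc k)))
      (ℤ∣.∣m⇒∣m*n (q Z.[x^ suc k ]) m∣a)

    -- In place of a search for lowest coefficients prime to π: π divides the product of the two
    -- constant terms, hence one of them, and `DividesAll-drop` removes that one since (a + X p) q -
    -- a q = X (p q). The induction continues with a shorter list.
    prime-∣-⊛ : ∀ {π} → Prime π → ∀ p q → DividesAll π (p Z.⊛ q) → DividesAll π p ⊎ DividesAll π q
    prime-∣-⊛ {π} π-prime []      q       h = inj₁ (DividesAll-[] π)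
    prime-∣-⊛ {π} π-prime (a ∷ p) []      h = inj₂ (DividesAll-[] π)
    prime-∣-⊛ {π} π-prime (a ∷ p) (b ∷ q) h =
      [ (λ π∣a → Sum.map₁ (DividesAll-∷ p π∣a)
          (prime-∣-⊛ π-prime p (b ∷ q) (DividesAll-drop p (b ∷ q) π∣a h)))
      , (λ π∣b → Sum.map₂ (DividesAll-∷ q π∣b)
          (prime-∣-⊛ π-prime (a ∷ p) q (DividesAll-resp (Z.⊛-comm q (a ∷ p))
            (DividesAll-drop q (a ∷ p) π∣b (DividesAll-resp (Z.⊛-comm (a ∷ p) (b ∷ q)) h)))))
      ]′ (prime-∣-* π-prime a b (≡.subst (+ π ℤ∣.∣_) (ℤₚ.+-identityʳ (a ℤ.* b)) (h 0)))

    quotient : ∀ {m} p → DividesAll m p → ∃[ q ] (p Z.≋ Z.scale (+ m) q)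
    quotient     []      h = [] , Z.≋-refl
    quotient {m} (a ∷ p) h with quotient p (λ k → h (suc k)) | h 0
    ... | q , e | divides b a≡ = b ∷ q , Z.∷-cong (≡.trans a≡ (ℤₚ.*-comm b (+ m))) e

  ι-pos* : ∀ m n → ι (+ (m ℕ.* n)) ≈ ι (+ m) * ι (+ n)
  ι-pos* m n = trans (reflexive (≡.cong ι (ℤₚ.pos-* m n))) (*-homo (+ m) (+ n))

  clear-denominators : ∀ f → ∃[ D ] ∃[ F ] (ℕ.NonZero D × mapₚ F ≋ scale (ι (+ D)) f)
  clear-denominators []      = 1 , [] , _ , ≋-refl
  clear-denominators (a ∷ f) with clear-denominators f | fraction a
  ... | D , F , D≢0 , e | d , i , d≢0 , da≈i =
        D ℕ.* d , (+ D ℤ.* i) ∷ Z.scale (+ d) F , ℕₚ.m*n≢0 D d {{D≢0}} {{d≢0}} , ∷-cong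
          (trans (*-homo (+ D) i) (trans (*-congˡ (sym da≈i))
              (trans (sym (*-assoc _ _ _)) (*-congʳ (sym (ι-pos* D d))))))
          (mapₚ (Z.scale (+ d) F)              ≋⟨ map-scale (+ d) F ⟩
           scale (ι (+ d)) (mapₚ F)            ≋⟨ scale-congˡ (ι (+ d)) e ⟩
           scale (ι (+ d)) (scale (ι (+ D)) f) ≋⟨ scale-scale (ι (+ d)) (ι (+ D)) f ⟩
           scale (ι (+ d) * ι (+ D)) f         ≋⟨ scale-congʳ f (trans (*-comm _ _) (sym (ι-pos* D d))) ⟩
           scale (ι (+ (D ℕ.* d))) f           ∎ₚ)

  -- D f stays integral when D loses a prime dividing all coefficients of D f: f is monic,
  -- so that prime divides the leading coefficient D of D f.
  reduce-multiple : ∀ {π f d} → Prime π → MonicOf f d → ∀ D F → mapₚ F ≋ scale (ι (+ D)) f → DividesAll π F →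
    ∃[ D′ ] ∃[ F′ ] (D ≡ π ℕ.* D′ × mapₚ F′ ≋ scale (ι (+ D′)) f)
  reduce-multiple {π} {f} {d} π-prime mf D F e π∣F =
    extract (quotient F π∣F) (ℤ∣.∣⇒∣ᵤ (≡.subst (+ π ℤ∣.∣_) lead (π∣F d))) (invert (ι (+ π)))
    where
    Result = ∃[ D′ ] ∃[ F′ ] (D ≡ π ℕ.* D′ × mapₚ F′ ≋ scale (ι (+ D′)) f)
    lead : F Z.[x^ d ] ≡ + D
    lead = ι-injective (trans (sym (coeff-map F d)) (trans (coeff≈ e d) (trans (coeff-scale (ι (+ D)) f d)
      (trans (*-congˡ (leading mf)) (*-identityʳ _)))))
    extract : ∃[ F′ ] (F Z.≋ Z.scale (+ π) F′) → π ℕ∣.∣ D → ι (+ π) ≈ 0# ⊎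
        (ι (+ π) ≉ 0# × ∃[ b ] ι (+ π) * b ≈ 1#) → Result
    extract _ _ (inj₁ π≈0) = ⊥-elim (ℕ.≢-nonZero⁻¹ π {{prime⇒nonZero π-prime}}
      (ℤₚ.+-injective (ι-injective (trans π≈0 (sym 0#-homo)))))
    extract (F′ , F≋) (ℕ∣.divides D′ D≡D′π) (inj₂ (_ , b , πb≈1)) = D′ , F′ , D≡πD′ ,
      (mapₚ F′                                 ≋⟨ unscale (mapₚ F′) ⟨
       scale b (scale (ι (+ π)) (mapₚ F′))     ≋⟨ scale-congˡ b (map-scale (+ π) F′) ⟨
       scale b (mapₚ (Z.scale (+ π) F′))       ≋⟨ scale-congˡ b (map-cong F≋) ⟨
       scale b (mapₚ F)                        ≋⟨ scale-congˡ b e ⟩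
       scale b (scale (ι (+ D)) f)
         ≋⟨ scale-congˡ b (scale-congʳ f (trans (reflexive (≡.cong (λ t → ι (+ t)) D≡πD′)) (ι-pos* π D′))) ⟩
       scale b (scale (ι (+ π) * ι (+ D′)) f)  ≋⟨ scale-congˡ b (scale-scale (ι (+ π)) (ι (+ D′)) f) ⟨
       scale b (scale (ι (+ π)) (scale (ι (+ D′)) f)) ≋⟨ unscale (scale (ι (+ D′)) f) ⟩
       scale (ι (+ D′)) f                      ∎ₚ)
      where
      D≡πD′ : D ≡ π ℕ.* D′
      D≡πD′ = ≡.trans D≡D′π (ℕₚ.*-comm D′ π)
      unscale : ∀ p → scale b (scale (ι (+ π)) p) ≋ p
      unscale p = ≋-trans (scale-scale b (ι (+ π)) p)
          (≋-trans (scale-congʳ p (trans (*-comm _ _) πb≈1)) (scale-1 p))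

  -- If F = D f and G = E g are integral, then F G = D E q, so a prime of D E divides all
  -- coefficients of F or all of G and can be cancelled there. When D E has become 1, f is the image
  -- of F.
  monic-factor-integral : ∀ {f g d e} q → MonicOf f d → MonicOf g e → mapₚ q ≋ f ⊛ g → ∃[ F ] (mapₚ F ≋ f)
  monic-factor-integral {f} {g} q mf mg q≋fg = start (clear-denominators f) (clear-denominators g)
    where
    -- The induction is on the prime factors of D E, where D f and E g are integral.
    descend : ∀ πs → All Prime πs → ∀ D E F G → D ℕ.* E ≡ product πs →
      mapₚ F ≋ scale (ι (+ D)) f → mapₚ G ≋ scale (ι (+ E)) g → ∃[ F ] (mapₚ F ≋ f)
    descend [] [] D E F G DE≡1 eF eG = F , ≋-trans eF (≋-trans
      (scale-congʳ f (trans (reflexive (≡.cong (λ t → ι (+ t)) (ℕₚ.m*n≡1⇒m≡1 D E DE≡1))) 1#-homo)) (scale-1 f))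
    descend (π ∷ πs) (π-prime ∷ primes) D E F G DE≡ eF eG =
      [ (λ π∣F → dropˡ (reduce-multiple π-prime mf D F eF π∣F))
      , (λ π∣G → dropʳ (reduce-multiple π-prime mg E G eG π∣G))
      ]′ (prime-∣-⊛ π-prime F G π∣FG)
      where
      FG≋ : F Z.⊛ G Z.≋ Z.scale (+ (D ℕ.* E)) q
      FG≋ = map-injective (
        mapₚ (F Z.⊛ G)                                        ≋⟨ map-⊛ F G ⟩
        mapₚ F ⊛ mapₚ G                                       ≋⟨ ⊛-cong eF eG ⟩
        scale (ι (+ D)) f ⊛ scale (ι (+ E)) g                 ≋⟨ scale-⊛ (ι (+ D)) f (scale (ι (+ E)) g) ⟩
        scale (ι (+ D)) (f ⊛ scale (ι (+ E)) g)
          ≋⟨ scale-congˡ (ι (+ D)) (⊛-comm f (scale (ι (+ E)) g)) ⟩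
        scale (ι (+ D)) (scale (ι (+ E)) g ⊛ f)               ≋⟨ scale-congˡ (ι (+ D)) (scale-⊛ (ι (+ E)) g f) ⟩
        scale (ι (+ D)) (scale (ι (+ E)) (g ⊛ f))             ≋⟨ scale-scale (ι (+ D)) (ι (+ E)) (g ⊛ f) ⟩
        scale (ι (+ D) * ι (+ E)) (g ⊛ f)
          ≋⟨ scale-cong (sym (ι-pos* D E)) (≋-trans (⊛-comm g f) (≋-sym q≋fg)) ⟩
        scale (ι (+ (D ℕ.* E))) (mapₚ q)                      ≋⟨ map-scale (+ (D ℕ.* E)) q ⟨
        mapₚ (Z.scale (+ (D ℕ.* E)) q)                        ∎ₚ)
      π∣FG : DividesAll π (F Z.⊛ G)
      π∣FG k = ≡.subst (+ π ℤ∣.∣_) (≡.sym (≡.trans (Z.coeff≈ FG≋ k) (Z.coeff-scale (+ (D ℕ.* E)) q k)))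
        (ℤ∣.∣m⇒∣m*n {m = + (D ℕ.* E)} (q Z.[x^ k ])
            (ℤ∣.∣ᵤ⇒∣ (≡.subst (π ℕ∣.∣_) (≡.sym DE≡) (ℕ∣.m∣m*n (product πs)))))
      cancel : ∀ {m} → π ℕ.* m ≡ π ℕ.* product πs → m ≡ product πs
      cancel {m} = ℕₚ.*-cancelˡ-≡ m (product πs) π {{prime⇒nonZero π-prime}}
      dropˡ : ∃[ D′ ] ∃[ F′ ] (D ≡ π ℕ.* D′ × mapₚ F′ ≋ scale (ι (+ D′)) f) → ∃[ F ] (mapₚ F ≋ f)
      dropˡ (D′ , F′ , D≡ , eF′) = descend πs primes D′ E F′ G
        (cancel (≡.trans (≡.sym (ℕₚ.*-assoc π D′ E)) (≡.trans (≡.cong (ℕ._* E) (≡.sym D≡)) DE≡))) eF′ eG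
      dropʳ : ∃[ E′ ] ∃[ G′ ] (E ≡ π ℕ.* E′ × mapₚ G′ ≋ scale (ι (+ E′)) g) → ∃[ F ] (mapₚ F ≋ f)
      dropʳ (E′ , G′ , E≡ , eG′) = descend πs primes D E′ F G′
        (cancel (≡.trans (ℕ*.x∙yz≈y∙xz π D E′) (≡.trans (≡.cong (D ℕ.*_) (≡.sym E≡)) DE≡))) eF eG′
    start : ∃[ D ] ∃[ F ] (ℕ.NonZero D × mapₚ F ≋ scale (ι (+ D)) f) →
      ∃[ E ] ∃[ G ] (ℕ.NonZero E × mapₚ G ≋ scale (ι (+ E)) g) → ∃[ F ] (mapₚ F ≋ f)
    start (D , F , D≢0 , eF) (E , G , E≢0 , eG) = descend (PrimeFactorisation.factors primes)
      (PrimeFactorisation.factorsPrime primes) D E F G (PrimeFactorisation.isFactorisation primes) eF eG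
      where
      primes = factorise (D ℕ.* E) {{ℕₚ.m*n≢0 D E {{D≢0}} {{E≢0}}}}

-- Coefficients of a Lagrange combination after the substitution of x - 1.

module LagrangeSums {c ℓ} (R : CommutativeRing c ℓ) where
  open CommutativeRing R hiding (zero)
  open PolynomialRing R
  open PolynomialDegree R
  open RootVectors R

  coeff-∑ₚ : ∀ {n} (p : Vector Poly n) k → ∑ₚ p [x^ k ] ≈ Vector.foldr _+_ 0# (λ j → p j [x^ k ])
  coeff-∑ₚ {zero}  p k = refl
  coeff-∑ₚ {suc n} p k = trans (coeff-⊕ (head p) (∑ₚ (tail p)) k) (+-congˡ (coeff-∑ₚ (tail p) k))

  shift-∑ₚ : ∀ {n} (p : Vector Poly n) → shift (∑ₚ p) ≋ ∑ₚ (λ j → shift (p j))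
  shift-∑ₚ {zero}  p = ≋-refl
  shift-∑ₚ {suc n} p = ≋-trans (∘ₚ-⊕ (head p) (∑ₚ (tail p)) (x- 1#))
      (⊕-cong (≋-refl {shift (head p)}) (shift-∑ₚ (tail p)))

  coeff-shift-combination : ∀ {n} (γ u : Vector Carrier n) k →
    shift (combination γ u) [x^ k ] ≈ Vector.foldr _+_ 0# (λ j → γ j * shift (omit u j) [x^ k ])
  coeff-shift-combination γ u k = trans (coeff≈ eq k)
      (trans (coeff-∑ₚ (λ j → scale (γ j) (shift (omit u j))) k)
          (∑-cong λ j → coeff-scale (γ j) (shift (omit u j)) k))
    where
    eq : shift (combination γ u) ≋ ∑ₚ (λ j → scale (γ j) (shift (omit u j)))
    eq = ≋-trans (∘ₚ-congʳ (x- 1#) (combination≋∑ₚ γ u))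
        (≋-trans (shift-∑ₚ (λ j → scale (γ j) (omit u j))) (∑ₚ-cong λ j → ∘ₚ-scale (γ j) (omit u j) (x- 1#)))
    ∑-cong : ∀ {n} {a b : Vector Carrier n} → (∀ j → a j ≈ b j) → Vector.foldr _+_ 0# a ≈ Vector.foldr _+_ 0# b
    ∑-cong {zero}  e = refl
    ∑-cong {suc n} e = +-cong (e zero) (∑-cong λ j → e (suc j))

-- Identifying the gcd of p and p′ from the grouped roots.

module RepeatedRoots {c ℓ} (R : CommutativeRing c ℓ)
  (1≉0 : ¬ (CommutativeRing._≈_ R (CommutativeRing.1# R) (CommutativeRing.0# R))) where
  open CommutativeRing R hiding (zero)
  open PolynomialRing R
  open PolynomialDegree R
  open RootVectors R
  open PolynomialSolver using (solveₚ; _⊜_; _:⊕_; _:⊛_)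

  MonicOf⇒≉[] : ∀ {p d} → MonicOf p d → ¬ (p ≋ [])
  MonicOf⇒≉[] m e = 1≉0 (trans (sym (leading m)) (coeff≈ e _))

  MonicOf-multiple-≥ : ∀ {p q d m} s → MonicOf p d → MonicOf q m → q ≋ p ⊛ s → d ℕ.≤ m
  MonicOf-multiple-≥ {p} {q} {d} {m} s mp mq e = ℕₚ.≮⇒≥ λ m<d → MonicOf⇒≉[] mq
    (≋-trans e (≋-trans (⊛-congˡ p (Below-0
        (Below-cancel s mp (Below-≤ (ℕₚ.≤-trans m<d (ℕₚ.m≤m+n d 0)) (Below-resp e (below mq))))))
      (⊛-zeroʳ p)))

  -- The leading coefficient of q is known only to be nonzero. As g is monic, it reappears as the
  -- coefficient of x^(l + r) in p, which excludes n < l + r.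
  degree-⊛ : ∀ {p q g n r l} → MonicOf p n → MonicOf g l → HasDegree q r → p ≋ g ⊛ q → n ≡ l ℕ.+ r
  degree-⊛ {p} {q} {g} {n} {r} {l} mp mg (lead≉0 , high) e = case (ℕₚ.<-cmp n (l ℕ.+ r))
    where
    bq : Below q (suc r)
    bq = mkBelow high
    top : p [x^ l ℕ.+ r ] ≈ q [x^ r ]
    top = trans (coeff≈ e (l ℕ.+ r))
        (trans (coeff-⊛-top g q (below mg) bq) (trans (*-congʳ (leading mg)) (*-identityˡ _)))
    case : Tri (n ℕ.< l ℕ.+ r) (n ≡ l ℕ.+ r) (l ℕ.+ r ℕ.< n) → n ≡ l ℕ.+ r
    case (tri≈ _ n≡ _) = n≡
    case (tri< n< _ _) = ⊥-elim (lead≉0 (trans (sym top) (vanishes (below mp) _ n<)))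
    case (tri> _ _ n>) = ⊥-elim (1≉0
        (trans (sym (leading mp)) (trans (coeff≈ e n) (vanishes (Below-⊛ g q (below mg) bq) n n>))))

  -- A gcd of p and p′ in a form that survives a change of ring: maximality over ℚ says nothing
  -- about real divisors, whereas the identity `g≋` is preserved by any homomorphism.
  record GcdData {n} (v : Vector Carrier n) : Set (c ⊔ ℓ) where
    field
      min g h s t    : Poly
      r l            : ℕ
      min-monic      : MonicOf min r
      g-monic        : MonicOf g l
      linears≋       : linears v ≋ min ⊛ g
      deriv-linears≋ : deriv (linears v) ≋ h ⊛ g
      g≋             : g ≋ s ⊛ deriv (linears v) ⊕ t ⊛ linears v

  module _ {d} {D : Carrier → Set d} (regular : ∀ {a} → D a → Regular a)
    {n m} {v : Vector Carrier (suc n)} {u : Vector Carrier (suc m)} (grouped : Grouped D v u)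
    (weights-regular : ∀ j → Regular (weights grouped j)) where

    Grouped-distinct : Distinct u
    Grouped-distinct i j i<j = regular (Grouped-apart grouped i j i<j)

    record Separation (δ : GcdData v) : Set (c ⊔ ℓ) where
      open GcdData δ
      field
        degree≡    : r ≡ suc m
        min≋       : min ≋ linears u
        g≋cofactor : g ≋ cofactor grouped

    -- g is a combination of p and p′, hence a multiple g = G k of the cofactor
    -- G = ∏ (x − uⱼ)^(mⱼ − 1); k divides both ∏ (x − uⱼ) and p′ / G, so it is 1.
    separate : (δ : GcdData v) → Separation δ
    separate δ = conclude (common-factor (weights grouped) u Grouped-distinct weights-regular {min} {h} {k} M≋
        H≋)
      where
      open GcdData δ
      M = linears u
      H = combination (weights grouped) u
      G = cofactor grouped
      k = s ⊛ H ⊕ t ⊛ M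
      p≋ : linears v ≋ M ⊛ G
      p≋ = linears-grouped grouped
      p′≋ : deriv (linears v) ≋ H ⊛ G
      p′≋ = deriv-linears-grouped grouped
      G-monic : MonicOf G (n ℕ.∸ m)
      G-monic = MonicOf-quotient G (MonicOf-linears u)
          (≡.subst (MonicOf (M ⊛ G)) (≡.sym (≡.cong suc (ℕₚ.m+[n∸m]≡n (Grouped-≤ grouped))))
        (MonicOf-resp p≋ (MonicOf-linears v)))
      g≋Gk : g ≋ G ⊛ k
      g≋Gk = ≋-trans g≋ (≋-trans (⊕-cong (⊛-congˡ s p′≋) (⊛-congˡ t p≋))
        (solveₚ 5 (λ s t H M G → s :⊛ (H :⊛ G) :⊕ t :⊛ (M :⊛ G) ⊜ G :⊛ (s :⊛ H :⊕ t :⊛ M)) ≋-refl s t H M G))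
      divide-G : ∀ a b → a ⊛ G ≋ b ⊛ g → a ≋ b ⊛ k
      divide-G a b e = ⊛-cancelˡ a (b ⊛ k) G-monic (≋-trans (⊛-comm G a) (≋-trans e (≋-trans (⊛-congˡ b g≋Gk)
        (solveₚ 3 (λ b G k → b :⊛ (G :⊛ k) ⊜ G :⊛ (b :⊛ k)) ≋-refl b G k))))
      M≋ : M ≋ min ⊛ k
      M≋ = divide-G M min (≋-trans (≋-sym p≋) linears≋)
      H≋ : H ≋ h ⊛ k
      H≋ = divide-G H h (≋-trans (≋-sym p′≋) deriv-linears≋)
      conclude : ∃[ f ] (min ≋ M ⊛ f) → Separation δ
      conclude (f , min≋Mf) = record
        { degree≡    = r≡
        ; min≋       = ≋-sym (≋-trans M≋ (≋-trans (⊛-congˡ min k≋1) (×1 min)))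
        ; g≋cofactor = ≋-trans g≋Gk (≋-trans (⊛-congˡ G k≋1) (×1 G)) }
        where
        r≡ : r ≡ suc m
        r≡ = ℕₚ.≤-antisym (MonicOf-multiple-≥ k min-monic (MonicOf-linears u) M≋)
                          (MonicOf-multiple-≥ f (MonicOf-linears u) min-monic min≋Mf)
        k≋1 : k ≋ 1# ∷ []
        k≋1 = MonicOf-unit (MonicOf-quotient k min-monic (MonicOf-resp M≋
          (≡.subst (MonicOf M) (≡.trans (≡.sym r≡) (≡.sym (ℕₚ.+-identityʳ r))) (MonicOf-linears u))))
        ×1 : ∀ p → p ⊛ (1# ∷ []) ≋ p
        ×1 p = ≋-trans (⊛-comm p (1# ∷ [])) (⊛-identityˡ p)

  module _ {d} {D : Carrier → Set d} (regular : ∀ {a} → D a → Regular a)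
    {m} (u : Vector Carrier (suc m)) (apart : ∀ i j → i Fin.< j → D (u j - u i))
    (weights-regular : ∀ j → Regular (weights (Grouped-self {D = D} u apart) j)) where

    -- With all multiplicities 1 the derivative is itself a Lagrange combination with regular
    -- weights, so `common-factor` puts all of `linears u` into e₁. Cancelling it leaves δ f = 1,
    -- and δ has degree 0.
    linears-separable : ∀ {δ e₁ e₂ l} → MonicOf δ l → linears u ≋ δ ⊛ e₁ → deriv (linears u) ≋ δ ⊛ e₂ → l ≡ 0
    linears-separable {δ} {e₁} {e₂} {l} mδ lin≋ deriv≋ = conclude
      (common-factor (weights self) u (λ i j i<j → regular (apart i j i<j)) weights-regular {e₁} {e₂} {δ}
        (≋-trans lin≋ (⊛-comm δ e₁)) (cofactor-1
            (≋-trans (≋-sym (deriv-linears-grouped self)) (≋-trans deriv≋ (⊛-comm δ e₂)))))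
      where
      self = Grouped-self {D = D} u apart
      M = linears u
      cofactor-self≋1 : cofactor self ≋ 1# ∷ []
      cofactor-self≋1 = ⊛-cancelˡ (cofactor self) (1# ∷ []) (MonicOf-linears u)
        (≋-trans (≋-sym (linears-grouped self)) (≋-sym (≋-trans (⊛-comm M (1# ∷ [])) (⊛-identityˡ M))))
      cofactor-1 : ∀ {p q} → p ⊛ cofactor self ≋ q → p ≋ q
      cofactor-1 {p} e = ≋-trans (≋-sym
          (≋-trans (⊛-congˡ p cofactor-self≋1) (≋-trans (⊛-comm p (1# ∷ [])) (⊛-identityˡ p)))) e
      conclude : ∃[ f ] (e₁ ≋ M ⊛ f) → l ≡ 0
      conclude (f , e₁≋) = ℕₚ.n≤0⇒n≡0
          (MonicOf-multiple-≥ f mδ MonicOf-1 (⊛-cancelˡ (1# ∷ []) (δ ⊛ f) (MonicOf-linears u)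
        (≋-trans (≋-trans (⊛-comm M (1# ∷ [])) (⊛-identityˡ M)) (≋-trans lin≋ (≋-trans (⊛-congˡ δ e₁≋)
          (solveₚ 3 (λ δ M f → δ :⊛ (M :⊛ f) ⊜ M :⊛ (δ :⊛ f)) ≋-refl δ M f))))))

-- Grouping a sorted list.

module SortedGrouping {c ℓ} (R : CommutativeRing c ℓ) (O : Nonnegativity R) where
  open CommutativeRing R hiding (zero)
  open Nonnegativity O
  open RootVectors R
  open IntegerCoefficients R using (solve; _:=_; _:+_; _:-_; :-_)

  Sorted : ∀ {n} → Vector Carrier n → Set ℓ
  Sorted v = ∀ i j → i Fin.≤ j → NonNeg (v j - v i)

  sandwich : ∀ {n} {v : Vector Carrier n} → Sorted v → ∀ i j k → i Fin.≤ j → j Fin.≤ k → v i ≈ v k → v i ≈ v j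
  sandwich {v = v} sorted i j k i≤j j≤k vi≈vk = sym
    (trans (solve 2 (λ a b → b := b :- a :+ a) refl (v i) (v j)) (trans (+-congʳ vj-vi≈0) (+-identityˡ _)))
    where
    vj-vi≈0 : v j - v i ≈ 0#
    vj-vi≈0 = nonNeg-antisym (sorted i j i≤j) (nonNeg-resp
      (trans (+-congʳ (sym vi≈vk)) (solve 2 (λ a b → a :- b := :- (b :- a)) refl (v i) (v j))) (sorted j k j≤k))

  group-sorted : ∀ {d} {D : Carrier → Set d} {n} (v : Vector Carrier (suc n)) → Sorted v →
      (∀ {a b} → a ≈ b → D a → D b) →
    (∀ i j → i Fin.< j → v i ≈ v j ⊎ D (v j - v i)) → ∃[ r ] Σ[ u ∈ Vector Carrier (suc r) ] Grouped D v u
  group-sorted {D = D} v sorted resp dec = group v resp λ i → adjacent i (dec (inject₁ i) (suc i) (i<suc i))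
    where
    i<suc : ∀ i → inject₁ i Fin.< suc i
    i<suc i = s≤s (ℕₚ.≤-reflexive (toℕ-inject₁ i))
    suc≤ : ∀ i j → inject₁ i Fin.< j → suc i Fin.≤ j
    suc≤ i j i<j = ≡.subst (λ t → suc t ℕ.≤ Fin.toℕ j) (toℕ-inject₁ i) i<j
    adjacent : ∀ i → v (inject₁ i) ≈ v (suc i) ⊎ D (v (suc i) - v (inject₁ i)) →
      v (inject₁ i) ≈ v (suc i) ⊎ (∀ j → inject₁ i Fin.< j → D (v j - v (inject₁ i)))
    adjacent i (inj₁ e) = inj₁ e
    adjacent i (inj₂ d) = inj₂ λ j i<j → spread j i<j (dec (inject₁ i) j i<j)
      where
      spread : ∀ j → inject₁ i Fin.< j → v (inject₁ i) ≈ v j ⊎ D (v j - v (inject₁ i)) → D (v j - v (inject₁ i))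
      spread j i<j (inj₂ d′) = d′
      -- By sortedness, v i = v j puts the neighbour in between at the same value. No contradiction
      -- is drawn: the apartness of the neighbour is transported to v j.
      spread j i<j (inj₁ e)  = resp (+-congʳ (trans
        (sym (sandwich sorted (inject₁ i) (suc i) j (ℕₚ.<⇒≤ (i<suc i)) (suc≤ i j i<j) e)) e)) d

-- Deciding equality of the real roots.

module RealRoots where
  open RealField
  open CommutativeRing realRing hiding (zero)
  open PolynomialRing realRing
  open PolynomialDegree realRing
  open RootVectors realRing
  open RepeatedRoots realRing 1≄0
  open SortedGrouping realRing realNonnegativity
  open IntegerCoefficients realRing using (solve; _:=_; _:+_; _:*_; _:-_; :-_; con)
  open import Algebra.Properties.Semiring.Mult.TCOptimised semiring using (1+×) renaming (_×_ to _·_)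
  open import Relation.Binary.Reasoning.Setoid setoid

  Nonzero : ℝ → Set
  Nonzero x = ¬ (x ≃ 0ᵣ)

  Nonzero-resp : ∀ {x y} → x ≃ y → Nonzero x → Nonzero y
  Nonzero-resp x≃y x≄0 y≃0 = x≄0 (trans x≃y y≃0)

  -- Characteristic 0, so that multiplicities do not vanish: from (1 + n) · 1 = 0 would follow -1 =
  -- n · 1 ≥ 0, and then 1 = 0 by antisymmetry.
  multiple-regular : ∀ n → 0 ℕ.< n → Regular (n · 1ᵣ)
  multiple-regular (suc n) _ = nonzero⇒Regular λ e → 1≄0 (NonNeg-antisym NonNeg-1
    (NonNeg-resp (trans (trans (sym (+-identityˡ _)) (+-congʳ (sym (-‿inverseˡ 1ᵣ))))
        (trans (+-assoc _ _ _) (trans (+-congˡ (trans (sym (1+× n 1ᵣ)) e)) (+-identityʳ _))))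
      (multiple-nonNeg n)))
    where
    multiple-nonNeg : ∀ n → NonNeg (n · 1ᵣ)
    multiple-nonNeg zero    = NonNeg-0
    multiple-nonNeg (suc n) = NonNeg-resp (sym (1+× n 1ᵣ)) (NonNeg-+ NonNeg-1 (multiple-nonNeg n))

  weights-regular : ∀ {D : ℝ → Set} {n m} {v : Vector ℝ (suc n)} {u : Vector ℝ (suc m)}
    (g : Grouped D v u) j → Regular (weights g j)
  weights-regular g j = multiple-regular (multiplicity g j) (multiplicity-positive g j)

  ¬¬-∀ : ∀ {n} {P : Fin n → Set} → (∀ i → ¬ ¬ P i) → ¬ ¬ (∀ i → P i)
  ¬¬-∀ {zero}  h k = k λ ()
  ¬¬-∀ {suc n} h k = h zero λ p → ¬¬-∀ (λ i → h (suc i)) λ ps → k λ { zero → p ; (suc i) → ps i }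

  -- Excluded middle holds under a double negation for each of the finitely many pairs, and `¬¬-∀`
  -- collects them. The grouping may be opened only for stable goals: the equality of reals in
  -- `min-root` and of natural numbers in `min-separable`.
  ¬¬-grouped : ∀ {n} (v : Vector ℝ (suc n)) → Sorted v →
    ¬ ¬ (∃[ m ] Σ[ u ∈ Vector ℝ (suc m) ] Grouped Nonzero v u)
  ¬¬-grouped v sorted = ¬¬-map
    (λ dec → group-sorted v sorted Nonzero-resp λ i j _ → dec i j)
    (¬¬-∀ λ i → ¬¬-∀ λ j → ¬¬-map (λ { (yes e) → inj₁ e ; (no v≄) → inj₂ λ e → v≄ (sym (x-y≃0⇒x≃y e)) })
        ¬¬-excluded-middle)

  module _ {n} {v : Vector ℝ (suc n)} (sorted : Sorted v) (δ : GcdData v) where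
    open GcdData δ

    min-root : ∀ i → eval min (v i) ≃ 0ᵣ
    min-root i = ≃-stable (¬¬-map root (¬¬-grouped v sorted))
      where
      root : ∃[ m ] Σ[ u ∈ Vector ℝ (suc m) ] Grouped Nonzero v u → eval min (v i) ≃ 0ᵣ
      root (m , u , grouped) = let j , e = Grouped-⊆ grouped i in begin
        eval min (v i)            ≈⟨ eval-congʳ min e ⟩
        eval min (u j)
          ≈⟨ eval-cong (u j) (Separation.min≋ (separate nonzero⇒Regular grouped (weights-regular grouped) δ)) ⟩
        eval (linears u) (u j)    ≈⟨ eval-linears-root u j ⟩
        0ᵣ                        ∎

    -- This is what makes the gcd of min and min′ equal to 1 before any two roots have been
    -- compared.
    min-separable : ∀ {d e₁ e₂ k} → MonicOf d k → min ≋ d ⊛ e₁ → deriv min ≋ d ⊛ e₂ → k ≡ 0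
    min-separable {d} {e₁} {e₂} {k} md min≋de₁ deriv≋de₂ = decidable-stable (k ℕₚ.≟ 0)
        (¬¬-map degree≡0 (¬¬-grouped v sorted))
      where
      degree≡0 : ∃[ m ] Σ[ u ∈ Vector ℝ (suc m) ] Grouped Nonzero v u → k ≡ 0
      degree≡0 (m , u , grouped) = linears-separable nonzero⇒Regular u (Grouped-apart grouped)
        (weights-regular (Grouped-self u (Grouped-apart grouped))) {d} {e₁} {e₂} md
        (≋-trans (≋-sym min≋) min≋de₁) (≋-trans (≋-sym (deriv-cong min≋)) deriv≋de₂)
        where open Separation (separate nonzero⇒Regular grouped (weights-regular grouped) δ)

    -- For roots x, y of min, Taylor's formula 0 = (y − x) (min′(x) + (y − x) L) and
    -- B(x) min′(x) = 1 give (y − x) (1 − θ) = 0 for θ = − B(x) L (y − x). So θ is 0 if x = y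
    -- and 1 otherwise, which a rational approximation decides.
    compare-roots : ∀ A B → A ⊛ min ⊕ B ⊛ deriv min ≋ 1ᵣ ∷ [] → ∀ i j → i Fin.< j →
      v i ≃ v j ⊎ PosUnit (v j - v i)
    compare-roots A B bezout i j i<j = decide (taylor min x y)
      where
      x = v i
      y = v j
      B[x] = eval B x
      D[x] = eval (deriv min) x
      BD≃1 : B[x] * D[x] ≃ 1ᵣ
      BD≃1 = begin
        B[x] * D[x]
          ≈⟨ trans (sym (+-identityˡ _)) (+-congʳ (sym (zeroʳ (eval A x)))) ⟩
        eval A x * 0ᵣ + B[x] * D[x]               ≈⟨ +-congʳ (*-congˡ (min-root i)) ⟨
        eval A x * eval min x + B[x] * D[x]       ≈⟨ +-cong (eval-⊛ A min x) (eval-⊛ B (deriv min) x) ⟨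
        eval (A ⊛ min) x + eval (B ⊛ deriv min) x ≈⟨ eval-⊕ (A ⊛ min) (B ⊛ deriv min) x ⟨
        eval (A ⊛ min ⊕ B ⊛ deriv min) x          ≈⟨ eval-cong x bezout ⟩
        eval (1ᵣ ∷ []) x                          ≈⟨ eval-1 x ⟩
        1ᵣ                                        ∎
      decide : ∃[ L ] (eval min y ≃ eval min x + (y - x) * (D[x] + (y - x) * L)) → x ≃ y ⊎ PosUnit (y - x)
      decide (L , taylor≃) = Sum.map θ≃0⇒ θ≃1⇒ (decide-idempotent (¬¬-map dichotomy ¬¬-excluded-middle))
        where
        S = - (B[x] * L)
        θ = S * (y - x)
        product≃0 : (y - x) * (1ᵣ - θ) ≃ 0ᵣ
        product≃0 = begin
          (y - x) * (1ᵣ - θ)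
            ≈⟨ *-congˡ (+-congʳ BD≃1) ⟨
          (y - x) * (B[x] * D[x] - θ)
            ≈⟨ solve 4 (λ d b e l → d :* (b :* e :- (:- (b :* l)) :* d) := b :*
                (con (+ 0) :+ d :* (e :+ d :* l))) refl (y - x) B[x] D[x] L ⟩
          B[x] * (0ᵣ + (y - x) * (D[x] + (y - x) * L))
            ≈⟨ *-congˡ (+-congʳ (min-root i)) ⟨
          B[x] * (eval min x + (y - x) * (D[x] + (y - x) * L))
            ≈⟨ *-congˡ taylor≃ ⟨
          B[x] * eval min y
            ≈⟨ *-congˡ (min-root j) ⟩
          B[x] * 0ᵣ
            ≈⟨ zeroʳ _ ⟩
          0ᵣ ∎
        dichotomy : Dec (y - x ≃ 0ᵣ) → θ ≃ 0ᵣ ⊎ θ ≃ 1ᵣ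
        dichotomy (yes e)  = inj₁ (trans (*-congˡ e) (zeroʳ S))
        dichotomy (no  ≄0) = inj₂ (sym (x-y≃0⇒x≃y (nonzero⇒Regular ≄0 (1ᵣ - θ) product≃0)))
        θ≃0⇒ : θ ≃ 0ᵣ → x ≃ y
        θ≃0⇒ e = sym (x-y≃0⇒x≃y (begin
          y - x                 ≈⟨ solve 1 (λ d → d := d :* (con (+ 1) :- con (+ 0))) refl (y - x) ⟩
          (y - x) * (1ᵣ - 0ᵣ)   ≈⟨ *-congˡ (+-congˡ (-‿cong e)) ⟨
          (y - x) * (1ᵣ - θ)    ≈⟨ product≃0 ⟩
          0ᵣ                    ∎))
        θ≃1⇒ : θ ≃ 1ᵣ → PosUnit (y - x)
        θ≃1⇒ e = inverse⇒PosUnit {s = S} (sorted i j (ℕₚ.<⇒≤ i<j)) e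

  PosUnit-resp : ∀ {x y} → x ≃ y → PosUnit x → PosUnit y
  PosUnit-resp x≃y (0≤x , s , 0≤s , sx≃1) = NonNeg-resp x≃y 0≤x , s , 0≤s , trans (*-congˡ (sym x≃y)) sx≃1

  PosUnit⇒Regular : ∀ {x} → PosUnit x → Regular x
  PosUnit⇒Regular {x} (_ , s , _ , sx≃1) z xz≃0 = begin
    z              ≈⟨ trans (sym (*-identityˡ z)) (*-congʳ (sym sx≃1)) ⟩
    s * x * z      ≈⟨ *-assoc s x z ⟩
    s * (x * z)    ≈⟨ *-congˡ xz≃0 ⟩
    s * 0ᵣ         ≈⟨ zeroʳ s ⟩
    0ᵣ             ∎

  record Decomposition {n} (v : Vector ℝ (suc n)) (w : Vector ℝ n) (δ : GcdData v) : Set where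
    open GcdData δ
    field
      m            : ℕ
      degree≡      : r ≡ suc m
      u            : Vector ℝ (suc m)
      u-increasing : StrictlyIncreasing u
      min≋         : min ≋ linears u
      γ            : Vector ℝ (suc m)
      0≤γ          : ∀ j → 0ᵣ ≤ᵣ γ j
      linears-w≋   : linears w ≋ combination γ u ⊛ g

  decompose : ∀ {n} (v : Vector ℝ (suc n)) (w : Vector ℝ n) → WeaklyIncreasing v →
    (∀ i → v (inject₁ i) ≤ᵣ w i × w i ≤ᵣ v (suc i)) → (δ : GcdData v) → (let open GcdData δ) →
    ∀ A B → A ⊛ min ⊕ B ⊛ deriv min ≋ 1ᵣ ∷ [] → Decomposition v w δ
  decompose v w increasing inter δ A B bezout =
    assemble (group-sorted v sorted PosUnit-resp (compare-roots sorted δ A B bezout))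
    where
    open GcdData δ
    sorted : Sorted v
    sorted i j i≤j = ≤ᵣ⇒NonNeg (increasing i j i≤j)
    assemble : ∃[ m ] Σ[ u ∈ Vector ℝ (suc m) ] Grouped PosUnit v u → Decomposition v w δ
    assemble (m , u , grouped) = add-γ
        (interlacing-combination grouped w λ i → ≤ᵣ⇒NonNeg (proj₁ (inter i)) , ≤ᵣ⇒NonNeg (proj₂ (inter i)))
      where
      -- The identification of min and g once more, now for a grouping that exists outright.
      open Separation (separate PosUnit⇒Regular grouped (weights-regular grouped) δ)
      add-γ : Σ[ γ ∈ Vector ℝ (suc m) ]
          ((∀ j → NonNeg (γ j)) × linears w ≋ combination γ u ⊛ cofactor grouped) → Decomposition v w δ
      add-γ (γ , 0≤γ , eq) = record
        { m = m ; degree≡ = degree≡ ; u = u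
        ; u-increasing = λ i j i<j → PosUnit⇒< (Grouped-apart grouped i j i<j)
        ; min≋ = min≋ ; γ = γ ; 0≤γ = 0≤γ
        ; linears-w≋ = ≋-trans eq (⊛-congˡ (combination γ u) (≋-sym g≋cofactor)) }

-- Transfer between ℤ, the field of fractions K and ℝ.

module Algebraic (K : CommutativeRing 0ℓ 0ℓ)
  (κ : CommutativeRing.Carrier K → ℝ)
  (κ-hom : RingMorphisms.IsRingHomomorphism (CommutativeRing.rawRing K) ℝ-rawRing κ)
  (κ-injective : ∀ {a b} → κ a ≃ κ b → CommutativeRing._≈_ K a b)
  (ι : ℤ → CommutativeRing.Carrier K)
  (ι-hom : RingMorphisms.IsRingHomomorphism ℤ-rawRing (CommutativeRing.rawRing K) ι)
  (ι-injective : ∀ {i j} → CommutativeRing._≈_ K (ι i) (ι j) → i ≡ j)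
  (invert : InverseOrZero K)
  (fraction : ∀ a → ∃[ D ] ∃[ i ]
      (ℕ.NonZero D × CommutativeRing._≈_ K (CommutativeRing._*_ K (ι (+ D)) a) (ι i))) where
  open RealField using (realRing; 1≄0)
  private
    module Z where
      open PolynomialRing ℤₚ.+-*-commutativeRing public
      open PolynomialDegree ℤₚ.+-*-commutativeRing public
    module R where
      open CommutativeRing realRing public
      open PolynomialRing realRing public
      open PolynomialDegree realRing public
      open RootVectors realRing public
      open RepeatedRoots realRing 1≄0 public
      open SortedGrouping realRing RealField.realNonnegativity public using (Sorted)
      open RealRoots public
    module K = CommutativeRing K
    module ι where
      open PolynomialMap ℤₚ.+-*-commutativeRing K ι ι-hom public
      open Injective ι-injective public
    module κ where
      open PolynomialMap K realRing κ κ-hom public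
      open Injective κ-injective public
    module κ-hom = RingMorphisms.IsRingHomomorphism κ-hom
  open PolynomialRing K
  open PolynomialDegree K
  open EuclideanAlgorithm K invert
  open GaussLemma K ι ι-hom ι-injective invert fraction using (monic-factor-integral)
  open PolynomialSolver using (solveₚ; _⊜_; _:⊕_; _:⊛_)

  1≉0 : ¬ (K.1# K.≈ K.0#)
  1≉0 e = 1≄0 (R.trans (R.sym κ-hom.1#-homo) (R.trans (κ-hom.⟦⟧-cong e) κ-hom.0#-homo))

  open RepeatedRoots K 1≉0 using (degree-⊛)

  -- `IsRootList` admits any nonzero leading constant; comparing the coefficients of x^n forces it
  -- to be 1.
  rootList-monic : ∀ {n} {p : R.Poly} {v : Vector ℝ n} → R.MonicOf p n → IsRootList p v → p R.≋ R.linears v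
  rootList-monic {n} {p} {v} mp (_ , c , _ , p≋) = R.≋-trans p≋
      (R.≋-trans (R.scale-congʳ (R.linears v) c≃1) (R.scale-1 (R.linears v)))
    where
    mv = R.MonicOf-linears v
    c≃1 : c ≃ 1ᵣ
    c≃1 = R.trans (R.sym (R.*-identityʳ c)) (R.trans (R.*-congˡ (R.sym (R.leading mv)))
      (R.trans (R.sym (R.coeff-scale c (R.linears v) n)) (R.trans (R.sym (R.coeff≈ p≋ n)) (R.leading mp))))

  record Conclusion (p q : Z.Poly) (g Min : Poly) (n r : ℕ) : Set where
    field
      m            : ℕ
      degree≡      : r ≡ suc m
      r≤n          : r ℕ.≤ n
      f            : Z.Poly
      f-monic      : Z.MonicOf f m
      q≋fg         : ι.mapₚ q ≋ ι.mapₚ f ⊛ g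
      u            : Vector ℝ (suc m)
      u-increasing : StrictlyIncreasing u
      Min≋         : κ.mapₚ Min R.≋ R.linears u
      γ            : Vector ℝ (suc m)
      0≤γ          : ∀ j → 0ᵣ ≤ᵣ γ j
      f≋           : κ.mapₚ (ι.mapₚ f) R.≋ R.combination γ u

  module _ {n} (p : Z.Poly) (p-monic : Z.MonicOf p (suc n)) (q : Z.Poly) (q-monic : Z.MonicOf q n)
    (g : Poly) (gcd : IsMonicGCD g (ι.mapₚ p) (deriv (ι.mapₚ p)))
    (Min : Poly) (p≋Min⊛g : ι.mapₚ p ≋ Min ⊛ g) (r : ℕ) (Min-degree : HasDegree Min r) where

    private
      pK = ι.mapₚ p
      pK-monic : MonicOf pK (suc n)
      pK-monic = ι.MonicOf-map p-monic

      l : ℕ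
      l = proj₁ (IsMonicGCD.monic gcd)
      g-monic : MonicOf g l
      g-monic = let _ , (_ , high) , lead = IsMonicGCD.monic gcd in monicOf lead (mkBelow high)

      p≋g⊛Min : pK ≋ g ⊛ Min
      p≋g⊛Min = ≋-trans p≋Min⊛g (⊛-comm Min g)
      1+n≡l+r : suc n ≡ l ℕ.+ r
      1+n≡l+r = degree-⊛ pK-monic g-monic Min-degree p≋g⊛Min
      Min-monic : MonicOf Min r
      Min-monic = MonicOf-quotient Min g-monic (MonicOf-resp p≋g⊛Min (≡.subst (MonicOf pK) 1+n≡l+r pK-monic))

      -- The derivative is put first because the algorithm divides by its second argument, which has
      -- to be monic.
      module B₁ = Bezout (bezout (deriv pK) pK pK-monic)
      module B₂ = Bezout (bezout (deriv Min) Min Min-monic)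

      -- Maximality of g is applied to the gcd that Euclid's algorithm found; multiplying the Bézout
      -- identity by e then exhibits g itself as a combination of p′ and p.
      g-multiple : B₁.gcd ∣ₚ g
      g-multiple = IsMonicGCD.greatest gcd B₁.gcd B₁.gcd∣ʳ B₁.gcd∣ˡ
      e = proj₁ g-multiple
      g-identity : g ≋ (e ⊛ B₁.s) ⊛ deriv pK ⊕ (e ⊛ B₁.t) ⊛ pK
      g-identity = ≋-trans (proj₂ g-multiple) (≋-trans (⊛-congʳ e B₁.identity)
        (solveₚ 5 (λ s t P p e → (s :⊛ P :⊕ t :⊛ p) :⊛ e ⊜ (e :⊛ s) :⊛ P :⊕ (e :⊛ t) :⊛ p) ≋-refl B₁.s B₁.t
          (deriv pK) pK e))
      h = proj₁ (IsMonicGCD.divides₂ gcd)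
      deriv≋ : deriv pK ≋ h ⊛ g
      deriv≋ = ≋-trans (proj₂ (IsMonicGCD.divides₂ gcd)) (⊛-comm g h)

      map-combination : ∀ a b c d → κ.mapₚ (a ⊛ b ⊕ c ⊛ d) R.≋ κ.mapₚ a R.⊛ κ.mapₚ b R.⊕ κ.mapₚ c R.⊛ κ.mapₚ d
      map-combination a b c d = R.≋-trans (κ.map-⊕ (a ⊛ b) (c ⊛ d)) (R.⊕-cong (κ.map-⊛ a b) (κ.map-⊛ c d))

      gcdData : ∀ {v : Vector ℝ (suc n)} → κ.mapₚ pK R.≋ R.linears v → R.GcdData v
      gcdData {v} p≋v = record
        { min = κ.mapₚ Min ; g = κ.mapₚ g ; h = κ.mapₚ h ; s = κ.mapₚ (e ⊛ B₁.s) ; t = κ.mapₚ (e ⊛ B₁.t)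
        ; r = r ; l = l ; min-monic = κ.MonicOf-map Min-monic ; g-monic = κ.MonicOf-map g-monic
        ; linears≋ = R.≋-trans (R.≋-sym p≋v) (R.≋-trans (κ.map-cong p≋Min⊛g) (κ.map-⊛ Min g))
        ; deriv-linears≋ = R.≋-trans (R.≋-sym deriv-p≋v) (R.≋-trans (κ.map-cong deriv≋) (κ.map-⊛ h g))
        ; g≋ = R.≋-trans (κ.map-cong g-identity)
            (R.≋-trans (map-combination (e ⊛ B₁.s) (deriv pK) (e ⊛ B₁.t) pK)
            (R.⊕-cong (R.⊛-congˡ (κ.mapₚ (e ⊛ B₁.s)) deriv-p≋v) (R.⊛-congˡ (κ.mapₚ (e ⊛ B₁.t)) p≋v))) }
        where
        deriv-p≋v : κ.mapₚ (deriv pK) R.≋ R.deriv (R.linears v)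
        deriv-p≋v = R.≋-trans (κ.map-deriv pK) (R.deriv-cong p≋v)

      -- The gcd of Min and Min′ is computed over K, and its image over ℝ reveals its degree: it is
      -- monic of degree 0, hence 1.
      Min-bezout : ∀ {v : Vector ℝ (suc n)} → R.Sorted v → (p≋v : κ.mapₚ pK R.≋ R.linears v) →
        κ.mapₚ B₂.t R.⊛ κ.mapₚ Min R.⊕ κ.mapₚ B₂.s R.⊛ R.deriv (κ.mapₚ Min) R.≋ 1ᵣ ∷ []
      Min-bezout sorted p≋v = R.≋-trans (R.⊕-comm (κ.mapₚ B₂.t R.⊛ κ.mapₚ Min) _) (R.≋-trans
        (R.⊕-cong (R.⊛-congˡ (κ.mapₚ B₂.s) (R.≋-sym (κ.map-deriv Min))) (R.≋-refl {κ.mapₚ B₂.t R.⊛ κ.mapₚ Min}))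
        (R.≋-trans (R.≋-sym (map-combination B₂.s (deriv Min) B₂.t Min))
            (R.≋-trans (κ.map-cong (≋-sym B₂.identity))
          (R.MonicOf-unit (≡.subst (R.MonicOf (κ.mapₚ B₂.gcd)) degree≡0 gcd-monic)))))
        where
        gcd-monic = κ.MonicOf-map B₂.gcd-monic
        degree≡0 : B₂.degree ≡ 0
        degree≡0 = R.min-separable sorted (gcdData p≋v) gcd-monic
          (R.≋-trans (κ.map-cong (proj₂ B₂.gcd∣ʳ)) (κ.map-⊛ B₂.gcd (proj₁ B₂.gcd∣ʳ)))
          (R.≋-trans (R.≋-sym (κ.map-deriv Min))
              (R.≋-trans (κ.map-cong (proj₂ B₂.gcd∣ˡ)) (κ.map-⊛ B₂.gcd (proj₁ B₂.gcd∣ˡ))))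

      qK = ι.mapₚ q

      -- Division by the monic g has the same quotient and remainder over K and over ℝ.
      descend-quotient : ∀ c → κ.mapₚ qK R.≋ c R.⊛ κ.mapₚ g → ∃[ s ] (qK ≋ g ⊛ s × κ.mapₚ s R.≋ c)
      descend-quotient c q≋cg with divide qK g-monic
      ... | s , t , q≋ , t-below = s , q≋gs , R.≋-sym c≋s
        where
        G = κ.mapₚ g
        S = κ.mapₚ s
        T = κ.mapₚ t
        module Rₛ = R.PolynomialSolver
        G⊛difference : G R.⊛ (c R.⊕ R.neg S) R.≋ T
        G⊛difference = R.≋-trans
          (Rₛ.solveₚ 3 (λ G c S → G Rₛ.:⊛ (c Rₛ.:⊖ S) Rₛ.⊜ c Rₛ.:⊛ G Rₛ.:⊖ G Rₛ.:⊛ S) R.≋-refl G c S)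
          (R.≋-trans (R.⊕-cong (R.≋-trans (R.≋-sym q≋cg)
              (R.≋-trans (κ.map-cong q≋) (R.≋-trans (κ.map-⊕ (g ⊛ s) t) (R.⊕-cong (κ.map-⊛ g s) R.≋-refl))))
                  R.≋-refl)
            (Rₛ.solveₚ 2 (λ x y → (x Rₛ.:⊕ y) Rₛ.:⊖ x Rₛ.⊜ y) R.≋-refl (G R.⊛ S) T))
        difference≋[] : c R.⊕ R.neg S R.≋ []
        difference≋[] = R.Below-0 (R.Below-cancel (c R.⊕ R.neg S) (κ.MonicOf-map g-monic)
          (R.Below-resp (R.≋-sym G⊛difference)
              (≡.subst (R.Below T) (≡.sym (ℕₚ.+-identityʳ l)) (κ.Below-map t-below))))
        c≋s : c R.≋ S
        c≋s = R.⊖≋[]⇒≋ difference≋[]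
        t≋[] : t ≋ []
        t≋[] = κ.map-injective (R.≋-trans (R.≋-sym G⊛difference)
            (R.≋-trans (R.⊛-congˡ G difference≋[]) (R.⊛-zeroʳ G)))
        q≋gs : qK ≋ g ⊛ s
        q≋gs = ≋-trans q≋ (≋-trans (⊕-cong (≋-refl {g ⊛ s}) t≋[]) (⊕-identityʳ _))

    interlacing-conclusion : Interlaces n (κ.mapₚ qK) (κ.mapₚ pK) → Conclusion p q g Min (suc n) r
    interlacing-conclusion (v , w , v-roots@(v-sorted , _) , w-roots , inter) = conclude
      (R.decompose v w v-sorted inter (gcdData p≋v) (κ.mapₚ B₂.t) (κ.mapₚ B₂.s)
        (Min-bezout (λ i j i≤j → RealField.≤ᵣ⇒NonNeg (v-sorted i j i≤j)) p≋v))
      where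
      p≋v : κ.mapₚ pK R.≋ R.linears v
      p≋v = rootList-monic (κ.MonicOf-map pK-monic) v-roots
      q≋w : κ.mapₚ qK R.≋ R.linears w
      q≋w = rootList-monic (κ.MonicOf-map (ι.MonicOf-map q-monic)) w-roots
      conclude : R.Decomposition v w (gcdData p≋v) → Conclusion p q g Min (suc n) r
      conclude D = integral (descend-quotient (R.combination D.γ D.u) (R.≋-trans q≋w D.linears-w≋))
        where
        module D = R.Decomposition D
        n≡l+m : n ≡ l ℕ.+ D.m
        n≡l+m = ℕₚ.suc-injective (≡.trans 1+n≡l+r (≡.trans (≡.cong (l ℕ.+_) D.degree≡) (ℕₚ.+-suc l D.m)))
        integral : ∃[ s ] (qK ≋ g ⊛ s × κ.mapₚ s R.≋ R.combination D.γ D.u) → Conclusion p q g Min (suc n) r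
        -- Both s and g are monic over K and their product is the integer polynomial q, so Gauss's
        -- lemma applies to s.
        integral (s , q≋gs , s≋) = finish (monic-factor-integral q s-monic g-monic (≋-trans q≋gs (⊛-comm g s)))
          where
          s-monic : MonicOf s D.m
          s-monic = MonicOf-quotient s g-monic
              (MonicOf-resp q≋gs (≡.subst (MonicOf qK) n≡l+m (ι.MonicOf-map q-monic)))
          finish : ∃[ f ] (ι.mapₚ f ≋ s) → Conclusion p q g Min (suc n) r
          finish (f , f≋s) = record
            { m = D.m ; degree≡ = D.degree≡
            ; r≤n = ≡.subst (r ℕ.≤_) (≡.sym 1+n≡l+r) (ℕₚ.m≤n+m r l)
            ; f = f ; f-monic = ι.MonicOf-unmap (MonicOf-resp (≋-sym f≋s) s-monic)
            ; q≋fg = ≋-trans q≋gs (≋-trans (⊛-comm g s) (⊛-congʳ g (≋-sym f≋s)))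
            ; u = D.u ; u-increasing = D.u-increasing ; Min≋ = D.min≋
            ; γ = D.γ ; 0≤γ = D.0≤γ
            ; f≋ = R.≋-trans (κ.map-cong f≋s) s≋ }

-- The instance K = ℚ.

module RationalEmbedding where
  open RealField

  ℚ→ℝ-hom : RingMorphisms.IsRingHomomorphism ℚ-rawRing ℝ-rawRing ℚ→ℝ
  ℚ→ℝ-hom = record
    { isSemiringHomomorphism = record
      { isNearSemiringHomomorphism = record
        { +-isMonoidHomomorphism = record
          { isMagmaHomomorphism = record
            { isRelHomomorphism = record { cong = λ { ≡.refl → ≃-refl } }
            ; homo = λ _ _ → ≃-pointwise λ _ → ≡.refl }
          ; ε-homo = ≃-refl }
        ; *-homo = λ _ _ → ≃-pointwise λ _ → ≡.refl }
      ; 1#-homo = ≃-refl }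
    ; -‿homo = λ _ → ≃-pointwise λ _ → ≡.refl }

  -- For a ≢ b the two constant sequences stay at distance |a - b|, and this positive number itself
  -- is a tolerance that they violate.
  ℚ→ℝ-injective : ∀ {a b} → ℚ→ℝ a ≃ ℚ→ℝ b → a ≡ b
  ℚ→ℝ-injective {a} {b} e = decidable-stable (a ℚₚ.≟ b) λ a≢b →
    never (close e ℚ.∣ a ℚ.- b ∣ (ℚₚ.≰⇒> λ ∣a-b∣≤0 → a≢b (x∙y⁻¹≈ε⇒x≈y a b
      (ℚₚ.∣p∣≡0⇒p≡0 (a ℚ.- b) (ℚₚ.≤-antisym ∣a-b∣≤0 (ℚₚ.0≤∣p∣ (a ℚ.- b)))))))
      λ _ → ℚₚ.<-irrefl ≡.refl
    where open import Algebra.Properties.Group ℚₚ.+-0-group using (x∙y⁻¹≈ε⇒x≈y)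

  invertℚ : InverseOrZero ℚₚ.+-*-commutativeRing
  invertℚ a with a ℚₚ.≟ 0ℚ
  ... | yes a≡0 = inj₁ a≡0
  ... | no  a≢0 = inj₂ (a≢0 , (ℚ.1/ a) {{ℚ.≢-nonZero a≢0}} , ℚₚ.*-inverseʳ a {{ℚ.≢-nonZero a≢0}})

  open Embedding

  fractionℚ : ∀ a → ∃[ D ] ∃[ i ] (ℕ.NonZero D × ℤ→ℚ (+ D) ℚ.* a ≡ ℤ→ℚ i)
  fractionℚ a = ℚ.↧ₙ a , ℚ.↥ a , ℚ.nonZero , denominator-* a

  open Algebraic ℚₚ.+-*-commutativeRing ℚ→ℝ ℚ→ℝ-hom ℚ→ℝ-injective ℤ→ℚ ℤ→ℚ-hom ℤ→ℚ-injective invertℚ fractionℚ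
      public

-- Assembling the theorem.

private
  module Z where
    open PolynomialRing ℤₚ.+-*-commutativeRing public
    open PolynomialDegree ℤₚ.+-*-commutativeRing public
  module R where
    open CommutativeRing RealField.realRing public
    open PolynomialRing RealField.realRing public
    open PolynomialDegree RealField.realRing public
    open LagrangeSums RealField.realRing public
  module κ = PolynomialMap ℚₚ.+-*-commutativeRing RealField.realRing ℚ→ℝ RationalEmbedding.ℚ→ℝ-hom
  module ι = PolynomialMap ℤₚ.+-*-commutativeRing ℚₚ.+-*-commutativeRing ℤ→ℚ Embedding.ℤ→ℚ-hom

SeidelTrace⇒MonicOf : ∀ {n p} → SeidelTrace n p → Z.MonicOf p n
SeidelTrace⇒MonicOf T = Z.monicOf (SeidelTrace.a₀ T) (Z.mkBelow (proj₂ (SeidelTrace.degree T)))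

-- Root lists and interlacing are stated for the direct passage from ℤ to ℝ, while the gcd forces a
-- stop at ℚ.
ℤ[x]→ℝ[x]-via-ℚ : ∀ p → ℤ[x]→ℝ[x] p ≡ ℚ[x]→ℝ[x] (ℤ[x]→ℚ[x] p)
ℤ[x]→ℝ[x]-via-ℚ = Listₚ.map-∘

theorem4p4 : (n : ℕ) → 2 ≤ n →
    (p : ℤ[x].Poly) → SeidelTrace n p →
    (g : ℚ[x].Poly) → ℚ[x].IsMonicGCD g (ℤ[x]→ℚ[x] p) (ℚ[x].deriv (ℤ[x]→ℚ[x] p)) →
    (Min : ℚ[x].Poly) → ℤ[x]→ℚ[x] p ℚ[x].≋ Min ℚ[x].⊛ g →
    (r : ℕ) → ℚ[x].HasDegree Min r →
    (q : ℤ[x].Poly) → 𝒥 n p q →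
    (1 ≤ r × r ≤ n) ×
    (Σ[ f ∈ ℤ[x].Poly ]
    (ℤ[x]→ℚ[x] q ℚ[x].≋ ℤ[x]→ℚ[x] f ℚ[x].⊛ g) ×
    ℤ[x].HasDegree (ℤ[x].shift f) (r ∸ 1) ×
    (Σ[ v ∈ Vector ℝ r ]
    StrictlyIncreasing v ×
    (ℚ[x]→ℝ[x] Min ℝ[x].≋ ∏[x- v ]) ×
    (Σ[ γ ∈ Vector ℝ r ]
    (∀ j → 0ᵣ ≤ᵣ γ j) ×
    (∀ (i : Fin (suc (r ∸ 1))) →
    ℝ[x].coeffs (r ∸ 1) (ℤ[x]→ℝ[x] (ℤ[x].shift f)) i
    ≃ ∑ (λ j → γ j *ᵣ ℝ[x].coeffs (r ∸ 1) (ℝ[x].shift (Minⱼ v j)) i)))))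
theorem4p4 (suc n) 2≤n p p∈𝒯 g gcd Min p≋Min⊛g r Min-degree q (q∈𝒯 , q-interlaces-p) =
  unpack (RationalEmbedding.interlacing-conclusion p (SeidelTrace⇒MonicOf p∈𝒯) q (SeidelTrace⇒MonicOf q∈𝒯) g
      gcd Min p≋Min⊛g r Min-degree
    (≡.subst₂ (Interlaces n) (ℤ[x]→ℝ[x]-via-ℚ q) (ℤ[x]→ℝ[x]-via-ℚ p) q-interlaces-p))
  where
  unpack : RationalEmbedding.Conclusion p q g Min (suc n) r → _
  -- Matching on `degree≡` turns r into `suc m`, so that `r ∸ 1` becomes m, the degree of f, and r ≥
  -- 1 is immediate.
  unpack record { m = m ; degree≡ = ≡.refl ; r≤n = r≤n ; f = f ; f-monic = f-monic ; q≋fg = q≋fg ; u = u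
                ; u-increasing = u-increasing ; Min≋ = Min≋ ; γ = γ ; 0≤γ = 0≤γ ; f≋ = f≋ } =
    (s≤s z≤n , r≤n) , f , q≋fg , shift-degree , u , u-increasing , Min≋ , γ , 0≤γ ,
    -- Entry i of a coefficient vector is the coefficient of x^(m - i); the resulting sum is the
    -- required one because `omit u j` computes to `Minⱼ u j`.
    λ i → R.trans (R.coeff≈ shift≋ (m ∸ Fin.toℕ i)) (R.coeff-shift-combination γ u (m ∸ Fin.toℕ i))
    where
    shift-monic : Z.MonicOf (ℤ[x].shift f) m
    shift-monic = Z.MonicOf-shift f f-monic
    shift-degree : ℤ[x].HasDegree (ℤ[x].shift f) m
    shift-degree = (λ lead≡0 → 1≢0 (≡.trans (≡.sym (Z.leading shift-monic)) lead≡0)) , Z.vanishes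
        (Z.below shift-monic)
      where
      1≢0 : + 1 ≢ + 0
      1≢0 ()
    shift≋ : ℤ[x]→ℝ[x] (ℤ[x].shift f) R.≋ R.shift (RootVectors.combination RealField.realRing γ u)
    shift≋ = ≡.subst (R._≋ R.shift (RootVectors.combination RealField.realRing γ u))
        (≡.sym (ℤ[x]→ℝ[x]-via-ℚ (ℤ[x].shift f)))
      (R.≋-trans (κ.map-cong (ι.map-shift f)) (R.≋-trans (κ.map-shift (ℤ[x]→ℚ[x] f)) (R.∘ₚ-congʳ (R.x- 1ᵣ) f≋)))
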